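{- ${\rm CLU\#P} = {\rm CL\#P}$.
   Context: Alphabet $\Sigma=\{0,1\}$; NPTM means nondeterministic polynomial-time Turing machine. For a polynomial $p$, an NPTM $M$ is $p$-balanced if on every input $x$ the set of nondeterministic guess sequences of its computation paths is exactly $\{0,1\}^{p(|x|)}$; a computation path is identified with its guess string. $\mathrm{acc}_M(x)$ is the set of accepting paths of $M$ on $x$ and $\#\mathrm{acc}_M(x)=|\mathrm{acc}_M(x)|$. ${\rm FP}_{\rm t}$ is the class of total polynomial-time computable functions. For strings $a,b$ of the same length, $a\prec_{\rm lex} b$ means $b$ is the immediate lexicographic successor of $a$, and $\le_{\rm lex}$ is lexicographic order. ${\rm CLU\#P}$: a total function $f:\Sigma^*\to\mathbb{N}$ is in ${\rm CLU\#P}$ if there exist a polynomial $p$, a $p$-balanced NPTM $M$, functions $b,t\in{\rm FP}_{\rm t}$, and a polynomial-time computable 3-argument predicate $\prec$ such that for every $x$ there is a bijection $h_x:\Sigma^{p(|x|)}\to\Sigma^{p(|x|)}$ with: (1) $|b(x)|=|t(x)|=p(|x|)$; (2) $h_x(b(x))=0^{p(|x|)}$ and $h_x(t(x))=1^{p(|x|)}$; (3) for all $y,z\in\{0,1\}^{p(|x|)}$, $\prec(x,y,z)$ holds iff $h_x(y)\prec_{\rm lex}h_x(z)$; (4) if $f(x)\ne0$ then there are $\ell,u\in\{0,1\}^{p(|x|)}$ with $\mathrm{acc}_M(x)=\{w\in\{0,1\}^{p(|x|)}: h_x(\ell)\le_{\rm lex}h_x(w)\le_{\rm lex}h_x(u)\}$;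 (5) $f(x)=\#\mathrm{acc}_M(x)$. ${\rm CL\#P}$: A total order $A$ on $\Sigma^*$ is length-respecting if $|x|<|y|$ implies $x<_A y$. Write $x\prec_A y$ if $x<_A y$ and no $z$ satisfies $x<_A z<_A y$; $A$ has efficient adjacency checks if the relation $x\prec_A y$ is decidable in polynomial time. For a $p$-balanced NPTM $M$ and input $x$, for paths $y,z$ let $y\sim_{A,M,x}z$ iff ($y\prec_A z$ or $z\prec_A y$) and ($M$ accepts $x$ on $y$ iff $M$ accepts $x$ on $z$); let $\equiv_{A,M,x}$ be its reflexive-symmetric-transitive closure. An $A$-cluster is an equivalence class of $\equiv_{A,M,x}$ consisting of accepting paths, or the empty set. A function $f$ is in ${\rm CL\#P}$ if there are a polynomial $p$, a $p$-balanced NPTM $M$ and a length-respecting total order $A$ with efficient adjacency checks such that for all $x$, $\mathrm{acc}_M(x)$ is an $A$-cluster and $f(x)=\#\mathrm{acc}_M(x)$. -}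

module Defs where

open import Data.Bool using (Bool; true; false)
open import Data.Nat using (ℕ; zero; suc; _+_; _*_; _^_)
open import Data.Fin using (Fin; zero; suc)
open import Data.List using (List; []; _∷_; _++_; length; concatMap; map; filter)
open import Data.Maybe using (Maybe; just; nothing)
open import Data.Product using (Σ; _×_; _,_; ∃)
open import Data.Sum using (_⊎_)
open import Data.Vec using (Vec; []; _∷_; toList; replicate)
open import Relation.Binary.PropositionalEquality using (_≡_; _≢_)
open import Relation.Nullary using (¬_)
open import Relation.Nullary.Decidable using (does)
open import Data.Bool.Properties using (_≟_)
open import Function.Bundles using (_⇔_; _⤖_; Bijection)
open import Relation.Binary.Construct.Closure.Equivalence using (EqClosure)

-- Strings over Σ = {0,1}: false = 0, true = 1.

Str : Set
Str = List Bool

Poly : Set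
Poly = List ℕ

eval : Poly → ℕ → ℕ
eval []       n = 0
eval (c ∷ cs) n = c + n * eval cs n

-- Deterministic single-tape Turing machines.
-- Tape alphabet Fin (3 + k): zero = blank, 1 = bit 0, 2 = bit 1, others extra.
-- States Fin (suc Q); start state zero.  δ returning nothing = halt.

data Dir : Set where
  L R S : Dir

record TM : Set where
  field
    Q : ℕ
    k : ℕ
    δ : Fin (suc Q) → Fin (3 + k) → Maybe (Fin (suc Q) × Fin (3 + k) × Dir)

module _ (M : TM) where
  open TM M

  Sym : Set
  Sym = Fin (3 + k)

  blank : Sym
  blank = zero

  encBit : Bool → Sym
  encBit false = suc zero
  encBit true  = suc (suc zero)

  -- state, left part (nearest cell first), scanned symbol, right part
  record Config : Set where
    constructor cfg
    field
      state : Fin (suc Q)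
      left  : List Sym
      head  : Sym
      right : List Sym

  initial : Str → Config
  initial []      = cfg zero [] blank []
  initial (b ∷ w) = cfg zero [] (encBit b) (map encBit w)

  readBits : List Sym → Str
  readBits [] = []
  readBits (zero ∷ _) = []
  readBits (suc zero ∷ s) = false ∷ readBits s
  readBits (suc (suc zero) ∷ s) = true ∷ readBits s
  readBits (suc (suc (suc _)) ∷ _) = []

  output : Config → Str
  output (cfg _ _ h r) = readBits (h ∷ r)

  move : Fin (suc Q) → List Sym → Sym → List Sym → Dir → Config
  move q l s r S = cfg q l s r
  move q [] s r L = cfg q [] blank (s ∷ r)
  move q (a ∷ l) s r L = cfg q l a (s ∷ r)
  move q l s [] R = cfg q (s ∷ l) blank []
  move q l s (a ∷ r) R = cfg q (s ∷ l) a r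

  runFor : ℕ → Config → Maybe Str
  runFor t c@(cfg q l h r) with δ q h
  ... | nothing = just (output c)
  runFor zero    (cfg q l h r) | just _ = nothing
  runFor (suc t) (cfg q l h r) | just (q' , s , d) = runFor t (move q' l s r d)

PolyTimeFun : (Str → Str) → Set
PolyTimeFun g = Σ TM λ M → Σ ℕ λ c →
  ∀ x → runFor M (length x ^ c + c) (initial M x) ≡ just (g x)

pair : Str → Str → Str
pair x y = concatMap (λ b → b ∷ b ∷ []) x ++ (false ∷ true ∷ []) ++ y

PolyTimePred₁ : (Str → Bool) → Set
PolyTimePred₁ P = Σ (Str → Str) λ g → PolyTimeFun g × (∀ x → g x ≡ P x ∷ [])

PolyTimePred₂ : (Str → Str → Bool) → Set
PolyTimePred₂ P = Σ (Str → Str) λ g → PolyTimeFun g ×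
  (∀ x y → g (pair x y) ≡ P x y ∷ [])

PolyTimePred₃ : (Str → Str → Str → Bool) → Set
PolyTimePred₃ P = Σ (Str → Str) λ g → PolyTimeFun g ×
  (∀ x y z → g (pair x (pair y z)) ≡ P x y z ∷ [])

-- p-balanced NPTMs.  A p-balanced NPTM is given by its polynomial p and
-- its (deterministic, polynomial-time) acceptance predicate V on
-- (input, guess string): M accepts x on path y ∈ {0,1}^{p(|x|)} iff V x y.

record BalancedNPTM : Set where
  field
    p   : Poly
    V   : Str → Str → Bool
    V-poly : PolyTimePred₂ V

  m : Str → ℕ
  m x = eval p (length x)

  Path : Str → Set
  Path x = Vec Bool (m x)

  Acc : (x : Str) → Path x → Set
  Acc x y = V x (toList y) ≡ true

allVecs : (n : ℕ) → List (Vec Bool n)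
allVecs zero    = [] ∷ []
allVecs (suc n) = map (false ∷_) (allVecs n) ++ map (true ∷_) (allVecs n)

#acc : BalancedNPTM → Str → ℕ
#acc M x = length (filter (λ y → V x (toList y) ≟ true) (allVecs (m x)))
  where open BalancedNPTM M

data _<lex_ : {n : ℕ} → Vec Bool n → Vec Bool n → Set where
  here  : ∀ {n} {xs ys : Vec Bool n} → (false ∷ xs) <lex (true ∷ ys)
  there : ∀ {n a} {xs ys : Vec Bool n} → xs <lex ys → (a ∷ xs) <lex (a ∷ ys)

_≤lex_ : {n : ℕ} → Vec Bool n → Vec Bool n → Set
a ≤lex b = a <lex b ⊎ a ≡ b

_≺lex_ : {n : ℕ} → Vec Bool n → Vec Bool n → Set
a ≺lex b = a <lex b × ¬ (∃ λ c → a <lex c × c <lex b)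

CLU#P : (Str → ℕ) → Set
CLU#P f = Σ BalancedNPTM λ M → let open BalancedNPTM M in
  Σ (Str → Str) λ b → Σ (Str → Str) λ t → Σ (Str → Str → Str → Bool) λ pr →
  PolyTimeFun b × PolyTimeFun t × PolyTimePred₃ pr ×
  (∀ x → Σ (Path x ⤖ Path x) λ hx → let h = Bijection.to hx in
     (Σ (Path x) λ b' → toList b' ≡ b x × h b' ≡ replicate (m x) false) ×
     (Σ (Path x) λ t' → toList t' ≡ t x × h t' ≡ replicate (m x) true) ×
     (∀ (y z : Path x) → (pr x (toList y) (toList z) ≡ true) ⇔ (h y ≺lex h z)) ×
     (f x ≢ 0 → Σ (Path x) λ ℓ → Σ (Path x) λ u →
        ∀ w → Acc x w ⇔ (h ℓ ≤lex h w × h w ≤lex h u)) ×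
     f x ≡ #acc M x)

record LROrder : Set₁ where
  field
    _<A_   : Str → Str → Set
    irrefl : ∀ x → ¬ (x <A x)
    trans  : ∀ {x y z} → x <A y → y <A z → x <A z
    total  : ∀ x y → x ≢ y → x <A y ⊎ y <A x
    length-respecting : ∀ x y → length x Data.Nat.< length y → x <A y

  _≺A_ : Str → Str → Set
  x ≺A y = x <A y × ¬ (∃ λ z → x <A z × z <A y)

EfficientAdj : LROrder → Set
EfficientAdj A = Σ (Str → Str → Bool) λ adj → PolyTimePred₂ adj ×
  (∀ x y → (adj x y ≡ true) ⇔ (x ≺A y))
  where open LROrder A

module _ (A : LROrder) (M : BalancedNPTM) (x : Str) where
  open LROrder A
  open BalancedNPTM M

  _∼_ : Path x → Path x → Set
  y ∼ z = (toList y ≺A toList z ⊎ toList z ≺A toList y) × (Acc x y ⇔ Acc x z)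

  _≡AMx_ : Path x → Path x → Set
  _≡AMx_ = EqClosure _∼_

  AccIsCluster : Set
  AccIsCluster = (∀ w → ¬ Acc x w) ⊎
    (Σ (Path x) λ y₀ → (∀ w → w ≡AMx y₀ → Acc x w) × (∀ w → Acc x w ⇔ w ≡AMx y₀))

CL#P : (Str → ℕ) → Set₁
CL#P f = Σ BalancedNPTM λ M → Σ LROrder λ A → EfficientAdj A ×
  (∀ x → AccIsCluster A M x × f x ≡ #acc M x)

{-# OPTIONS --safe #-}
module Submission where

-- CLU#P ⊆ CL#P: the bijections h_x are glued to one order by ranking ⟨x,y⟩, for |y| = p(|x|), like
-- ⟨x,h_x(y)⟩ in the order by length and then lexicographically; all other words keep their place.  Adjacency
-- inside a block ⟨x,·⟩ is the given predicate.  Across the border of a block it can be decided because a block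
-- can only be left at t(x) and entered at b(x).
--
-- CL#P ⊆ CLU#P: the first and the last word of a given length in A cannot be computed, so a word y of length at
-- most N = p(|x|) is represented by the pair ⟨y,z⟩ with y ≺ z, padded to length 3N + 5.  These words come first,
-- from the constant pair for y = ε on; the last of them is recognised by |z| = N + 1, and after it follow all
-- the remaining words, which end in 1…1.
--
-- Polynomial-time functions are composed on stack machines, which a Turing machine simulates with one track per
-- stack.

-- Nor can the neighbours of a word in `A` be computed; only the check whether two given words are
-- neighbours is efficient. Hence the successor is guessed along with the word and verified, and the
-- lengths below N are included because ε is the one word whose place in `A` is known. The delicate
-- part is the remaining words: live words lie scattered among them, yet their adjacency must be
-- decidable. A leading bit achieves this. Words 1v are never live, so in the order by v and then by
-- the leading bit no two live words are neighbours, and the next dead word is found with one test.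
--
-- In the other direction h_x may be hard to compute, but its values at both ends of a block are
-- known and a block consists of consecutive words; so the rank of a border word is computable,
-- although ranks inside need not be. The new machine guesses ⟨x,y⟩ instead of y because a bare y is
-- shared by inputs of equal length whose bijections may order it differently.
--
-- The output on the single tape ends at the first non-bit, so feeding it to another machine means
-- moving and cleaning up; with stacks both are short loops.

open import Data.Bool using (Bool; true; false; _∧_; _∨_; not)
open import Data.Bool.Properties using () renaming (_≟_ to _≟B_)
open import Data.Empty using (⊥; ⊥-elim)
open import Data.Fin using (Fin; zero; suc; funToFin; finToFun; splitAt; join; combine; remQuot; _↑ˡ_; _↑ʳ_)
open import Data.Fin.Properties
  using (finToFun-funToFin; splitAt-join; splitAt-↑ˡ; splitAt-↑ʳ; remQuot-combine; injective⇒≤)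
  renaming (_≟_ to _≟F_)
open import Data.List using (List; []; _∷_; _++_; length; map; filter; _ʳ++_; reverse; replicate; head; drop)
open import Data.List.Membership.Propositional using (_∈_)
open import Data.List.Membership.Propositional.Properties
  using (∈-lookup; ∈-map⁺; ∈-map⁻; ∈-++⁺ˡ; ∈-++⁺ʳ; ∈-filter⁺; ∈-filter⁻)
open import Data.List.Properties
  using (∷-injective; length-map; length-reverse; length-replicate; length-++; map-replicate; map-id; map-++;
         ++-assoc; ++-identityʳ; ++-ʳ++; ʳ++-defn; ʳ++-ʳ++; reverse-involutive; reverse-map; unfold-reverse)
  renaming (≡-dec to ≡-decList)
open import Data.List.Relation.Unary.All as All using (All; []; _∷_)
open import Data.List.Relation.Unary.AllPairs using ([]; _∷_)
open import Data.List.Relation.Unary.Any as Any using (Any)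
open import Data.List.Relation.Unary.Any.Properties using (lookup-index)
open import Data.List.Relation.Unary.Unique.Propositional using (Unique)
open import Data.List.Relation.Unary.Unique.Propositional.Properties using ()
  renaming (map⁺ to map-unique; ++⁺ to ++-unique; filter⁺ to filter-unique)
open import Data.Maybe as Maybe using (Maybe; just; nothing)
open import Data.Nat
open import Data.Nat.Properties
open import Data.Nat.Tactic.RingSolver using (solve-∀)
open import Data.Product using (Σ; Σ-syntax; ∃; _×_; _,_; proj₁; proj₂)
open import Data.Sum as Sum using (_⊎_; inj₁; inj₂)
open import Data.Vec as Vec using (Vec; []; _∷_; lookup; _[_]≔_; toList; fromList)
open import Data.Vec.Properties
  using (lookup∘update; lookup∘update′; lookup-replicate; toList∘fromList; length-toList)
  renaming (≡-dec to ≡-decVec)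
open import Defs
open import Function using (_∘_; id; case_of_)
open import Function.Bundles using (_⇔_; mk⇔; _⤖_; mk⤖; Bijection; Equivalence)
open import Function.Properties.Equivalence using (⇔-isEquivalence)
open import Relation.Binary using (tri<; tri≈; tri>)
import Relation.Binary.Construct.Closure.Equivalence as EqC
open import Relation.Binary.Construct.Closure.ReflexiveTransitive as Star using (Star; _◅_)
open import Relation.Binary.Construct.Closure.Symmetric using (SymClosure; fwd; bwd)
import Relation.Binary.Construct.On as On
open import Relation.Binary.PropositionalEquality
open import Relation.Nullary using (Dec; yes; no; ¬_)
open import Relation.Unary using (Decidable)

-- Polynomial bounds

-- The single exponent d makes the class visibly closed under +, * and composition.
PolyBounded : (ℕ → ℕ) → Set
PolyBounded T = Σ ℕ λ d → ∀ n → T n ≤ (2 + n) ^ d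

1≤2+n^ : ∀ n d → 1 ≤ (2 + n) ^ d
1≤2+n^ n d = m^n>0 (2 + n) d

m≤2^m : ∀ m → m ≤ 2 ^ m
m≤2^m zero = z≤n
m≤2^m (suc m) = begin
  1 + m ≤⟨ +-mono-≤ (m^n>0 2 m) (m≤2^m m) ⟩
  2 ^ m + 2 ^ m ≡⟨ cong (2 ^ m +_) (sym (+-identityʳ (2 ^ m))) ⟩
  2 ^ suc m ∎
  where open ≤-Reasoning

pb-const : ∀ k → PolyBounded (λ _ → k)
pb-const k = k , λ n → ≤-trans (m≤2^m k) (^-monoˡ-≤ k (m≤m+n 2 n))

pb-id : PolyBounded (λ n → n)
pb-id = 1 , λ n → ≤-trans (m≤n+m n 2) (≤-reflexive (sym (*-identityʳ (2 + n))))

pb-* : ∀ {A T} → PolyBounded A → PolyBounded T → PolyBounded (λ n → A n * T n)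
pb-* (a , p) (b , q) = a + b , λ n →
  ≤-trans (*-mono-≤ (p n) (q n)) (≤-reflexive (sym (^-distribˡ-+-* (2 + n) a b)))

x+y≤xy+xy : ∀ {x y} → 1 ≤ x → 1 ≤ y → x + y ≤ x * y + x * y
x+y≤xy+xy {x} {y} 1≤x 1≤y = +-mono-≤
  (≤-trans (≤-reflexive (sym (*-identityʳ x))) (*-monoʳ-≤ x 1≤y))
  (≤-trans (≤-reflexive (sym (*-identityˡ y))) (*-monoˡ-≤ y 1≤x))

-- For x, y ≥ 1 a sum is at most twice the product, and one more factor 2 + n absorbs the 2.
pb-+ : ∀ {A T} → PolyBounded A → PolyBounded T → PolyBounded (λ n → A n + T n)
pb-+ {A} {T} (a , p) (b , q) = suc (a + b) , λ n → begin
  A n + T n                                       ≤⟨ +-mono-≤ (p n) (q n) ⟩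
  (2 + n) ^ a + (2 + n) ^ b                       ≤⟨ x+y≤xy+xy (1≤2+n^ n a) (1≤2+n^ n b) ⟩
  (2 + n) ^ a * (2 + n) ^ b + (2 + n) ^ a * (2 + n) ^ b
    ≡⟨ cong₂ _+_ (sym (^-distribˡ-+-* (2 + n) a b)) (sym (^-distribˡ-+-* (2 + n) a b)) ⟩
  (2 + n) ^ (a + b) + (2 + n) ^ (a + b)           ≤⟨ +-monoʳ-≤ ((2 + n) ^ (a + b)) (m≤m+n _ _) ⟩
  (2 + n) * (2 + n) ^ (a + b)                     ∎
  where open ≤-Reasoning

pb-pow : ∀ {A} d → PolyBounded A → PolyBounded (λ n → (2 + A n) ^ d)
pb-pow {A} zero    s = pb-const 1
pb-pow {A} (suc d) s = pb-* (pb-+ (pb-const 2) s) (pb-pow d s)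

pb-clock : ∀ c → PolyBounded (λ n → n ^ c + c)
pb-clock c = pb-+ (c , λ n → ^-monoˡ-≤ c (m≤n+m n 2)) (pb-const c)

-- The clocks in `PolyTimeFun` have the form n ^ c + c. From n = 2 on, 2 + n ≤ n * n, which doubles
-- the exponent; the additive 3 ^ d covers n = 0 and n = 1, where powers of n do not grow.
pb⇒clock : ∀ {T} → PolyBounded T → Σ ℕ λ c → ∀ n → T n ≤ n ^ c + c
pb⇒clock {T} (d , p) = 3 ^ d + 2 * d , λ n → ≤-trans (p n) (go n)
  where
  c = 3 ^ d + 2 * d
  go : ∀ n → (2 + n) ^ d ≤ n ^ c + c
  go 0 = ≤-trans (^-monoˡ-≤ d (n≤1+n 2)) (≤-trans (m≤m+n (3 ^ d) (2 * d)) (m≤n+m c (0 ^ c)))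
  go 1 = ≤-trans (m≤m+n (3 ^ d) (2 * d)) (m≤n+m c (1 ^ c))
  go n@(suc (suc k)) = begin
    (2 + n) ^ d       ≤⟨ ^-monoˡ-≤ d (+-monoˡ-≤ n (s≤s (s≤s (z≤n {k})))) ⟩
    (n + n) ^ d       ≤⟨ ^-monoˡ-≤ d (+-monoʳ-≤ n (m≤m+n n (k * n))) ⟩
    (n * n) ^ d       ≡⟨ cong (λ m → (n * m) ^ d) (sym (*-identityʳ n)) ⟩
    (n ^ 2) ^ d       ≡⟨ ^-*-assoc n 2 d ⟩
    n ^ (2 * d)       ≤⟨ ^-monoʳ-≤ n (m≤n+m (2 * d) (3 ^ d)) ⟩
    n ^ c             ≤⟨ m≤m+n (n ^ c) c ⟩
    n ^ c + c         ∎
    where open ≤-Reasoning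

-- Runs of Turing machines

module Bounded {C : Set} (next : C → Maybe C) where

  infix 4 _⟶[_]_
  -- The index bounds the number of steps instead of counting them: `stop` accepts any budget, so
  -- time estimates are inequalities throughout.
  data _⟶[_]_ (c : C) : ℕ → C → Set where
    stop : ∀ {t} → c ⟶[ t ] c
    go   : ∀ {t d e} → next c ≡ just d → d ⟶[ t ] e → c ⟶[ suc t ] e

  ⟶-weaken : ∀ {c d s t} → s ≤ t → c ⟶[ s ] d → c ⟶[ t ] d
  ⟶-weaken _         stop     = stop
  ⟶-weaken (s≤s s≤t) (go p r) = go p (⟶-weaken s≤t r)

  infixr 5 _◅◅_
  _◅◅_ : ∀ {c d e s t} → c ⟶[ s ] d → d ⟶[ t ] e → c ⟶[ s + t ] e
  _◅◅_ {s = s} stop r′ = ⟶-weaken (m≤n+m _ s) r′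
  go p r ◅◅ r′ = go p (r ◅◅ r′)

module _ (M : TM) where
  open TM M

  stepTM : Config M → Maybe (Config M)
  stepTM (cfg q l h r) = Maybe.map (λ (q' , s , d) → move M q' l s r d) (δ q h)

  -- A tape given as one list, where an exhausted list stands for a blank under the head. This
  -- unifies the two clauses of `initial` and the two of a move to the right.
  load : Fin (suc Q) → List (Sym M) → List (Sym M) → Config M
  load q l []      = cfg q l zero []
  load q l (s ∷ r) = cfg q l s r

  initial≡load : ∀ x → initial M x ≡ load zero [] (map (encBit M) x)
  initial≡load []      = refl
  initial≡load (_ ∷ _) = refl

  output-load : ∀ q l w → output M (load q l w) ≡ readBits M w
  output-load q l []      = refl
  output-load q l (_ ∷ _) = refl

  open Bounded stepTM

  runFor-halted : ∀ t c → stepTM c ≡ nothing → runFor M t c ≡ just (output M c)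
  runFor-halted t (cfg q l h r) eq with δ q h
  ... | nothing = refl
  runFor-halted t (cfg q l h r) () | just _

  runFor-step : ∀ t c {d} → stepTM c ≡ just d → runFor M (suc t) c ≡ runFor M t d
  runFor-step t (cfg q l h r) eq with δ q h
  runFor-step t (cfg q l h r) refl | just _ = refl
  runFor-step t (cfg q l h r) ()   | nothing

  ⟶⇒runFor : ∀ {t c d} → c ⟶[ t ] d → stepTM d ≡ nothing → runFor M t c ≡ just (output M d)
  ⟶⇒runFor {t} {c} stop h = runFor-halted t c h
  ⟶⇒runFor {suc t} {c} (go p r) h = trans (runFor-step t c p) (⟶⇒runFor r h)

  runFor⇒⟶ : ∀ t c {o} → runFor M t c ≡ just o →
    Σ (Config M) λ d → c ⟶[ t ] d × stepTM d ≡ nothing × output M d ≡ o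
  runFor⇒⟶ t (cfg q l h r) eq with δ q h in e
  runFor⇒⟶ t (cfg q l h r) refl | nothing = cfg q l h r , stop , cong (Maybe.map _) e , refl
  runFor⇒⟶ zero (cfg q l h r) () | just _
  runFor⇒⟶ (suc t) (cfg q l h r) eq | just (q' , s , m) with runFor⇒⟶ t (move M q' l s r m) eq
  ... | d , red , halt , out = d , go (cong (Maybe.map _) e) red , halt , out

-- Stack machines and their compilation to Turing machines

-- A retraction suffices: states and letters are encoded before they are decoded, so codes outside
-- the image do not occur in a run.
record Finite (A : Set) : Set where
  field
    size    : ℕ
    enc     : A → Fin size
    dec     : Fin size → A
    dec-enc : ∀ a → dec (enc a) ≡ a

finiteFin : ∀ n → Finite (Fin n)
finiteFin n = record { size = n ; enc = id ; dec = id ; dec-enc = λ _ → refl }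

finite⊎ : ∀ {A B} → Finite A → Finite B → Finite (A ⊎ B)
finite⊎ {A} {B} F G = record
  { size = m + n
  ; enc = λ a → join m n (Sum.map F.enc G.enc a)
  ; dec = λ i → Sum.map F.dec G.dec (splitAt m i)
  ; dec-enc = λ a → trans (cong (Sum.map F.dec G.dec) (splitAt-join m n (Sum.map F.enc G.enc a))) (lem a)
  }
  where
  module F = Finite F
  module G = Finite G
  m = F.size
  n = G.size
  lem : ∀ a → Sum.map F.dec G.dec (Sum.map F.enc G.enc a) ≡ a
  lem (inj₁ a) = cong inj₁ (F.dec-enc a)
  lem (inj₂ b) = cong inj₂ (G.dec-enc b)

finiteRetract : ∀ {A B : Set} (f : A → B) (g : B → A) → (∀ a → g (f a) ≡ a) → Finite B → Finite A
finiteRetract f g gf F = record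
  { size = size ; enc = enc ∘ f ; dec = g ∘ dec
  ; dec-enc = λ a → trans (cong g (dec-enc (f a))) (gf a) }
  where open Finite F

finiteMaybe : ∀ {A} → Finite A → Finite (Maybe A)
finiteMaybe F = finiteRetract
  (λ { nothing → inj₁ zero ; (just a) → inj₂ a })
  (λ { (inj₁ _) → nothing ; (inj₂ a) → just a })
  (λ { nothing → refl ; (just a) → refl })
  (finite⊎ (finiteFin 1) F)

Letter : ℕ → Set
Letter K = Fin (3 + K)

bit : ∀ {K} → Bool → Letter K
bit false = suc zero
bit true  = suc (suc zero)

unbit : ∀ {K} → Letter K → Maybe Bool
unbit (suc zero)       = just false
unbit (suc (suc zero)) = just true
unbit _                = nothing

unbit-bit : ∀ {K} b → unbit {K} (bit b) ≡ just b
unbit-bit false = refl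
unbit-bit true  = refl

Stacks : ℕ → ℕ → Set
Stacks r K = Vec (List (Letter K)) r

data Instr (r K : ℕ) (X : Set) : Set where
  push : Fin r → Letter K → X → Instr r K X
  pop  : Fin r → (Maybe (Letter K) → X) → Instr r K X

exec : ∀ {r K X} → Instr r K X → Stacks r K → X × Stacks r K
exec (push i s x) σ = x , σ [ i ]≔ (s ∷ lookup σ i)
exec (pop i k)    σ = k (head (lookup σ i)) , σ [ i ]≔ drop 1 (lookup σ i)

-- Leaving the fragment is the value `nothing` outside `Q`, so that composition can redirect it to
-- the start of the next fragment.
record Frag (r K : ℕ) : Set₁ where
  field
    Q      : Set
    finite : Finite Q
    start  : Q
    instr  : Q → Instr r K (Maybe Q)

module _ {r K : ℕ} (F : Frag r K) where
  open Frag F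

  stepSM : Maybe Q × Stacks r K → Maybe (Maybe Q × Stacks r K)
  stepSM (nothing , σ) = nothing
  stepSM (just q  , σ) = just (exec (instr q) σ)

  Runs : Stacks r K → ℕ → Stacks r K → Set
  Runs σ t τ = Bounded._⟶[_]_ stepSM (just start , σ) t (nothing , τ)

height-step : ∀ {r K X} (I : Instr r K X) σ i → length (lookup (proj₂ (exec I σ)) i) ≤ suc (length (lookup σ i))
height-step (push j s x) σ i with i ≟F j
... | yes refl = ≤-reflexive (cong length (lookup∘update i σ _))
... | no i≢j   = ≤-trans (≤-reflexive (cong length (lookup∘update′ i≢j σ _))) (n≤1+n _)
height-step (pop j k) σ i with i ≟F j
... | yes refl = ≤-trans (≤-reflexive (cong length (lookup∘update i σ _))) (drop-length (lookup σ i))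
  where
  drop-length : ∀ {A : Set} (xs : List A) → length (drop 1 xs) ≤ suc (length xs)
  drop-length []       = z≤n
  drop-length (_ ∷ xs) = ≤-trans (n≤1+n _) (n≤1+n _)
... | no i≢j   = ≤-trans (≤-reflexive (cong length (lookup∘update′ i≢j σ _))) (n≤1+n _)

-- Simulating an instruction costs a walk along a stack, so a bound on the run time has to bound the
-- heights as well.
height-run : ∀ {r K} (F : Frag r K) → let open Bounded (stepSM F) in
  ∀ {s s' σ τ t} → (s , σ) ⟶[ t ] (s' , τ) → ∀ i → length (lookup τ i) ≤ length (lookup σ i) + t
height-run F Bounded.stop i = m≤m+n _ _
height-run F {s = just q} {σ = σ} {t = suc t} (Bounded.go refl r) i =
  ≤-trans (height-run F r i) (≤-trans (+-monoˡ-≤ t (height-step (Frag.instr F q) σ i))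
    (≤-reflexive (sym (+-suc (length (lookup σ i)) t))))

++-split : ∀ {A B : Set} (f : A → B) W xs {ys} → map f W ≡ xs ++ ys →
  Σ[ U ∈ List A ] Σ[ V ∈ List A ] W ≡ U ++ V × map f U ≡ xs × map f V ≡ ys
++-split f W [] eq = [] , W , refl , refl , eq
++-split f (w ∷ W) (x ∷ xs) eq with ∷-injective eq
... | p , q with ++-split f W xs q
... | U , V , e , u , v = w ∷ U , V , cong (w ∷_) e , cong₂ _∷_ p u , v

module Compile {r K : ℕ} (F : Frag (suc r) K) where
  open Frag F renaming (Q to Ctl; finite to finiteCtl)

  opaque
    cell : Finite (Maybe (Letter K))
    cell = finiteMaybe (finiteFin (3 + K))

  module Cell = Finite cell

  k : ℕ
  k = Cell.size ^ suc r

  Tape : Set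
  Tape = Fin (3 + k)

  -- Blanks and raw input bits count as empty on all tracks, so a cell never visited before can be
  -- written like any other.
  track : Fin (suc r) → Tape → Maybe (Letter K)
  track i (suc (suc (suc c))) = Cell.dec (finToFun {Cell.size} {suc r} c i)
  track i _                   = nothing

  column : Tape → Fin (suc r) → Maybe (Letter K) → Fin (suc r) → Fin Cell.size
  column c i v j with j ≟F i
  ... | yes _ = Cell.enc v
  ... | no  _ = Cell.enc (track j c)

  write : Tape → Fin (suc r) → Maybe (Letter K) → Tape
  write c i v = suc (suc (suc (funToFin (column c i v))))

  track-write : ∀ c i v → track i (write c i v) ≡ v
  track-write c i v rewrite finToFun-funToFin (column c i v) i with i ≟F i
  ... | yes _  = Cell.dec-enc v
  ... | no i≢i = ⊥-elim (i≢i refl)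

  track-write′ : ∀ c i v {j} → j ≢ i → track j (write c i v) ≡ track j c
  track-write′ c i v {j} j≢i rewrite finToFun-funToFin (column c i v) j with j ≟F i
  ... | yes j≡i = ⊥-elim (j≢i j≡i)
  ... | no  _   = Cell.dec-enc (track j c)

  -- Stack i sits on track i, bottom leftmost; the blank left of the tracks marks the home position.
  data Phase : Set where
    conv outR outL fin     : Phase
    home                   : Maybe Ctl → Phase
    pushing popping popped : Ctl → Phase

  opaque
    finiteCtls : Finite (Maybe Ctl ⊎ (Ctl ⊎ (Ctl ⊎ Ctl)))
    finiteCtls = finite⊎ (finiteMaybe finiteCtl) (finite⊎ finiteCtl (finite⊎ finiteCtl finiteCtl))

  finitePhase : Finite Phase
  finitePhase = finiteRetract to from from-to
    (finite⊎ (finiteFin 4) finiteCtls)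
    where
    to : Phase → Fin 4 ⊎ (Maybe Ctl ⊎ (Ctl ⊎ (Ctl ⊎ Ctl)))
    to conv        = inj₁ zero
    to outR        = inj₁ (suc zero)
    to outL        = inj₁ (suc (suc zero))
    to fin         = inj₁ (suc (suc (suc zero)))
    to (home s)    = inj₂ (inj₁ s)
    to (pushing q) = inj₂ (inj₂ (inj₁ q))
    to (popping q) = inj₂ (inj₂ (inj₂ (inj₁ q)))
    to (popped q)  = inj₂ (inj₂ (inj₂ (inj₂ q)))
    from : Fin 4 ⊎ (Maybe Ctl ⊎ (Ctl ⊎ (Ctl ⊎ Ctl))) → Phase
    from (inj₁ zero)                   = conv
    from (inj₁ (suc zero))             = outR
    from (inj₁ (suc (suc zero)))       = outL
    from (inj₁ (suc (suc (suc zero)))) = fin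
    from (inj₂ (inj₁ s))               = home s
    from (inj₂ (inj₂ (inj₁ q)))        = pushing q
    from (inj₂ (inj₂ (inj₂ (inj₁ q)))) = popping q
    from (inj₂ (inj₂ (inj₂ (inj₂ q)))) = popped q
    from-to : ∀ p → from (to p) ≡ p
    from-to conv        = refl
    from-to outR        = refl
    from-to outL        = refl
    from-to fin         = refl
    from-to (home _)    = refl
    from-to (pushing _) = refl
    from-to (popping _) = refl
    from-to (popped _)  = refl

  module Ph = Finite finitePhase

  Action : Set
  Action = Maybe (Phase × Tape × Dir)

  dispatch : Ctl → Instr (suc r) K (Maybe Ctl) → Action
  dispatch q (push _ _ _) = just (pushing q , zero , R)
  dispatch q (pop _ _)    = just (popping q , zero , R)

  pushAt : Ctl → Instr (suc r) K (Maybe Ctl) → Tape → Action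
  pushAt q (pop _ _) c = nothing
  pushAt q (push i s x) c with track i c
  ... | nothing = just (home x , write c i (just s) , L)
  ... | just _  = just (pushing q , c , R)

  popAt : Ctl → Instr (suc r) K (Maybe Ctl) → Tape → Action
  popAt q (push _ _ _) c = nothing
  popAt q (pop i x) c with track i c
  ... | nothing = just (popped q , c , L)
  ... | just _  = just (popping q , c , R)

  take : Instr (suc r) K (Maybe Ctl) → Tape → Action
  take (push _ _ _) _         = nothing
  -- A blank to the left of the first free cell is the home mark: the stack was empty.
  take (pop i x)    zero      = just (home (x nothing) , zero , S)
  take (pop i x)    c@(suc _) = just (home (x (track i c)) , write c i nothing , S)

  emit : Maybe Bool → Action
  emit (just false) = just (outR , suc zero , R)
  emit (just true)  = just (outR , suc (suc zero) , R)
  -- This blank ends the output for `readBits`; columns of the other stacks may follow it.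
  emit nothing      = just (outL , zero , L)

  δ′ : Phase → Tape → Action
  δ′ conv zero                   = just (home (just start) , zero , L)
  δ′ conv (suc zero)             = just (conv , write zero zero (just (bit false)) , R)
  δ′ conv (suc (suc zero))       = just (conv , write zero zero (just (bit true)) , R)
  δ′ conv (suc (suc (suc _)))    = nothing
  δ′ (home s) c@(suc _)          = just (home s , c , L)
  δ′ (home (just q)) zero        = dispatch q (instr q)
  δ′ (home nothing) zero         = just (outR , zero , R)
  δ′ (pushing q) c               = pushAt q (instr q) c
  δ′ (popping q) c               = popAt q (instr q) c
  δ′ (popped q) c                = take (instr q) c
  δ′ outR c                      = emit (track zero c Maybe.>>= unbit)
  δ′ outL zero                   = just (fin , zero , R)
  δ′ outL c@(suc _)              = just (outL , c , L)
  δ′ fin _                       = nothing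

  machine : TM
  machine = record
    -- One less than the number of phases, since states are `Fin (suc Q)`. The phase `conv` has code
    -- zero, the start state.
    { Q = 3 + Finite.size finiteCtls
    ; k = k
    ; δ = λ q s → Maybe.map (λ (p , s′ , d) → Ph.enc p , s′ , d) (δ′ (Ph.dec q) s) }

  open Bounded (stepTM machine)

  Cfg : Set
  Cfg = Config machine

  at : Phase → List Tape → Tape → List Tape → Cfg
  at p l c r = cfg (Ph.enc p) l c r

  ld : Phase → List Tape → List Tape → Cfg
  ld p l w = load machine (Ph.enc p) l w

  mv : Phase → List Tape → Tape → List Tape → Dir → Cfg
  mv p = move machine (Ph.enc p)

  step≡ : ∀ p c {l r p′ s d} → δ′ p c ≡ just (p′ , s , d) →
    stepTM machine (at p l c r) ≡ just (mv p′ l s r d)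
  step≡ p c eq rewrite Ph.dec-enc p | eq = refl

  mvR : ∀ p l s w → mv p l s w R ≡ ld p (s ∷ l) w
  mvR p l s []      = refl
  mvR p l s (_ ∷ _) = refl

  stepR : ∀ p c {l w p′ s} → δ′ p c ≡ just (p′ , s , R) →
    stepTM machine (at p l c w) ≡ just (ld p′ (s ∷ l) w)
  stepR p c {l} {w} {p′} {s} eq = trans (step≡ p c eq) (cong just (mvR p′ l s w))

  infixr 5 _◅≡_
  _◅≡_ : ∀ {c d e t} → c ≡ d → d ⟶[ t ] e → c ⟶[ t ] e
  refl ◅≡ r = r

  walkR : ∀ {A : Set} p (f g : A → Tape) (U : List A) {l V} →
    All (λ a → δ′ p (f a) ≡ just (p , g a , R)) U →
    ld p l (map f U ++ V) ⟶[ length U ] ld p (map g U ʳ++ l) V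
  walkR p f g []      []       = stop
  walkR p f g (a ∷ U) (h ∷ hs) = go (stepR p (f a) h) (walkR p f g U hs)

  -- Where a walk to the left ends: beyond the left edge, where the move itself supplies a blank, or
  -- at the home mark. The former happens after reading the input and thereby creates the home mark.
  data End : List Tape → Set where
    edge   : End []
    marked : End (zero ∷ [])

  data NonBlank : Tape → Set where
    nb : ∀ {c} → NonBlank (suc c)

  walkL : ∀ p {e} → End e → (∀ {c} → δ′ p (suc c) ≡ just (p , suc c , L)) → ∀ l {s r} → All NonBlank l →
    mv p (l ++ e) s r L ⟶[ length l ] at p [] zero (l ʳ++ s ∷ r)
  walkL p edge   h []      []        = stop
  walkL p marked h []      []        = stop
  walkL p e      h (suc c ∷ l) (nb ∷ ns) = go (step≡ p (suc c) h) (walkL p e h l ns)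

  reverse-NonBlank : ∀ U l → All NonBlank U → All NonBlank l → All NonBlank (U ʳ++ l)
  reverse-NonBlank []      l []       ns = ns
  reverse-NonBlank (_ ∷ U) l (n ∷ us) ns = reverse-NonBlank U _ us (n ∷ ns)

  walkL′ : ∀ p {e} → End e → (∀ {c} → δ′ p (suc c) ≡ just (p , suc c , L)) → ∀ U {s r} → All NonBlank U →
    mv p (U ʳ++ e) s r L ⟶[ length U ] at p [] zero (U ++ s ∷ r)
  walkL′ p {e} end h U {s} {r} nbs
    rewrite ʳ++-defn U {e} | sym (ʳ++-ʳ++ U {[]} {s ∷ r}) | sym (length-reverse U)
    = walkL p end h (reverse U) (reverse-NonBlank U [] nbs [])

  Blank : Fin (suc r) → List Tape → Set
  Blank i V = Σ[ m ∈ ℕ ] map (track i) V ≡ replicate m nothing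

  Holds : Fin (suc r) → List Tape → List (Letter K) → Set
  Holds i W as = Σ[ m ∈ ℕ ] map (track i) W ≡ map just as ++ replicate m nothing

  Represents : List Tape → Stacks (suc r) K → Set
  Represents W σ = ∀ i → Holds i W (reverse (lookup σ i))

  holds-++ : ∀ i U V as → map (track i) U ≡ map just as → Blank i V → Holds i (U ++ V) as
  holds-++ i U V as u (m , v) = m , trans (map-++ (track i) U V) (cong₂ _++_ u v)

  holds-split : ∀ i W as → Holds i W as →
    Σ[ U ∈ List Tape ] Σ[ V ∈ List Tape ] W ≡ U ++ V × map (track i) U ≡ map just as × Blank i V
  holds-split i W as (m , eq) with ++-split (track i) W (map just as) eq
  ... | U , V , e , u , v = U , V , e , u , m , v

  holds-snoc-blank : ∀ i W as → Holds i W as → Holds i (W ++ zero ∷ []) as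
  holds-snoc-blank i W as h with holds-split i W as h
  ... | U , V , refl , u , m , v =
    subst (λ W → Holds i W as) (sym (++-assoc U V (zero ∷ [])))
      (holds-++ i U (V ++ zero ∷ []) as u (suc m , trans (map-++ (track i) V _) (trans (cong (_++ nothing ∷ []) v) (snoc m))))
    where
    snoc : ∀ m → replicate m nothing ++ nothing ∷ [] ≡ replicate {A = Maybe (Letter K)} (suc m) nothing
    snoc zero    = refl
    snoc (suc m) = cong (nothing ∷_) (snoc m)

  -- An exhausted tape reads as a blank cell, so a first free cell can always be assumed to exist.
  record FreeCell (i : Fin (suc r)) (U V : List Tape) : Set where
    field
      c      : Tape
      V′     : List Tape
      loaded : ∀ p l → ld p l V ≡ at p l c V′
      keeps  : ∀ j as → Holds j (U ++ V) as → Holds j (U ++ c ∷ V′) as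
      free   : track i c ≡ nothing
      blank′ : Blank i V′

  freeCell : ∀ i U V → Blank i V → FreeCell i U V
  freeCell i U [] _ = record
    { c = zero ; V′ = [] ; loaded = λ _ _ → refl ; free = refl ; blank′ = 0 , refl
    ; keeps = λ j as h → holds-snoc-blank j U as (subst (λ W → Holds j W as) (++-identityʳ U) h) }
  freeCell i U (c ∷ V) (suc m , eq) = record
    { c = c ; V′ = V ; loaded = λ _ _ → refl ; keeps = λ _ _ h → h
    ; free = proj₁ (∷-injective eq) ; blank′ = m , proj₂ (∷-injective eq) }

  rewrite-track : ∀ {σ i U c V v as} → Represents (U ++ c ∷ V) σ →
    Holds i (U ++ write c i v ∷ V) (reverse as) →
    Represents (U ++ write c i v ∷ V) (σ [ i ]≔ as)
  rewrite-track {σ} {i} {U} {c} {V} {v} {as} rep h j with j ≟F i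
  ... | yes refl rewrite lookup∘update j σ as = h
  ... | no j≢i rewrite lookup∘update′ j≢i σ as with rep j
  ... | m , eq = m , trans (trans (map-++ (track j) U _)
          (trans (cong (λ z → map (track j) U ++ z ∷ map (track j) V) (track-write′ c i v j≢i))
            (sym (map-++ (track j) U (c ∷ V))))) eq

  -- An occupied cell has a nonempty track and so is not blank; hence the way back over a stack
  -- cannot stop before the home mark.
  occupied-NonBlank : ∀ i U as → map (track i) U ≡ map just as → All NonBlank U
  occupied-NonBlank i []                      []       eq = []
  occupied-NonBlank i (zero ∷ U)              (a ∷ as) ()
  occupied-NonBlank i (suc c ∷ U)             (a ∷ as) eq = nb ∷ occupied-NonBlank i U as (proj₂ (∷-injective eq))

  occupied-All : ∀ {i} {P : Tape → Set} U as → map (track i) U ≡ map just as →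
    (∀ c {a} → track i c ≡ just a → P c) → All P U
  occupied-All []      []       eq h = []
  occupied-All (c ∷ U) (a ∷ as) eq h = h c (proj₁ (∷-injective eq)) ∷ occupied-All U as (proj₂ (∷-injective eq)) h

  occupied-length : ∀ {i} U (as : List (Letter K)) → map (track i) U ≡ map just as → length U ≡ length as
  occupied-length {i} U as eq = trans (sym (length-map (track i) U)) (trans (cong length eq) (length-map just as))

  walkOver : ∀ {i p} U as {l V} → map (track i) U ≡ map just as →
    (∀ c {a} → track i c ≡ just a → δ′ p c ≡ just (p , c , R)) →
    ld p l (U ++ V) ⟶[ length U ] ld p (U ʳ++ l) V
  walkOver {p = p} U as {l} {V} u h =
    subst (λ z → ld p l (z ++ V) ⟶[ length U ] ld p (z ʳ++ l) V) (map-id U)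
      (walkR p id id U (occupied-All U as u h))

  pushAt-occupied : ∀ q i s x c {a} → track i c ≡ just a → pushAt q (push i s x) c ≡ just (pushing q , c , R)
  pushAt-occupied q i s x c eq rewrite eq = refl

  pushAt-free : ∀ q i s x c → track i c ≡ nothing → pushAt q (push i s x) c ≡ just (home x , write c i (just s) , L)
  pushAt-free q i s x c eq rewrite eq = refl

  popAt-occupied : ∀ q i x c {a} → track i c ≡ just a → popAt q (pop i x) c ≡ just (popping q , c , R)
  popAt-occupied q i x c eq rewrite eq = refl

  popAt-free : ∀ q i x c → track i c ≡ nothing → popAt q (pop i x) c ≡ just (popped q , c , L)
  popAt-free q i x c eq rewrite eq = refl

  Simulates : Maybe Ctl → List Tape → ℕ → Maybe Ctl → Stacks (suc r) K → Set
  Simulates s W t s′ τ = Σ[ W′ ∈ List Tape ] (at (home s) [] zero W ⟶[ t ] at (home s′) [] zero W′) × Represents W′ τ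

  simulate-push : ∀ {q i a x W σ} → instr q ≡ push i a x → Represents W σ →
    Simulates (just q) W (2 * length (lookup σ i) + 5) x (σ [ i ]≔ (a ∷ lookup σ i))
  simulate-push {q} {i} {a} {x} {W} {σ} ins rep with holds-split i W _ (rep i)
  ... | U , V , refl , u , bl = U ++ write c i (just a) ∷ V′ , run , rewrite-track {σ = σ} {U = U} {as = a ∷ as} rep′ hold
    where
    open FreeCell (freeCell i U V bl)
    as = lookup σ i
    rep′ : Represents (U ++ c ∷ V′) σ
    rep′ j = keeps j _ (rep j)
    hold : Holds i (U ++ write c i (just a) ∷ V′) (reverse (a ∷ as))
    hold rewrite unfold-reverse a as with blank′
    ... | m , v = m , (begin
      map (track i) (U ++ write c i (just a) ∷ V′)                       ≡⟨ map-++ (track i) U _ ⟩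
      map (track i) U ++ track i (write c i (just a)) ∷ map (track i) V′ ≡⟨ cong₂ (λ y z → y ++ track i (write c i (just a)) ∷ z) u v ⟩
      map just (reverse as) ++ track i (write c i (just a)) ∷ replicate m nothing
        ≡⟨ cong (λ z → map just (reverse as) ++ z ∷ replicate m nothing) (track-write c i (just a)) ⟩
      map just (reverse as) ++ (just a ∷ []) ++ replicate m nothing      ≡⟨ sym (++-assoc (map just (reverse as)) _ _) ⟩
      (map just (reverse as) ++ just a ∷ []) ++ replicate m nothing      ≡⟨ cong (_++ replicate m nothing) (sym (map-++ just (reverse as) (a ∷ []))) ⟩
      map just (reverse as ++ a ∷ []) ++ replicate m nothing ∎)
      where open ≡-Reasoning
    len : length U ≡ length as
    len = trans (occupied-length U (reverse as) u) (length-reverse as)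
    time : 1 + (length U + (1 + length U)) ≤ 2 * length as + 5
    time = ≤-trans (≤-reflexive (trans (cong (λ n → 1 + (n + (1 + n))) len) (lem (length as)))) (+-monoʳ-≤ (2 * length as) (s≤s (s≤s z≤n)))
      where
      lem : ∀ n → 1 + (n + (1 + n)) ≡ 2 * n + 2
      lem = solve-∀
    run : at (home (just q)) [] zero (U ++ V) ⟶[ 2 * length as + 5 ] at (home x) [] zero (U ++ write c i (just a) ∷ V′)
    run = ⟶-weaken time
      (go (stepR (home (just q)) zero (cong (dispatch q) ins))
        (walkOver {i} U (reverse as) u (λ c e → trans (cong (λ I → pushAt q I c) ins) (pushAt-occupied q i a x c e))
          ◅◅ loaded (pushing q) _ ◅≡
               (go (step≡ (pushing q) c (trans (cong (λ I → pushAt q I c) ins) (pushAt-free q i a x c free)))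
                 (walkL′ (home x) marked refl U (occupied-NonBlank i U (reverse as) u)))))

  take-cell : ∀ {i x c a} → track i c ≡ just a → take (pop i x) c ≡ just (home (x (just a)) , write c i nothing , S)
  take-cell {c = suc c} eq rewrite eq = refl

  simulate-pop : ∀ {q i x W σ} → instr q ≡ pop i x → Represents W σ →
    Simulates (just q) W (2 * length (lookup σ i) + 5) (x (head (lookup σ i))) (σ [ i ]≔ drop 1 (lookup σ i))
  simulate-pop {q} {i} {x} {W} {σ} ins rep with lookup σ i in σi≡ | holds-split i W _ (rep i)
  ... | [] | [] , V , refl , u , bl = c ∷ V′ , run , rep″
    where
    open FreeCell (freeCell i [] V bl)
    rep″ : Represents (c ∷ V′) (σ [ i ]≔ [])
    rep″ j with j ≟F i
    ... | no j≢i rewrite lookup∘update′ j≢i σ [] = keeps j _ (rep j)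
    ... | yes refl rewrite lookup∘update i σ [] = subst (λ z → Holds i (c ∷ V′) (reverse z)) σi≡ (keeps i _ (rep i))
    run : at (home (just q)) [] zero V ⟶[ 5 ] at (home (x nothing)) [] zero (c ∷ V′)
    run = go (stepR (home (just q)) zero (cong (dispatch q) ins))
      (loaded (popping q) _ ◅≡
        (go (step≡ (popping q) c (trans (cong (λ I → popAt q I c) ins) (popAt-free q i x c free)))
          (go (step≡ (popped q) zero (cong (λ I → take I zero) ins)) stop)))
  -- The stack is stored in reverse, so its top is the last occupied cell `d`, directly left of the
  -- first free one.
  ... | a ∷ as | U , V , refl , u , bl with ++-split (track i) U (map just (reverse as))
      (trans u (trans (cong (map just) (unfold-reverse a as)) (map-++ just (reverse as) (a ∷ []))))
  ... | U₁ , d ∷ [] , refl , u₁ , d≡ = U₁ ++ write d i nothing ∷ c ∷ V′ , run , rewrite-track {σ = σ} {U = U₁} {as = as} rep′ hold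
    where
    open FreeCell (freeCell i (U₁ ++ d ∷ []) V bl)
    di : track i d ≡ just a
    di = proj₁ (∷-injective d≡)
    rep′ : Represents (U₁ ++ d ∷ c ∷ V′) σ
    rep′ j = subst (λ W → Holds j W _) (++-assoc U₁ (d ∷ []) (c ∷ V′)) (keeps j _ (rep j))
    hold : Holds i (U₁ ++ write d i nothing ∷ c ∷ V′) (reverse as)
    hold = holds-++ i U₁ _ (reverse as) u₁
      (suc (suc (proj₁ blank′)) , cong₂ _∷_ (track-write d i nothing) (cong₂ _∷_ free (proj₂ blank′)))
    len : length U₁ ≡ length as
    len = trans (occupied-length U₁ (reverse as) u₁) (length-reverse as)
    len′ : length (U₁ ++ d ∷ []) ≡ suc (length as)
    len′ = trans (occupied-length (U₁ ++ d ∷ []) _ u) (length-reverse (a ∷ as))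
    time : 1 + (length (U₁ ++ d ∷ []) + (3 + length U₁)) ≤ 2 * suc (length as) + 5
    time = ≤-trans (≤-reflexive (trans (cong₂ (λ m n → 1 + (m + (3 + n))) len′ len) (lem (length as))))
             (+-monoʳ-≤ (2 * suc (length as)) (s≤s (s≤s (s≤s z≤n))))
      where
      lem : ∀ n → 1 + (suc n + (3 + n)) ≡ 2 * suc n + 3
      lem = solve-∀
    back : (U₁ ++ d ∷ []) ʳ++ (zero ∷ []) ≡ d ∷ (U₁ ʳ++ zero ∷ [])
    back = ++-ʳ++ U₁
    run : at (home (just q)) [] zero ((U₁ ++ d ∷ []) ++ V) ⟶[ 2 * suc (length as) + 5 ]
          at (home (x (just a))) [] zero (U₁ ++ write d i nothing ∷ c ∷ V′)
    run = ⟶-weaken time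
      (go (stepR (home (just q)) zero (cong (dispatch q) ins))
        (walkOver {i} (U₁ ++ d ∷ []) (reverse (a ∷ as)) u
            (λ c e → trans (cong (λ I → popAt q I c) ins) (popAt-occupied q i x c e))
          ◅◅ trans (loaded (popping q) _) (cong (λ l → at (popping q) l c V′) back) ◅≡
               (go (step≡ (popping q) c (trans (cong (λ I → popAt q I c) ins) (popAt-free q i x c free)))
                 (go (step≡ (popped q) d (trans (cong (λ I → take I d) ins) (take-cell {x = x} {d} di)))
                   (go (step≡ (home _) (write d i nothing) refl)
                     (walkL′ (home (x (just a))) marked refl U₁ (occupied-NonBlank i U₁ (reverse as) u₁)))))))

  simulate-step : ∀ {q W σ} → Represents W σ → ∀ H → (∀ i → length (lookup σ i) ≤ H) →
    Simulates (just q) W (2 * H + 5) (proj₁ (exec (instr q) σ)) (proj₂ (exec (instr q) σ))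
  simulate-step {q} {W} {σ} rep H h with instr q in ins
  ... | push i a x with simulate-push {σ = σ} ins rep
  ... | W′ , run , rep′ = W′ , ⟶-weaken (+-monoˡ-≤ 5 (*-monoʳ-≤ 2 (h i))) run , rep′
  simulate-step {q} {W} {σ} rep H h | pop i x with simulate-pop {σ = σ} ins rep
  ... | W′ , run , rep′ = W′ , ⟶-weaken (+-monoˡ-≤ 5 (*-monoʳ-≤ 2 (h i))) run , rep′

  -- Within t steps no stack outgrows H + t, so H + t can serve as the height in the cost of every
  -- single step.
  simulate-run : ∀ {s s′ σ τ t W} → Bounded._⟶[_]_ (stepSM F) (s , σ) t (s′ , τ) → Represents W σ →
    ∀ H → (∀ i → length (lookup σ i) ≤ H) → Simulates s W (t * (2 * (H + t) + 5)) s′ τ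
  simulate-run {W = W} Bounded.stop rep H h = W , stop , rep
  simulate-run {just q} {s′} {σ} {t = suc t} (Bounded.go refl r) rep H h
    with simulate-step {q} rep H h
  ... | W₁ , run₁ , rep₁ with simulate-run r rep₁ (suc H) (λ i → ≤-trans (height-step (instr q) σ i) (s≤s (h i)))
  ... | W₂ , run₂ , rep₂ = W₂ , ⟶-weaken time (run₁ ◅◅ run₂) , rep₂
    where
    time : (2 * H + 5) + t * (2 * (suc H + t) + 5) ≤ suc t * (2 * (H + suc t) + 5)
    time rewrite +-suc H t = +-monoˡ-≤ (t * (2 * suc (H + t) + 5)) (+-monoˡ-≤ 5 (*-monoʳ-≤ 2 (≤-trans (m≤m+n H t) (n≤1+n _))))

  inputStacks : Str → Stacks (suc r) K
  inputStacks x = reverse (map bit x) ∷ Vec.replicate r []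

  inCell : Bool → Tape
  inCell b = write zero zero (just (bit b))

  inCells-represent : ∀ x → Represents (map inCell x ++ zero ∷ []) (inputStacks x)
  inCells-represent x zero rewrite reverse-involutive (map (bit {K}) x) =
    holds-++ zero (map inCell x) (zero ∷ []) (map bit x) (lem x) (1 , refl)
    where
    lem : ∀ x → map (track zero) (map inCell x) ≡ map just (map bit x)
    lem []      = refl
    lem (b ∷ x) = cong₂ _∷_ (track-write zero zero (just (bit b))) (lem x)
  inCells-represent x (suc i) = subst (λ as → Holds (suc i) (map inCell x ++ zero ∷ []) (reverse as))
    (sym (lookup-replicate i [])) (suc (length x) , lem x)
    where
    lem : ∀ x → map (track (suc i)) (map inCell x ++ zero ∷ []) ≡ replicate (suc (length x)) nothing
    lem []      = refl
    lem (b ∷ x) = cong₂ _∷_ (track-write′ zero zero (just (bit b)) {suc i} (λ ())) (lem x)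

  load-input : ∀ x → initial machine x ⟶[ length x + (1 + length x) ]
    at (home (just start)) [] zero (map inCell x ++ zero ∷ [])
  load-input x = trans (initial≡load machine x) (cong (λ w → ld conv [] w) (sym (++-identityʳ _))) ◅≡
    (walkR conv (encBit machine) inCell x {[]} {[]} (reads x)
      ◅◅ go (step≡ conv zero refl)
        (⟶-weaken (≤-reflexive (length-map inCell x)) (walkL′ (home (just start)) edge refl (map inCell x) {zero} {[]} (nonBlank x))))
    where
    reads : ∀ x → All (λ b → δ′ conv (encBit machine b) ≡ just (conv , inCell b , R)) x
    reads []          = []
    reads (false ∷ x) = refl ∷ reads x
    reads (true ∷ x)  = refl ∷ reads x
    nonBlank : ∀ x → All NonBlank (map inCell x)
    nonBlank []      = []
    nonBlank (b ∷ x) = nb ∷ nonBlank x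

  readBits-encBit : ∀ y V → readBits machine (map (encBit machine) y ++ zero ∷ V) ≡ y
  readBits-encBit []          V = refl
  readBits-encBit (false ∷ y) V = cong (false ∷_) (readBits-encBit y V)
  readBits-encBit (true ∷ y)  V = cong (true ∷_) (readBits-encBit y V)

  write-output : ∀ W y → Holds zero W (map bit y) → Σ[ e ∈ Cfg ]
    (at (home nothing) [] zero W ⟶[ 2 * length y + 3 ] e) × stepTM machine e ≡ nothing × output machine e ≡ y
  write-output W y h with holds-split zero W (map bit y) h
  ... | U , V , refl , u , bl = e , ⟶-weaken time run , halted , trans (output-load machine _ _ (map (encBit machine) y ++ zero ∷ V′)) (readBits-encBit y V′)
    where
    open FreeCell (freeCell zero U V bl)
    e : Cfg
    e = ld fin (zero ∷ []) (map (encBit machine) y ++ zero ∷ V′)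
    halted : stepTM machine e ≡ nothing
    halted with map (encBit machine) y ++ zero ∷ V′
    ... | []    rewrite Ph.dec-enc fin = refl
    ... | _ ∷ _ rewrite Ph.dec-enc fin = refl
    emitted : ∀ U y → map (track zero) U ≡ map just (map bit y) → ∀ l →
      ld outR l (U ++ V) ⟶[ length y ] ld outR (map (encBit machine) y ʳ++ l) V
    emitted []      []      eq l = stop
    emitted (c ∷ U) (b ∷ y) eq l = go (stepR outR c (lem b refl)) (emitted U y (proj₂ (∷-injective eq)) _)
      where
      lem : ∀ b′ → b′ ≡ b → δ′ outR c ≡ just (outR , encBit machine b′ , R)
      lem false refl rewrite proj₁ (∷-injective eq) = refl
      lem true  refl rewrite proj₁ (∷-injective eq) = refl
    encBit-NonBlank : ∀ y → All NonBlank (map (encBit machine) y)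
    encBit-NonBlank []          = []
    encBit-NonBlank (false ∷ y) = nb ∷ encBit-NonBlank y
    encBit-NonBlank (true ∷ y)  = nb ∷ encBit-NonBlank y
    end : δ′ outR c ≡ just (outL , zero , L)
    end rewrite free = refl
    time : 1 + (length y + (1 + (length (map (encBit machine) y) + 1))) ≤ 2 * length y + 3
    time rewrite length-map (encBit machine) y = ≤-reflexive (lem (length y))
      where
      lem : ∀ n → 1 + (n + (1 + (n + 1))) ≡ 2 * n + 3
      lem = solve-∀
    run : at (home nothing) [] zero (U ++ V) ⟶[ 1 + (length y + (1 + (length (map (encBit machine) y) + 1))) ] e
    run = go (stepR (home nothing) zero refl)
      (emitted U y u _ ◅◅ loaded outR _ ◅≡
        (go (step≡ outR c end)
          (walkL′ outL marked refl (map (encBit machine) y) (encBit-NonBlank y)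
            ◅◅ go (stepR outL zero refl) stop)))

  correct : ∀ x {y t τ} → Runs F (inputStacks x) t τ → lookup τ zero ≡ reverse (map bit y) →
    runFor machine ((length x + (1 + length x)) + (t * (2 * (length x + t) + 5) + (2 * (length x + t) + 3))) (initial machine x) ≡ just y
  correct x {y} {t} {τ} run out =
    let W , run₁ , rep       = simulate-run run (inCells-represent x) (length x) hs
        e , run₂ , halt , eq = write-output W y (subst (Holds zero W) (trans (cong reverse out) (reverse-involutive (map bit y))) (rep zero))
    in trans (⟶⇒runFor machine (load-input x ◅◅ run₁ ◅◅ ⟶-weaken bound run₂) halt) (cong just eq)
    where
    hs : ∀ i → length (lookup (inputStacks x) i) ≤ length x
    hs zero = ≤-reflexive (trans (length-reverse (map bit x)) (length-map bit x))
    hs (suc i) = subst (λ as → length as ≤ length x) (sym (lookup-replicate i [])) z≤n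
    leny : length y ≤ length x + t
    leny = begin
      length y                             ≡⟨ sym (length-map (bit {K}) y) ⟩
      length (map (bit {K}) y)             ≡⟨ sym (length-reverse (map bit y)) ⟩
      length (reverse (map (bit {K}) y))   ≡⟨ cong length (sym out) ⟩
      length (lookup τ zero)               ≤⟨ height-run F run zero ⟩
      length (reverse (map (bit {K}) x)) + t ≡⟨ cong (_+ t) (trans (length-reverse (map bit x)) (length-map bit x)) ⟩
      length x + t                         ∎
      where open ≤-Reasoning
    bound : 2 * length y + 3 ≤ 2 * (length x + t) + 3
    bound = +-monoˡ-≤ 3 (*-monoʳ-≤ 2 leny)

-- Input and output have their last letter on top, because words are laid out on track 0 from left
-- to right, the direction in which a stack grows.
PolyTimeSM : (r K : ℕ) → (Str → Str) → Set₁
PolyTimeSM r K f = Σ[ F ∈ Frag (suc r) K ] Σ[ T ∈ (ℕ → ℕ) ] PolyBounded T × (∀ x →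
  Σ[ τ ∈ Stacks (suc r) K ] Runs F (Compile.inputStacks F x) (T (length x)) τ × lookup τ zero ≡ reverse (map bit (f x)))

runFor-mono : ∀ M c {s t o} → s ≤ t → runFor M s c ≡ just o → runFor M t c ≡ just o
runFor-mono M c {s} {t} s≤t eq with runFor⇒⟶ M s c eq
... | d , run , halt , out = trans (⟶⇒runFor M (Bounded.⟶-weaken (stepTM M) s≤t run) halt) (cong just out)

SM⇒TM : ∀ {r K f} → PolyTimeSM r K f → PolyTimeFun f
SM⇒TM {r} {K} {f} (F , T , pb , run) = Compile.machine F , proj₁ clock , λ x →
  let τ , ρ , o = run x
  in runFor-mono (Compile.machine F) (initial (Compile.machine F) x) (proj₂ clock (length x)) (Compile.correct F x ρ o)
  where
  clock : Σ[ c ∈ ℕ ] ∀ n → (n + (1 + n)) + (T n * (2 * (n + T n) + 5) + (2 * (n + T n) + 3)) ≤ n ^ c + c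
  clock = pb⇒clock (pb-+ (pb-+ pb-id (pb-+ (pb-const 1) pb-id))
     (pb-+ (pb-* pb (pb-+ (pb-* (pb-const 2) (pb-+ pb-id pb)) (pb-const 5)))
           (pb-+ (pb-* (pb-const 2) (pb-+ pb-id pb)) (pb-const 3))))

-- Stack machine fragments

finite× : ∀ {A B} → Finite A → Finite B → Finite (A × B)
finite× F G = record
  { size = F.size * G.size
  ; enc = λ (a , b) → combine (F.enc a) (G.enc b)
  ; dec = λ i → let j , k = remQuot G.size i in F.dec j , G.dec k
  ; dec-enc = λ (a , b) → trans (cong (λ (j , k) → F.dec j , G.dec k) (remQuot-combine (F.enc a) (G.enc b)))
                                 (cong₂ _,_ (F.dec-enc a) (G.dec-enc b))
  }
  where
  module F = Finite F
  module G = Finite G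

finiteBool : Finite Bool
finiteBool = finiteRetract
  (λ { false → zero ; true → suc zero })
  (λ { zero → false ; (suc zero) → true })
  (λ { false → refl ; true → refl })
  (finiteFin 2)

finiteDir : Finite Dir
finiteDir = finiteRetract
  (λ { L → zero ; R → suc zero ; S → suc (suc zero) })
  (λ { zero → L ; (suc zero) → R ; (suc (suc zero)) → S })
  (λ { L → refl ; R → refl ; S → refl })
  (finiteFin 3)

mapInstr : ∀ {r K} {X Y : Set} → (X → Y) → Instr r K X → Instr r K Y
mapInstr f (push i s x) = push i s (f x)
mapInstr f (pop i k)    = pop i (f ∘ k)

exec-mapInstr : ∀ {r K} {X Y : Set} (f : X → Y) (I : Instr r K X) σ →
  exec (mapInstr f I) σ ≡ (f (proj₁ (exec I σ)) , proj₂ (exec I σ))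
exec-mapInstr f (push i s x) σ = refl
exec-mapInstr f (pop i k)    σ = refl

infixr 4 _⨾_
_⨾_ : ∀ {r K} → Frag r K → Frag r K → Frag r K
F ⨾ G = record
  { Q = F.Q ⊎ G.Q
  ; finite = finite⊎ F.finite G.finite
  ; start = inj₁ F.start
  ; instr = λ { (inj₁ q) → mapInstr (Maybe.maybe (just ∘ inj₁) (just (inj₂ G.start))) (F.instr q)
              ; (inj₂ q) → mapInstr (Maybe.map inj₂) (G.instr q) } }
  where
  module F = Frag F
  module G = Frag G

module _ {r K : ℕ} {F G : Frag r K} where
  private
    module F = Frag F
    module G = Frag G
  open Bounded (stepSM F) using () renaming (_⟶[_]_ to _⟶F[_]_)
  open Bounded (stepSM G) using () renaming (_⟶[_]_ to _⟶G[_]_)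
  open Bounded (stepSM (F ⨾ G))

  left-runs : ∀ {s σ t τ} → (s , σ) ⟶F[ t ] (nothing , τ) →
    (Maybe.maybe (just ∘ inj₁) (just (inj₂ G.start)) s , σ) ⟶[ t ] (just (inj₂ G.start) , τ)
  left-runs Bounded.stop = stop
  left-runs {just q} {σ} (Bounded.go refl r) = go (cong just (exec-mapInstr _ (F.instr q) σ)) (left-runs r)

  right-runs : ∀ {s σ t τ} → (s , σ) ⟶G[ t ] (nothing , τ) → (Maybe.map inj₂ s , σ) ⟶[ t ] (nothing , τ)
  right-runs Bounded.stop = stop
  right-runs {just q} {σ} (Bounded.go refl r) = go (cong just (exec-mapInstr _ (G.instr q) σ)) (right-runs r)

  runs-⨾ : ∀ {σ s τ t ρ} → Runs F σ s τ → Runs G τ t ρ → Runs (F ⨾ G) σ (s + t) ρ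
  runs-⨾ p q = left-runs p ◅◅ right-runs q

-- A fragment touches few stacks; `mk` fixes all the others, so a run lemma proved once applies to
-- any choice of stacks.
record View {r K : ℕ} (i : Fin r) (mk : List (Letter K) → Stacks r K) : Set where
  field
    get : ∀ u → lookup (mk u) i ≡ u
    set : ∀ u w → mk u [ i ]≔ w ≡ mk w

module _ {r K : ℕ} {i : Fin r} {mk : List (Letter K) → Stacks r K} (V : View i mk) where
  open View V

  exec-pop : ∀ {X : Set} (k : Maybe (Letter K) → X) u → exec (pop i k) (mk u) ≡ (k (head u) , mk (drop 1 u))
  exec-pop k u rewrite get u = cong (k (head u) ,_) (set u (drop 1 u))

  exec-push : ∀ {X : Set} s (x : X) u → exec (push i s x) (mk u) ≡ (x , mk (s ∷ u))
  exec-push s x u rewrite get u = cong (x ,_) (set u (s ∷ u))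

clear : ∀ {r K} → Fin r → Frag r K
clear i = record
  { Q = Fin 1 ; finite = finiteFin 1 ; start = zero
  ; instr = λ _ → pop i (Maybe.map (λ _ → zero)) }

runs-clear : ∀ {r K} {i : Fin r} {mk : List (Letter K) → Stacks r K} → View i mk →
  ∀ u → Runs (clear i) (mk u) (length u + 1) (mk [])
runs-clear V []      = Bounded.go (cong just (exec-pop V (Maybe.map (λ _ → zero)) [])) Bounded.stop
runs-clear V (a ∷ u) = Bounded.go (cong just (exec-pop V (Maybe.map (λ _ → zero)) (a ∷ u))) (runs-clear V u)

copy : ∀ {r K} (i j k : Fin r) → Frag r K
copy {r} {K} i j k = record
  { Q = Maybe (Letter K ⊎ Letter K) ; finite = finiteMaybe (finite⊎ (finiteFin _) (finiteFin _)) ; start = nothing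
  ; instr = λ { nothing         → pop i (Maybe.map (λ s → just (inj₁ s)))
              ; (just (inj₁ s)) → push j s (just (just (inj₂ s)))
              ; (just (inj₂ s)) → push k s (just nothing) } }

runs-copy : ∀ {r K} {i j k : Fin r} {mk : List (Letter K) → List (Letter K) → List (Letter K) → Stacks r K} →
  (∀ v w → View i (λ u → mk u v w)) → (∀ u w → View j (λ v → mk u v w)) → (∀ u v → View k (λ w → mk u v w)) →
  ∀ u v w → Runs (copy i j k) (mk u v w) (3 * length u + 1) (mk [] (u ʳ++ v) (u ʳ++ w))
runs-copy I J K []      v w = Bounded.go (cong just (exec-pop (I v w) (Maybe.map (λ s → just (inj₁ s))) [])) Bounded.stop
runs-copy I J K (a ∷ u) v w = Bounded.⟶-weaken _ (≤-reflexive (lem (length u)))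
  (Bounded.go (cong just (exec-pop (I v w) (Maybe.map (λ s → just (inj₁ s))) (a ∷ u)))
    (Bounded.go (cong just (exec-push (J u w) a (just (just (inj₂ a))) v))
      (Bounded.go (cong just (exec-push (K u (a ∷ v)) a (just nothing) w))
        (runs-copy I J K u (a ∷ v) (a ∷ w)))))
  where
  lem : ∀ n → 3 + (3 * n + 1) ≡ 3 * suc n + 1
  lem = solve-∀

-- Two bits per transition are what the doubling of letters in `pair` requires.
data Out : Set where
  ε   : Out
  [_] : Bool → Out
  _⋯_ : Bool → Bool → Out

out : Out → Str
out ε       = []
out [ a ]   = a ∷ []
out (a ⋯ b) = a ∷ b ∷ []

-- Doubling, both projections of `pair`, unpadding and filling are one-pass transductions, so one
-- fragment and one time bound serve for all of them.
record FST : Set where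
  field
    n     : ℕ
    start : Fin n
    δ     : Fin n → Bool → Out × Fin n
    ω     : Fin n → Out

  transduce : Fin n → Str → Str
  transduce q []      = out (ω q)
  transduce q (b ∷ u) = out (proj₁ (δ q b)) ++ transduce (proj₂ (δ q b)) u

  run : Str → Str
  run = transduce start

-- `readBits` ends an output at the first letter that is not a bit; transducers stop at the same
-- place, so they can work on what a simulated machine has left.
NoBit : ∀ {K} → List (Letter K) → Set
NoBit w = (head w Maybe.>>= unbit) ≡ nothing

module _ {r K : ℕ} (T : FST) (i j : Fin r) where
  open FST T

  data Ctl : Set where
    read  : Fin n → Ctl
    emit₁ : Bool → Maybe (Fin n) → Ctl
    emit₂ : Bool → Bool → Maybe (Fin n) → Ctl

  finiteCtl : Finite Ctl
  finiteCtl = finiteRetract {B = Fin n ⊎ ((Bool × Maybe (Fin n)) ⊎ (Bool × Bool × Maybe (Fin n)))}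
    (λ { (read q) → inj₁ q ; (emit₁ a s) → inj₂ (inj₁ (a , s)) ; (emit₂ a b s) → inj₂ (inj₂ (a , b , s)) })
    (λ { (inj₁ q) → read q ; (inj₂ (inj₁ (a , s))) → emit₁ a s ; (inj₂ (inj₂ (a , b , s))) → emit₂ a b s })
    (λ { (read q) → refl ; (emit₁ a s) → refl ; (emit₂ a b s) → refl })
    (finite⊎ (finiteFin n) (finite⊎ (finite× finiteBool fM) (finite× finiteBool (finite× finiteBool fM))))
    where fM = finiteMaybe (finiteFin n)

  emitting : Out → Maybe (Fin n) → Maybe Ctl
  emitting ε       s = Maybe.map read s
  emitting [ a ]   s = just (emit₁ a s)
  emitting (a ⋯ b) s = just (emit₂ a b s)

  onRead : Fin n → Maybe Bool → Maybe Ctl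
  onRead q (just b) = emitting (proj₁ (δ q b)) (just (proj₂ (δ q b)))
  onRead q nothing  = emitting (ω q) nothing

  onReadLetter : Fin n → Maybe (Letter K) → Maybe Ctl
  onReadLetter q m = onRead q (m Maybe.>>= unbit)

  transducer : Frag r K
  transducer = record
    { Q = Ctl ; finite = finiteCtl ; start = read start
    ; instr = λ { (read q)      → pop i (onReadLetter q)
                ; (emit₁ a s)   → push j (bit a) (Maybe.map read s)
                ; (emit₂ a b s) → push j (bit a) (just (emit₁ b s)) } }

  module _ {mk : List (Letter K) → List (Letter K) → Stacks r K}
           (I : ∀ v → View i (λ u → mk u v)) (J : ∀ u → View j (mk u)) where
    open Bounded (stepSM transducer)

    runs-emit : ∀ o s u v →
      (emitting o s , mk u v) ⟶[ 2 ] (Maybe.map read s , mk u (map bit (out o) ʳ++ v))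
    runs-emit ε       s u v = stop
    runs-emit [ a ]   s u v = go (cong just (exec-push (J u) (bit a) _ v)) stop
    runs-emit (a ⋯ b) s u v = go (cong just (exec-push (J u) (bit a) _ v))
      (go (cong just (exec-push (J u) (bit b) _ (bit a ∷ v))) stop)

    -- The pop that detects the end of x also removes the delimiter, hence `drop 1 w`.
    runs-transduce : ∀ q x w v → NoBit w →
      (just (read q) , mk (map bit x ++ w) v) ⟶[ 3 * length x + 3 ]
      (nothing , mk (drop 1 w) (map bit (transduce q x) ʳ++ v))
    runs-transduce q [] w v nb = go (cong just (trans (exec-pop (I v) (onReadLetter q) w) (cong (λ m → onRead q m , mk (drop 1 w) v) nb)))
      (runs-emit (ω q) nothing (drop 1 w) v)
    runs-transduce q (b ∷ x) w v nb
      rewrite map-++ (bit {K}) (out (proj₁ (δ q b))) (transduce (proj₂ (δ q b)) x)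
            | ++-ʳ++ (map (bit {K}) (out (proj₁ (δ q b)))) {map bit (transduce (proj₂ (δ q b)) x)} {v}
      = ⟶-weaken (≤-reflexive (lem (length x)))
          (go (cong just (trans (exec-pop (I v) (onReadLetter q) (bit b ∷ map bit x ++ w)) (cong (λ m → onRead q m , mk (map bit x ++ w) v) (unbit-bit {K} b))))
            (runs-emit (proj₁ (δ q b)) (just (proj₂ (δ q b))) (map bit x ++ w) v
              ◅◅ runs-transduce (proj₂ (δ q b)) x w _ nb))
      where
      lem : ∀ n → suc (2 + (3 * n + 3)) ≡ 3 * suc n + 3
      lem = solve-∀

transduce-copy : ∀ T q → FST.ω T q ≡ ε → (∀ b → FST.δ T q b ≡ ([ b ] , q)) → ∀ x → FST.transduce T q x ≡ x
transduce-copy T q ω≡ δ≡ []      = cong out ω≡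
transduce-copy T q ω≡ δ≡ (b ∷ x) rewrite δ≡ b = cong (b ∷_) (transduce-copy T q ω≡ δ≡ x)

idFST : FST
idFST = record { n = 1 ; start = zero ; δ = λ q b → [ b ] , q ; ω = λ _ → ε }

idFST-run : ∀ x → FST.run idFST x ≡ x
idFST-run = transduce-copy idFST zero refl (λ _ → refl)

moveBits : ∀ {r K} (i j : Fin r) → Frag r K
moveBits = transducer idFST

runs-moveBits : ∀ {r K} {i j : Fin r} {mk : List (Letter K) → List (Letter K) → Stacks r K} →
  (∀ v → View i (λ u → mk u v)) → (∀ u → View j (mk u)) → ∀ x w v → NoBit w →
  Runs (moveBits i j) (mk (map bit x ++ w) v) (3 * length x + 3) (mk (drop 1 w) (map bit x ʳ++ v))
runs-moveBits {i = i} {j} {mk} I J x w v nb =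
  subst (λ y → Runs (moveBits i j) (mk (map bit x ++ w) v) (3 * length x + 3) (mk (drop 1 w) (map bit y ʳ++ v)))
    (idFST-run x) (runs-transduce idFST i j I J zero x w v nb)

-- Several machines run over one stack alphabet, the disjoint union of their extra letters; `ρ`
-- recovers the letters of one of them.
record Retract (k K : ℕ) : Set where
  field
    ι   : Fin k → Fin K
    ρ   : Fin K → Maybe (Fin k)
    ρ-ι : ∀ i → ρ (ι i) ≡ just i

retractˡ : ∀ {k l m} → Retract k l → Retract k (l + m)
retractˡ {k} {l} {m} r = record
  { ι = λ i → ι i ↑ˡ m
  ; ρ = λ j → Sum.[ ρ , (λ _ → nothing) ] (splitAt l j)
  ; ρ-ι = λ i → trans (cong Sum.[ ρ , (λ _ → nothing) ] (splitAt-↑ˡ l (ι i) m)) (ρ-ι i) }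
  where open Retract r

retractʳ : ∀ {k l m} → Retract k m → Retract k (l + m)
retractʳ {k} {l} {m} r = record
  { ι = λ i → l ↑ʳ ι i
  ; ρ = λ j → Sum.[ (λ _ → nothing) , ρ ] (splitAt l j)
  ; ρ-ι = λ i → trans (cong Sum.[ (λ _ → nothing) , ρ ] (splitAt-↑ʳ l m (ι i))) (ρ-ι i) }
  where open Retract r

retractId : ∀ {k} → Retract k k
retractId = record { ι = id ; ρ = just ; ρ-ι = λ _ → refl }

Stacks₄ : ℕ → Set
Stacks₄ K = Stacks 4 K

pattern s0 = zero
pattern s1 = suc zero
pattern s2 = suc (suc zero)
pattern s3 = suc (suc (suc zero))

view₀ : ∀ {K} {b c d : List (Letter K)} → View s0 (λ u → u ∷ b ∷ c ∷ d ∷ [])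
view₀ = record { get = λ _ → refl ; set = λ _ _ → refl }

view₁ : ∀ {K} {a c d : List (Letter K)} → View s1 (λ u → a ∷ u ∷ c ∷ d ∷ [])
view₁ = record { get = λ _ → refl ; set = λ _ _ → refl }

view₂ : ∀ {K} {a b d : List (Letter K)} → View s2 (λ u → a ∷ b ∷ u ∷ d ∷ [])
view₂ = record { get = λ _ → refl ; set = λ _ _ → refl }

view₃ : ∀ {K} {a b c : List (Letter K)} → View s3 (λ u → a ∷ b ∷ c ∷ u ∷ [])
view₃ = record { get = λ _ → refl ; set = λ _ _ → refl }

-- Turing machines as subroutines of stack machines

module Simulate {K : ℕ} (M : TM) (ret : Retract (TM.k M) K) where
  open TM M renaming (Q to Q#)
  open Retract ret

  emb : Sym M → Letter K
  emb zero                = zero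
  emb (suc zero)          = suc zero
  emb (suc (suc zero))    = suc (suc zero)
  emb (suc (suc (suc i))) = suc (suc (suc (ι i)))

  -- An empty stack reads as a blank, like the tape beyond its ends. Foreign letters do not occur in
  -- a simulation and get the value blank as well.
  prj : Maybe (Letter K) → Sym M
  prj nothing                     = zero
  prj (just zero)                 = zero
  prj (just (suc zero))           = suc zero
  prj (just (suc (suc zero)))     = suc (suc zero)
  prj (just (suc (suc (suc i))))  = Maybe.maybe (λ j → suc (suc (suc j))) zero (ρ i)

  prj-emb : ∀ s → prj (just (emb s)) ≡ s
  prj-emb zero                = refl
  prj-emb (suc zero)          = refl
  prj-emb (suc (suc zero))    = refl
  prj-emb (suc (suc (suc i))) rewrite ρ-ι i = refl

  emb-encBit : ∀ b → emb (encBit M b) ≡ bit b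
  emb-encBit false = refl
  emb-encBit true  = refl

  afterBits : List (Sym M) → List (Sym M)
  afterBits []                      = []
  afterBits w@(zero ∷ _)            = w
  afterBits (suc zero ∷ w)          = afterBits w
  afterBits (suc (suc zero) ∷ w)    = afterBits w
  afterBits w@(suc (suc (suc _)) ∷ _) = w

  emb-readBits : ∀ w → map emb w ≡ map bit (readBits M w) ++ map emb (afterBits w)
  emb-readBits []                        = refl
  emb-readBits (zero ∷ w)                = refl
  emb-readBits (suc zero ∷ w)            = cong (bit false ∷_) (emb-readBits w)
  emb-readBits (suc (suc zero) ∷ w)      = cong (bit true ∷_) (emb-readBits w)
  emb-readBits (suc (suc (suc _)) ∷ w)   = refl

  afterBits-NoBit : ∀ w → NoBit (map emb (afterBits w))
  afterBits-NoBit []                      = refl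
  afterBits-NoBit (zero ∷ w)              = refl
  afterBits-NoBit (suc zero ∷ w)          = afterBits-NoBit w
  afterBits-NoBit (suc (suc zero) ∷ w)    = afterBits-NoBit w
  afterBits-NoBit (suc (suc (suc _)) ∷ w) = refl

  data Ctl′ : Set where
    scan   : Fin (suc Q#) → Ctl′
    act    : Dir → Fin (suc Q#) → Sym M → Ctl′
    put    : Fin (suc Q#) → Sym M → Sym M → Ctl′
    finish : Sym M → Ctl′

  finiteCtl′ : Finite Ctl′
  finiteCtl′ = finiteRetract {B = Fin (suc Q#) ⊎ ((Dir × Fin (suc Q#) × Sym M) ⊎ ((Fin (suc Q#) × Sym M × Sym M) ⊎ Sym M))}
    (λ { (scan q) → inj₁ q ; (act d q s) → inj₂ (inj₁ (d , q , s)) ; (put q s a) → inj₂ (inj₂ (inj₁ (q , s , a))) ; (finish s) → inj₂ (inj₂ (inj₂ s)) })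
    (λ { (inj₁ q) → scan q ; (inj₂ (inj₁ (d , q , s))) → act d q s ; (inj₂ (inj₂ (inj₁ (q , s , a)))) → put q s a ; (inj₂ (inj₂ (inj₂ s))) → finish s })
    (λ { (scan q) → refl ; (act d q s) → refl ; (put q s a) → refl ; (finish s) → refl })
    (finite⊎ fQ (finite⊎ (finite× finiteDir (finite× fQ fS)) (finite⊎ (finite× fQ (finite× fS fS)) fS)))
    where
    fQ = finiteFin (suc Q#)
    fS = finiteFin (3 + k)

  onScan : Sym M → Maybe (Fin (suc Q#) × Sym M × Dir) → Maybe Ctl′
  onScan h nothing            = just (finish h)
  onScan h (just (q , s , d)) = just (act d q s)

  instr′ : Ctl′ → Instr 4 K (Maybe Ctl′)
  instr′ (scan q)    = pop s1 (λ m → onScan (prj m) (δ q (prj m)))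
  instr′ (act S q s) = push s1 (emb s) (just (scan q))
  instr′ (act R q s) = push s0 (emb s) (just (scan q))
  instr′ (act L q s) = pop s0 (λ m → just (put q s (prj m)))
  instr′ (put q s a) = push s1 (emb s) (just (act S q a))
  instr′ (finish h)  = push s1 (emb h) nothing

  -- Stack 0 holds the tape left of the head, stack 1 the scanned cell and the tape right of it.
  simulator : Frag 4 K
  simulator = record { Q = Ctl′ ; finite = finiteCtl′ ; start = scan zero ; instr = instr′ }

  tape : List (Letter K) → List (Letter K) → List (Sym M) → List (Sym M) → Stacks₄ K
  tape c d l w = map emb l ∷ map emb w ∷ c ∷ d ∷ []

  module _ (c d : List (Letter K)) where
    open Bounded (stepSM simulator)
    open Bounded (stepTM M) using () renaming (_⟶[_]_ to _⟶TM[_]_)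

    runs-scan : ∀ q l w → Σ[ h ∈ Sym M ] Σ[ r ∈ List (Sym M) ] load M q l w ≡ cfg q l h r ×
      stepSM simulator (just (scan q) , tape c d l w) ≡ just (onScan h (δ q h) , tape c d l r)
    runs-scan q l []      = zero , [] , refl , refl
    runs-scan q l (h ∷ r) = h , r , refl , cong (λ h′ → just (onScan h′ (δ q h′) , tape c d l r)) (prj-emb h)

    runs-act : ∀ dir q l s r → Σ[ l′ ∈ List (Sym M) ] Σ[ w′ ∈ List (Sym M) ] move M q l s r dir ≡ load M q l′ w′ ×
      ((just (act dir q s) , tape c d l r) ⟶[ 3 ] (just (scan q) , tape c d l′ w′))
    runs-act S q l s r       = l , s ∷ r , refl , go refl stop
    runs-act R q l s []      = s ∷ l , [] , refl , go refl stop
    runs-act R q l s (a ∷ r) = s ∷ l , a ∷ r , refl , go refl stop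
    runs-act L q []      s r = [] , zero ∷ s ∷ r , refl , go refl (go refl (go refl stop))
    runs-act L q (a ∷ l) s r = l , a ∷ s ∷ r , refl ,
      go (cong (λ a′ → just (just (put q s a′) , tape c d l r)) (prj-emb a)) (go refl (go refl stop))

    -- A machine step costs one pop for the scan and at most three instructions for the move. The
    -- final 2 are the scan that finds no transition and the push that puts the letter back.
    runs-simulator : ∀ {t q l w e} → load M q l w ⟶TM[ t ] e → stepTM M e ≡ nothing →
      Σ[ l′ ∈ List (Sym M) ] Σ[ w′ ∈ List (Sym M) ] readBits M w′ ≡ output M e ×
        ((just (scan q) , tape c d l w) ⟶[ 4 * t + 2 ] (nothing , tape c d l′ w′))
    runs-simulator {t} {q} {l} {w} run halt with runs-scan q l w
    ... | h , r , ld , sc with δ q h in δ≡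
    runs-simulator {t} {q} {l} {w} run halt | h , r , ld , sc | nothing = l , h ∷ r , out≡ run , ⟶-weaken (m≤n+m 2 (4 * t)) (go sc (go refl stop))
      where
      out≡ : ∀ {t e} → load M q l w ⟶TM[ t ] e → readBits M (h ∷ r) ≡ output M e
      out≡ Bounded.stop rewrite ld = refl
      out≡ (Bounded.go p _) rewrite ld | δ≡ with p
      ... | ()
    runs-simulator {t} {q} {l} {w} Bounded.stop halt | h , r , ld , sc | just x rewrite ld | δ≡ with halt
    ... | ()
    runs-simulator {suc t} {q} {l} {w} (Bounded.go p run) halt | h , r , ld , sc | just (q′ , s , dir) rewrite ld | δ≡ with p
    ... | refl with runs-act dir q′ l s r
    ... | l₁ , w₁ , mv≡ , ra with runs-simulator {t} {q′} {l₁} {w₁} (subst (_⟶TM[ t ] _) mv≡ run) halt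
    ... | l₂ , w₂ , o , rs = l₂ , w₂ , o , ⟶-weaken (≤-reflexive (lem t)) (go sc (ra ◅◅ rs))
      where
      lem : ∀ t → suc (3 + (4 * t + 2)) ≡ 4 * suc t + 2
      lem = solve-∀

    runs-input : ∀ {x t y} → runFor M t (initial M x) ≡ just y →
      Σ[ l′ ∈ List (Sym M) ] Σ[ w′ ∈ List (Sym M) ] readBits M w′ ≡ y ×
        Runs simulator ([] ∷ map bit x ∷ c ∷ d ∷ []) (4 * t + 2) (tape c d l′ w′)
    runs-input {x} {t} eq =
      let e , run , halt , o = runFor⇒⟶ M t (initial M x) eq
          l , w , o′ , rs    = runs-simulator (subst (_⟶TM[ t ] e) (initial≡load M x) run) halt
      in l , w , trans o′ o ,
         subst (λ u → Runs simulator ([] ∷ u ∷ c ∷ d ∷ []) (4 * t + 2) (tape c d l w)) (enc x) rs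
      where
      enc : ∀ x → map emb (map (encBit M) x) ≡ map bit x
      enc []      = refl
      enc (b ∷ x) = cong₂ _∷_ (emb-encBit b) (enc x)

  length-readBits : ∀ w → length (readBits M w) ≤ length w
  length-readBits []                      = z≤n
  length-readBits (zero ∷ w)              = z≤n
  length-readBits (suc zero ∷ w)          = s≤s (length-readBits w)
  length-readBits (suc (suc zero) ∷ w)    = s≤s (length-readBits w)
  length-readBits (suc (suc (suc _)) ∷ w) = z≤n

  length-afterBits : ∀ w → length (afterBits w) ≤ length w
  length-afterBits []                      = z≤n
  length-afterBits (zero ∷ w)              = ≤-refl
  length-afterBits (suc zero ∷ w)          = ≤-trans (length-afterBits w) (n≤1+n _)
  length-afterBits (suc (suc zero) ∷ w)    = ≤-trans (length-afterBits w) (n≤1+n _)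
  length-afterBits (suc (suc (suc _)) ∷ w) = ≤-refl

  runs-extract : ∀ {j} {mk : List (Letter K) → List (Letter K) → Stacks₄ K} →
    (∀ v → View s1 (λ u → mk u v)) → (∀ u → View j (mk u)) → ∀ w →
    Runs (moveBits s1 j ⨾ clear s1) (mk (map emb w) []) ((3 * length w + 3) + (length w + 1))
      (mk [] (reverse (map bit (readBits M w))))
  runs-extract {j} {mk} I J w = subst (λ y → Runs _ (mk y []) _ _) (sym (emb-readBits w))
    (runs-⨾ (Bounded.⟶-weaken _ (+-monoˡ-≤ 3 (*-monoʳ-≤ 3 (length-readBits w)))
              (runs-moveBits I J (readBits M w) (map emb (afterBits w)) [] (afterBits-NoBit w)))
            (Bounded.⟶-weaken _ (+-monoˡ-≤ 1 (≤-trans (drop≤ (afterBits w)) (length-afterBits w)))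
              (runs-clear (I _) (drop 1 (map emb (afterBits w))))))
    where
    drop≤ : ∀ w → length (drop 1 (map emb w)) ≤ length w
    drop≤ []      = z≤n
    drop≤ (_ ∷ w) = ≤-trans (≤-reflexive (length-map emb w)) (n≤1+n _)

-- An upper bound for simulating t steps on an input of length n and extracting the output.
evalTime : ℕ → ℕ → ℕ
evalTime n t = t + ((t + 1) + ((3 * (n + t) + 3) + ((n + t) + 1)))

module _ {K : ℕ} {f : Str → Str} (F : PolyTimeFun f) (ret : Retract (TM.k (proj₁ F)) K) where
  private
    M = proj₁ F
    c = proj₁ (proj₂ F)
  open Simulate M ret

  simTime : ℕ → ℕ
  simTime n = 4 * (n ^ c + c) + 2

  pb-simTime : PolyBounded simTime
  pb-simTime = pb-+ (pb-* (pb-const 4) (pb-clock c)) (pb-const 2)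

  evalTo : Fin 4 → Frag 4 K
  evalTo j = simulator ⨾ clear s0 ⨾ moveBits s1 j ⨾ clear s1

  module _ (x : Str) where
    private
      n = length x
      t = simTime n

    tape-bound : ∀ {u d l w} → Runs simulator ([] ∷ map bit x ∷ u ∷ d ∷ []) t (tape u d l w) → length w ≤ n + t
    tape-bound {u} {d} {l} {w} rs = begin
      length w                        ≡⟨ sym (length-map emb w) ⟩
      length (map emb w)              ≤⟨ height-run simulator rs s1 ⟩
      length (map (bit {K}) x) + t    ≡⟨ cong (_+ t) (length-map bit x) ⟩
      n + t                           ∎
      where open ≤-Reasoning

    length-eval : length (f x) ≤ n + t
    length-eval =
      let l , w , o , rs = runs-input [] [] (proj₂ (proj₂ F) x)
      in ≤-trans (≤-reflexive (cong length (sym o))) (≤-trans (length-readBits w) (tape-bound rs))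

    -- Stacks 2 and 3 are left alone except for the destination `j`, so a copy of the input or an
    -- earlier value can wait there.
    runs-evalTo : ∀ u d {j} {mk : List (Letter K) → List (Letter K) → Stacks₄ K} →
      (∀ v → View s1 (λ u → mk u v)) → (∀ u → View j (mk u)) → (∀ w → mk w [] ≡ [] ∷ w ∷ u ∷ d ∷ []) →
      Runs (evalTo j) ([] ∷ map bit x ∷ u ∷ d ∷ []) (evalTime n t) (mk [] (reverse (map bit (f x))))
    runs-evalTo u d {j} {mk} I J mk≡ =
      let l , w , o , rs = runs-input u d (proj₂ (proj₂ F) x)
      in runs-⨾ rs
           (runs-⨾ (Bounded.⟶-weaken _ (+-monoˡ-≤ 1 (height-run simulator rs s0))
                     (runs-clear view₀ (map emb l)))
             (Bounded.⟶-weaken _ (+-mono-≤ (+-monoˡ-≤ 3 (*-monoʳ-≤ 3 (tape-bound rs))) (+-monoˡ-≤ 1 (tape-bound rs)))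
               (subst₂ (λ σ y → Runs (moveBits s1 j ⨾ clear s1) σ ((3 * length w + 3) + (length w + 1)) (mk [] (reverse (map bit y))))
                 (mk≡ (map emb w)) o (runs-extract I J w))))

module _ {r K : ℕ} {i j : Fin r} {mk : List (Letter K) → List (Letter K) → Stacks r K}
         (I : ∀ v → View i (λ u → mk u v)) (J : ∀ u → View j (mk u)) where

  runs-move : ∀ x v → Runs (moveBits i j) (mk (map bit x) v) (3 * length x + 3) (mk [] (map bit x ʳ++ v))
  runs-move x v = subst (λ u → Runs (moveBits i j) (mk u v) (3 * length x + 3) (mk [] (map bit x ʳ++ v)))
    (++-identityʳ (map bit x)) (runs-moveBits I J x [] v refl)

  runs-moveBack : ∀ x → Runs (moveBits i j) (mk (reverse (map bit x)) []) (3 * length x + 3) (mk [] (map bit x))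
  runs-moveBack x = subst₂ (λ u v → Runs (moveBits i j) (mk u []) (3 * length x + 3) (mk [] v))
    (reverse-map bit x)
    (trans (cong reverse (reverse-map bit x)) (reverse-involutive (map bit x)))
    (subst (λ n → Runs (moveBits i j) (mk (map bit (reverse x)) []) (3 * n + 3) (mk [] (reverse (map bit (reverse x)))))
      (length-reverse x) (runs-move (reverse x) []))

-- A binary operation as a subroutine: it may use an alphabet of its own, leave garbage on stacks 1
-- to 3, and take time polynomial in the total length of its arguments.
record Operation (op : Str → Str → Str) : Set₁ where
  field
    k    : ℕ
    d    : ℕ
    frag : ∀ {K} → Retract k K → Frag 4 K
    runs : ∀ {K} (ret : Retract k K) u v → Σ[ τ ∈ Stacks₄ K ]
      Runs (frag ret) ([] ∷ map bit u ∷ map bit v ∷ [] ∷ []) ((2 + (length u + length v)) ^ d) τ ×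
      lookup τ zero ≡ reverse (map bit (op u v))

opaque
  -- The closure property behind composition, pairing and all tests. A copy of x waits on stack 2
  -- while f is evaluated, and the value of f waits on stack 3 while g is evaluated.
  lift₂ : ∀ {op f g} → Operation op → PolyTimeFun f → PolyTimeFun g → PolyTimeFun (λ x → op (f x) (g x))
  lift₂ {op} {f} {g} O F G = SM⇒TM (prog , T , pbT , λ x →
    let τ , ro , o = O.runs retO (f x) (g x)
        mb = map (bit {K}) x
        rF = reverse (map (bit {K}) (f x))
    in τ
     , runs-⨾ (subst₂ (λ m y → Runs (copy s0 s1 s2) (reverse mb ∷ [] ∷ [] ∷ [] ∷ []) (3 * m + 1) ([] ∷ y ∷ y ∷ [] ∷ []))
                (trans (length-reverse mb) (length-map bit x)) (reverse-involutive mb)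
                (runs-copy {mk = λ a b c → a ∷ b ∷ c ∷ [] ∷ []} (λ _ _ → view₀) (λ _ _ → view₁) (λ _ _ → view₂)
                  (reverse mb) [] []))
       (runs-⨾ (runs-evalTo F retF x mb [] {mk = λ a b → [] ∷ a ∷ mb ∷ b ∷ []} (λ _ → view₁) (λ _ → view₃) (λ _ → refl))
       (runs-⨾ (runs-move {mk = λ a b → b ∷ [] ∷ a ∷ rF ∷ []} (λ _ → view₂) (λ _ → view₀) x [])
       (runs-⨾ (runs-moveBack {mk = λ a b → a ∷ b ∷ [] ∷ rF ∷ []} (λ _ → view₀) (λ _ → view₁) x)
       (runs-⨾ (runs-evalTo G retG x [] rF {mk = λ a b → b ∷ a ∷ [] ∷ rF ∷ []} (λ _ → view₁) (λ _ → view₀) (λ _ → refl))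
       (runs-⨾ (Bounded.⟶-weaken _ (+-monoˡ-≤ 3 (*-monoʳ-≤ 3 (length-eval G retG x)))
                 (runs-moveBack {mk = λ a b → a ∷ [] ∷ b ∷ rF ∷ []} (λ _ → view₀) (λ _ → view₂) (g x)))
       (runs-⨾ (Bounded.⟶-weaken _ (+-monoˡ-≤ 3 (*-monoʳ-≤ 3 (length-eval F retF x)))
                 (runs-moveBack {mk = λ a b → [] ∷ b ∷ map bit (g x) ∷ a ∷ []} (λ _ → view₃) (λ _ → view₁) (f x)))
         (Bounded.⟶-weaken _ (^-monoˡ-≤ O.d (+-monoʳ-≤ 2 (+-mono-≤ (length-eval F retF x) (length-eval G retG x)))) ro)))))))
     , o)
    where
    module O = Operation O
    kF kG K : ℕ
    kF = TM.k (proj₁ F)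
    kG = TM.k (proj₁ G)
    K = kF + (kG + O.k)
    retF : Retract kF K
    retF = retractˡ retractId
    retG : Retract kG K
    retG = retractʳ {l = kF} (retractˡ retractId)
    retO : Retract O.k K
    retO = retractʳ {l = kF} (retractʳ {l = kG} retractId)
    prog : Frag 4 K
    prog = copy s0 s1 s2 ⨾ evalTo F retF s3 ⨾ moveBits s2 s0 ⨾ moveBits s0 s1
         ⨾ evalTo G retG s0 ⨾ moveBits s0 s2 ⨾ moveBits s3 s1 ⨾ O.frag retO
    a b T : ℕ → ℕ
    a = simTime F retF
    b = simTime G retG
    T n = (3 * n + 1) + (evalTime n (a n) + ((3 * n + 3) + ((3 * n + 3) + (evalTime n (b n)
        + ((3 * (n + b n) + 3) + ((3 * (n + a n) + 3) + (2 + ((n + a n) + (n + b n))) ^ O.d))))))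
    pb-linear : ∀ {t} k → PolyBounded t → PolyBounded (λ n → 3 * t n + k)
    pb-linear k p = pb-+ (pb-* (pb-const 3) p) (pb-const k)
    pb-evalTime : ∀ {t} → PolyBounded t → PolyBounded (λ n → evalTime n (t n))
    pb-evalTime p = pb-+ p (pb-+ (pb-+ p (pb-const 1)) (pb-+ (pb-linear 3 (pb-+ pb-id p)) (pb-+ (pb-+ pb-id p) (pb-const 1))))
    pbA : PolyBounded a
    pbA = pb-simTime F retF
    pbB : PolyBounded b
    pbB = pb-simTime G retG
    pbT : PolyBounded T
    pbT = pb-+ (pb-linear 1 pb-id) (pb-+ (pb-evalTime pbA) (pb-+ (pb-linear 3 pb-id) (pb-+ (pb-linear 3 pb-id) (pb-+ (pb-evalTime pbB)
        (pb-+ (pb-linear 3 (pb-+ pb-id pbB)) (pb-+ (pb-linear 3 (pb-+ pb-id pbA)) (pb-pow O.d (pb-+ (pb-+ pb-id pbA) (pb-+ pb-id pbB)))))))))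

-- Basic string operations on stacks

appendFST : ∀ T → Operation (λ u v → FST.run T u ++ v)
appendFST T = record
  { k = 0 ; d = proj₁ pb
  ; frag = λ _ → transducer T s1 s0 ⨾ moveBits s2 s0
  ; runs = λ {K} _ u v → _
    , Bounded.⟶-weaken _ (≤-trans (≤-reflexive (lem (length u) (length v))) (proj₂ pb (length u + length v)))
        (runs-⨾
          (subst (λ w → Runs (transducer T s1 s0) ([] ∷ w ∷ map bit v ∷ [] ∷ []) (3 * length u + 3) ((map bit (FST.run T u) ʳ++ []) ∷ [] ∷ map bit v ∷ [] ∷ []))
            (++-identityʳ (map bit u))
            (runs-transduce {K = K} T s1 s0 {mk = λ a b → b ∷ a ∷ map bit v ∷ [] ∷ []} (λ _ → view₁) (λ _ → view₀) (FST.start T) u [] [] refl))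
          (runs-move {mk = λ a b → b ∷ [] ∷ a ∷ [] ∷ []} (λ _ → view₂) (λ _ → view₀) v _))
    , trans (sym (++-ʳ++ (map bit (FST.run T u)))) (cong reverse (sym (map-++ bit (FST.run T u) v))) }
  where
  pb : PolyBounded (λ n → 3 * n + 6)
  pb = pb-+ (pb-* (pb-const 3) pb-id) (pb-const 6)
  lem : ∀ m n → (3 * m + 3) + (3 * n + 3) ≡ 3 * (m + n) + 6
  lem = solve-∀

-- Makes composition an instance of `lift₂`.
after : ∀ {f} → PolyTimeFun f → Operation (λ u _ → f u)
after {f} F = record
  { k = TM.k (proj₁ F) ; d = proj₁ pb
  ; frag = λ ret → evalTo F ret s0
  ; runs = λ ret u v → _
    , Bounded.⟶-weaken _ (≤-trans (proj₂ pb (length u)) (^-monoˡ-≤ (proj₁ pb) (+-monoʳ-≤ 2 (m≤m+n (length u) (length v)))))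
        (runs-evalTo F ret u (map bit v) [] {mk = λ a b → b ∷ a ∷ map bit v ∷ [] ∷ []} (λ _ → view₁) (λ _ → view₀) (λ _ → refl))
    , refl }
  where
  t : ℕ → ℕ
  t n = 4 * (n ^ proj₁ (proj₂ F) + proj₁ (proj₂ F)) + 2
  pt : PolyBounded t
  pt = pb-+ (pb-* (pb-const 4) (pb-clock (proj₁ (proj₂ F)))) (pb-const 2)
  pb : PolyBounded (λ n → evalTime n (t n))
  pb = pb-+ pt (pb-+ (pb-+ pt (pb-const 1)) (pb-+ (pb-+ (pb-* (pb-const 3) (pb-+ pb-id pt)) (pb-const 3)) (pb-+ (pb-+ pb-id pt) (pb-const 1))))

replicate-+ : ∀ {A : Set} m n {x : A} → replicate (m + n) x ≡ replicate m x ++ replicate n x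
replicate-+ zero    n     = refl
replicate-+ (suc m) n {x} = cong (x ∷_) (replicate-+ m n)

zeros : ℕ → Str
zeros n = replicate n false

module _ {K : ℕ} where
  private
    F : Letter K
    F = bit false

  data MulCtl : Set where
    outer inner save count restore : MulCtl
    unsave : MulCtl

  finiteMulCtl : Finite MulCtl
  finiteMulCtl = finiteRetract {B = Fin 6}
    (λ { outer → zero ; inner → suc zero ; save → suc (suc zero) ; count → suc (suc (suc zero)) ; restore → suc (suc (suc (suc zero))) ; unsave → suc (suc (suc (suc (suc zero)))) })
    (λ { zero → outer ; (suc zero) → inner ; (suc (suc zero)) → save ; (suc (suc (suc zero))) → count ; (suc (suc (suc (suc zero)))) → restore ; (suc (suc (suc (suc (suc zero))))) → unsave })
    (λ { outer → refl ; inner → refl ; save → refl ; count → refl ; restore → refl ; unsave → refl })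
    (finiteFin 6)

  multiplier : Frag 4 K
  multiplier = record { Q = MulCtl ; finite = finiteMulCtl ; start = outer ; instr = instr }
    where
    instr : MulCtl → Instr 4 K (Maybe MulCtl)
    instr outer   = pop s1 (Maybe.map (λ _ → inner))
    instr inner   = pop s2 (λ m → just (Maybe.maybe (λ _ → save) restore m))
    instr save    = push s3 F (just count)
    instr count   = push s0 F (just inner)
    instr restore = pop s3 (λ m → just (Maybe.maybe (λ _ → unsave) outer m))
    instr unsave  = push s2 F (just restore)

  open Bounded (stepSM multiplier)

  shift : ∀ n → (v : List (Letter K)) → replicate n F ++ F ∷ v ≡ F ∷ replicate n F ++ v
  shift zero    v = refl
  shift (suc n) v = cong (F ∷_) (shift n v)

  runs-inner : ∀ o u v w → (just inner , o ∷ u ∷ v ∷ w ∷ []) ⟶[ 3 * length v + 1 ]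
    (just restore , (replicate (length v) F ++ o) ∷ u ∷ [] ∷ (replicate (length v) F ++ w) ∷ [])
  runs-inner o u []      w = go refl stop
  runs-inner o u (a ∷ v) w = ⟶-weaken (≤-reflexive (lem (length v))) (go refl (go refl (go refl
    (subst₂ (λ y z → (just inner , (F ∷ o) ∷ u ∷ v ∷ (F ∷ w) ∷ []) ⟶[ 3 * length v + 1 ] (just restore , y ∷ u ∷ [] ∷ z ∷ []))
      (shift (length v) o) (shift (length v) w) (runs-inner (F ∷ o) u v (F ∷ w))))))
    where
    lem : ∀ n → 3 + (3 * n + 1) ≡ 3 * suc n + 1
    lem = solve-∀

  runs-restore : ∀ o u n v → (just restore , o ∷ u ∷ v ∷ replicate n F ∷ []) ⟶[ 2 * n + 1 ]
    (just outer , o ∷ u ∷ (replicate n F ++ v) ∷ [] ∷ [])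
  runs-restore o u zero    v = go refl stop
  runs-restore o u (suc n) v = ⟶-weaken (≤-reflexive (lem n)) (go refl (go refl
    (subst (λ y → (just restore , o ∷ u ∷ (F ∷ v) ∷ replicate n F ∷ []) ⟶[ 2 * n + 1 ] (just outer , o ∷ u ∷ y ∷ [] ∷ []))
      (shift n v) (runs-restore o u n (F ∷ v)))))
    where
    lem : ∀ n → 2 + (2 * n + 1) ≡ 2 * suc n + 1
    lem = solve-∀

  runs-outer : ∀ u v o → Σ[ v′ ∈ List (Letter K) ] (just outer , o ∷ u ∷ v ∷ [] ∷ []) ⟶[ length u * (5 * length v + 3) + 1 ]
    (nothing , (replicate (length u * length v) F ++ o) ∷ [] ∷ v′ ∷ [] ∷ [])
  runs-outer []      v o = v , go refl stop
  runs-outer (a ∷ u) v o =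
    -- Moving stack 2 to stack 3 and back preserves only its height and turns its letters into
    -- zeros; the remaining rounds depend on nothing but the height.
    let v′ , r = runs-outer u (replicate n F) (replicate n F ++ o)
    in v′ , ⟶-weaken (≤-reflexive (lem n (length u))) (go refl
      (runs-inner o u v [] ◅◅
        subst (λ w → (just restore , (replicate n F ++ o) ∷ u ∷ [] ∷ w ∷ []) ⟶[ 2 * n + 1 ] (just outer , (replicate n F ++ o) ∷ u ∷ replicate n F ∷ [] ∷ []))
          (sym (++-identityʳ (replicate n F)))
          (subst (λ w → (just restore , (replicate n F ++ o) ∷ u ∷ [] ∷ replicate n F ∷ []) ⟶[ 2 * n + 1 ] (just outer , (replicate n F ++ o) ∷ u ∷ w ∷ [] ∷ []))
            (++-identityʳ (replicate n F)) (runs-restore (replicate n F ++ o) u n [])) ◅◅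
        subst₂ (λ m y → (just outer , (replicate n F ++ o) ∷ u ∷ replicate n F ∷ [] ∷ []) ⟶[ length u * (5 * m + 3) + 1 ] (nothing , y ∷ [] ∷ v′ ∷ [] ∷ []))
          (length-replicate n) (rep r) r))
    where
    n = length v
    lem : ∀ n m → suc ((3 * n + 1) + ((2 * n + 1) + (m * (5 * n + 3) + 1))) ≡ suc m * (5 * n + 3) + 1
    lem = solve-∀
    rep : ∀ {A : Set} → A → replicate (length u * length (replicate n F)) F ++ replicate n F ++ o ≡ replicate (suc (length u) * n) F ++ o
    rep _ = begin
      replicate (length u * length (replicate n F)) F ++ replicate n F ++ o
        ≡⟨ cong (λ m → replicate (length u * m) F ++ replicate n F ++ o) (length-replicate n) ⟩
      replicate (length u * n) F ++ replicate n F ++ o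
        ≡⟨ sym (++-assoc (replicate (length u * n) F) (replicate n F) o) ⟩
      (replicate (length u * n) F ++ replicate n F) ++ o
        ≡⟨ cong (_++ o) (sym (replicate-+ (length u * n) n)) ⟩
      replicate (length u * n + n) F ++ o
        ≡⟨ cong (λ m → replicate m F ++ o) (+-comm (length u * n) n) ⟩
      replicate (n + length u * n) F ++ o ∎
      where open ≡-Reasoning

-- Numbers are represented by lengths; this product and concatenation together evaluate a polynomial
-- by Horner's rule.
multiply : Operation (λ u v → zeros (length u * length v))
multiply = record
  { k = 0 ; d = proj₁ pb
  ; frag = λ _ → multiplier
  ; runs = λ {K} _ u v →
      let m = length u
          n = length v
          v′ , r = runs-outer {K} (map bit u) (map bit v) []
      in _ , Bounded.⟶-weaken _ (≤-trans (bound m n) (proj₂ pb (m + n)))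
               (subst₂ (λ m n → Runs multiplier ([] ∷ map bit u ∷ map bit v ∷ [] ∷ []) (m * (5 * n + 3) + 1) ((replicate (m * n) (bit false) ++ []) ∷ [] ∷ v′ ∷ [] ∷ []))
                 (length-map bit u) (length-map bit v) r)
         , result (m * n) }
  where
  pb : PolyBounded (λ n → n * (5 * n + 3) + 1)
  pb = pb-+ (pb-* pb-id (pb-+ (pb-* (pb-const 5) pb-id) (pb-const 3))) (pb-const 1)
  bound : ∀ m n → m * (5 * n + 3) + 1 ≤ (m + n) * (5 * (m + n) + 3) + 1
  bound m n = +-monoˡ-≤ 1 (*-mono-≤ (m≤m+n m n) (+-monoˡ-≤ 3 (*-monoʳ-≤ 5 (m≤n+m n m))))
  rev-replicate : ∀ {K} n (v : List (Letter K)) → replicate n (bit false) ʳ++ v ≡ replicate n (bit false) ++ v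
  rev-replicate zero    v = refl
  rev-replicate (suc n) v = trans (rev-replicate n (bit false ∷ v)) (shift n v)
  result : ∀ {K} n → replicate n (bit {K} false) ++ [] ≡ reverse (map bit (zeros n))
  result n = trans (sym (rev-replicate n [])) (cong reverse (sym (map-replicate bit n false)))

-- Equality, the successor relation and the Boolean connectives are all decided by reading two words
-- in parallel; `nothing` tells the automaton which word has ended.
record DFA₂ : Set where
  field
    n      : ℕ
    start  : Fin n
    δ      : Fin n → Maybe Bool → Maybe Bool → Fin n
    accept : Fin n → Bool

  accepts : Fin n → Str → Str → Bool
  accepts q []      []      = accept q
  accepts q []      (b ∷ v) = accepts (δ q nothing (just b)) [] v
  accepts q (a ∷ u) []      = accepts (δ q (just a) nothing) u []
  accepts q (a ∷ u) (b ∷ v) = accepts (δ q (just a) (just b)) u v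

module _ (D : DFA₂) {K : ℕ} where
  open DFA₂ D

  data DFACtl : Set where
    read₁  : Fin n → DFACtl
    read₂  : Fin n → Maybe Bool → DFACtl
    answer : Bool → DFACtl

  finiteDFACtl : Finite DFACtl
  finiteDFACtl = finiteRetract {B = Fin n ⊎ ((Fin n × Maybe Bool) ⊎ Bool)}
    (λ { (read₁ q) → inj₁ q ; (read₂ q m) → inj₂ (inj₁ (q , m)) ; (answer b) → inj₂ (inj₂ b) })
    (λ { (inj₁ q) → read₁ q ; (inj₂ (inj₁ (q , m))) → read₂ q m ; (inj₂ (inj₂ b)) → answer b })
    (λ { (read₁ q) → refl ; (read₂ q m) → refl ; (answer b) → refl })
    (finite⊎ (finiteFin n) (finite⊎ (finite× (finiteFin n) (finiteMaybe finiteBool)) finiteBool))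

  onPair : Fin n → Maybe Bool → Maybe Bool → DFACtl
  onPair q nothing nothing = answer (accept q)
  onPair q m       m′      = read₁ (δ q m m′)

  checker : Frag 4 K
  checker = record { Q = DFACtl ; finite = finiteDFACtl ; start = read₁ start ; instr = instr }
    where
    instr : DFACtl → Instr 4 K (Maybe DFACtl)
    instr (read₁ q)   = pop s1 (λ m → just (read₂ q (m Maybe.>>= unbit)))
    instr (read₂ q m) = pop s2 (λ m′ → just (onPair q m (m′ Maybe.>>= unbit)))
    instr (answer b)  = push s0 (bit b) nothing

  open Bounded (stepSM checker)

  runs-pair : ∀ q u v → (just (read₁ q) , [] ∷ map bit u ∷ map bit v ∷ [] ∷ []) ⟶[ 2 ]
    (just (onPair q (head u) (head v)) , [] ∷ map bit (drop 1 u) ∷ map bit (drop 1 v) ∷ [] ∷ [])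
  runs-pair q u v = go (cong just (cong₂ _,_ (cong (λ m → just (read₂ q m)) (lem u)) (cong (λ y → [] ∷ y ∷ map bit v ∷ [] ∷ []) (lem′ u))))
    (go (cong just (cong₂ _,_ (cong (λ m → just (onPair q (head u) m)) (lem v)) (cong (λ y → [] ∷ map bit (drop 1 u) ∷ y ∷ [] ∷ []) (lem′ v)))) stop)
    where
    lem : ∀ u → (head (map (bit {K}) u) Maybe.>>= unbit) ≡ head u
    lem []      = refl
    lem (b ∷ u) = unbit-bit b
    lem′ : ∀ u → drop 1 (map (bit {K}) u) ≡ map bit (drop 1 u)
    lem′ []      = refl
    lem′ (b ∷ u) = refl

  runs-checker : ∀ q u v → Σ[ τ ∈ Stacks₄ K ]
    ((just (read₁ q) , [] ∷ map bit u ∷ map bit v ∷ [] ∷ []) ⟶[ 2 * (length u + length v) + 3 ] (nothing , τ)) ×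
    lookup τ zero ≡ bit (accepts q u v) ∷ []
  runs-checker q []      []      = _ , (runs-pair q [] [] ◅◅ go refl stop) , refl
  runs-checker q []      (b ∷ v) =
    let τ , r , e = runs-checker (δ q nothing (just b)) [] v
    in τ , ⟶-weaken (≤-reflexive (lem (length v))) (runs-pair q [] (b ∷ v) ◅◅ r) , e
    where
    lem : ∀ n → 2 + (2 * n + 3) ≡ 2 * suc n + 3
    lem = solve-∀
  runs-checker q (a ∷ u) []      =
    let τ , r , e = runs-checker (δ q (just a) nothing) u []
    in τ , ⟶-weaken (≤-reflexive (lem (length u))) (runs-pair q (a ∷ u) [] ◅◅ r) , e
    where
    lem : ∀ n → 2 + (2 * (n + 0) + 3) ≡ 2 * suc (n + 0) + 3
    lem = solve-∀
  runs-checker q (a ∷ u) (b ∷ v) =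
    let τ , r , e = runs-checker (δ q (just a) (just b)) u v
    in τ , ⟶-weaken (≤-trans (m≤m+n _ 2) (≤-reflexive (lem (length u) (length v)))) (runs-pair q (a ∷ u) (b ∷ v) ◅◅ r) , e
    where
    lem : ∀ m n → (2 + (2 * (m + n) + 3)) + 2 ≡ 2 * (suc m + suc n) + 3
    lem = solve-∀

lockstep : ∀ D → Operation (λ u v → DFA₂.accepts D (DFA₂.start D) u v ∷ [])
lockstep D = record
  { k = 0 ; d = proj₁ pb
  ; frag = λ _ → checker D
  ; runs = λ _ u v →
      let τ , r , e = runs-checker D (DFA₂.start D) u v
      in τ , Bounded.⟶-weaken _ (proj₂ pb (length u + length v)) r , e }
  where
  pb : PolyBounded (λ n → 2 * n + 3)
  pb = pb-+ (pb-* (pb-const 2) pb-id) (pb-const 3)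

-- Polynomial-time functions and predicates

pt-cong : ∀ {f g : Str → Str} → (∀ x → f x ≡ g x) → PolyTimeFun f → PolyTimeFun g
pt-cong f≗g (M , c , run) = M , c , λ x → trans (run x) (cong just (f≗g x))

pt-id : PolyTimeFun (λ x → x)
pt-id = M , 0 , λ x → trans (runFor-halted M (length x ^ 0 + 0) (initial M x) refl) (cong just (out≡ x))
  where
  M : TM
  M = record { Q = 0 ; k = 0 ; δ = λ _ _ → nothing }
  read≡ : ∀ x → readBits M (map (encBit M) x) ≡ x
  read≡ []          = refl
  read≡ (false ∷ x) = cong (false ∷_) (read≡ x)
  read≡ (true ∷ x)  = cong (true ∷_) (read≡ x)
  out≡ : ∀ x → output M (initial M x) ≡ x
  out≡ x = trans (cong (output M) (initial≡load M x)) (trans (output-load M zero [] (map (encBit M) x)) (read≡ x))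

pt-[] : PolyTimeFun (λ _ → [])
pt-[] = M , 1 , λ x → subst (λ t → runFor M t (initial M x) ≡ just []) (+-comm 1 (length x ^ 1)) (run x)
  where
  M : TM
  M = record { Q = 1 ; k = 0 ; δ = λ { zero _ → just (suc zero , zero , S) ; (suc _) _ → nothing } }
  run : ∀ x {t} → runFor M (suc t) (initial M x) ≡ just []
  run []      {zero}  = refl
  run []      {suc t} = refl
  run (b ∷ x) {zero}  = refl
  run (b ∷ x) {suc t} = refl

pt-∘ : ∀ {f g} → PolyTimeFun f → PolyTimeFun g → PolyTimeFun (λ x → f (g x))
pt-∘ F G = lift₂ (after F) G G

pt-FST : ∀ T {f} → PolyTimeFun f → PolyTimeFun (λ x → FST.run T (f x))
pt-FST T {f} F = pt-cong (λ x → ++-identityʳ (FST.run T (f x))) (lift₂ (appendFST T) F pt-[])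

pt-++ : ∀ {f g} → PolyTimeFun f → PolyTimeFun g → PolyTimeFun (λ x → f x ++ g x)
pt-++ {f} {g} F G = pt-cong (λ x → cong (_++ g x) (idFST-run (f x))) (lift₂ (appendFST idFST) F G)

doubleFST : FST
doubleFST = record { n = 1 ; start = zero ; δ = λ q b → b ⋯ b , q ; ω = λ _ → false ⋯ true }

doubleFST-run : ∀ x y → FST.run doubleFST x ++ y ≡ pair x y
doubleFST-run []      y = refl
doubleFST-run (b ∷ x) y = cong (λ z → b ∷ b ∷ z) (doubleFST-run x y)

pt-pair : ∀ {f g} → PolyTimeFun f → PolyTimeFun g → PolyTimeFun (λ x → pair (f x) (g x))
pt-pair {f} {g} F G = pt-cong (λ x → doubleFST-run (f x) (g x)) (lift₂ (appendFST doubleFST) F G)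

-- States: 0 between two code pairs, 1 and 2 after a first 0 or 1, 3 after the separator 01.
unpairFST : (first : Bool) → FST
unpairFST first = record { n = 4 ; start = zero ; δ = δ ; ω = λ _ → ε }
  where
  component : Bool → Bool → Out
  component true  b = [ b ]
  component false b = ε
  rest : Bool → Bool → Out
  rest true  b = ε
  rest false b = [ b ]
  δ : Fin 4 → Bool → Out × Fin 4
  δ zero                   false = ε , suc zero
  δ zero                   true  = ε , suc (suc zero)
  δ (suc zero)             false = component first false , zero
  δ (suc zero)             true  = ε , suc (suc (suc zero))
  δ (suc (suc zero))       true  = component first true , zero
  δ (suc (suc zero))       false = ε , suc (suc (suc zero))
  δ (suc (suc (suc zero))) b     = rest first b , suc (suc (suc zero))

opaque
  left right : Str → Str
  left  = FST.run (unpairFST true)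
  right = FST.run (unpairFST false)

opaque
  unfolding left right

  left-pair : ∀ x y → left (pair x y) ≡ x
  left-pair []          y = lem y
    where
    lem : ∀ y → FST.transduce (unpairFST true) (suc (suc (suc zero))) y ≡ []
    lem []      = refl
    lem (b ∷ y) = lem y
  left-pair (false ∷ x) y = cong (false ∷_) (left-pair x y)
  left-pair (true ∷ x)  y = cong (true ∷_) (left-pair x y)

  right-pair : ∀ x y → right (pair x y) ≡ y
  right-pair []          y = transduce-copy (unpairFST false) (suc (suc (suc zero))) refl (λ _ → refl) y
  right-pair (false ∷ x) y = right-pair x y
  right-pair (true ∷ x)  y = right-pair x y

pair-injective : ∀ {x y x′ y′} → pair x y ≡ pair x′ y′ → x ≡ x′ × y ≡ y′
pair-injective {x} {y} {x′} {y′} eq =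
  trans (sym (left-pair x y)) (trans (cong left eq) (left-pair x′ y′)) ,
  trans (sym (right-pair x y)) (trans (cong right eq) (right-pair x′ y′))

opaque
  unfolding left right

  pt-left : ∀ {f} → PolyTimeFun f → PolyTimeFun (λ x → left (f x))
  pt-left = pt-FST (unpairFST true)

  pt-right : ∀ {f} → PolyTimeFun f → PolyTimeFun (λ x → right (f x))
  pt-right = pt-FST (unpairFST false)

pt-∷ : ∀ b {f} → PolyTimeFun f → PolyTimeFun (λ x → b ∷ f x)
pt-∷ b {f} F = pt-cong (λ x → lem (f x)) (pt-FST T F)
  where
  T : FST
  T = record { n = 2 ; start = zero
             ; δ = λ { zero a → b ⋯ a , suc zero ; (suc zero) a → [ a ] , suc zero }
             ; ω = λ { zero → [ b ] ; (suc zero) → ε } }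
  lem : ∀ x → FST.run T x ≡ b ∷ x
  lem []      = refl
  lem (a ∷ x) = cong (λ z → b ∷ a ∷ z) (transduce-copy T (suc zero) refl (λ _ → refl) x)

pt-const : ∀ w → PolyTimeFun (λ _ → w)
pt-const []      = pt-[]
pt-const (b ∷ w) = pt-∷ b (pt-const w)

pt-tail : ∀ {f} → PolyTimeFun f → PolyTimeFun (λ x → drop 1 (f x))
pt-tail {f} F = pt-cong (λ x → lem (f x)) (pt-FST T F)
  where
  T : FST
  T = record { n = 2 ; start = zero
             ; δ = λ { zero a → ε , suc zero ; (suc zero) a → [ a ] , suc zero }
             ; ω = λ _ → ε }
  lem : ∀ x → FST.run T x ≡ drop 1 x
  lem []      = refl
  lem (a ∷ x) = transduce-copy T (suc zero) refl (λ _ → refl) x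

-- Decodes the padding 0^j 1 v of v.
unpad : Str → Str
unpad []          = []
unpad (false ∷ x) = unpad x
unpad (true ∷ x)  = x

pt-unpad : ∀ {f} → PolyTimeFun f → PolyTimeFun (λ x → unpad (f x))
pt-unpad {f} F = pt-cong (λ x → lem (f x)) (pt-FST T F)
  where
  T : FST
  T = record { n = 2 ; start = zero
             ; δ = λ { zero false → ε , zero ; zero true → ε , suc zero ; (suc zero) a → [ a ] , suc zero }
             ; ω = λ _ → ε }
  lem : ∀ x → FST.run T x ≡ unpad x
  lem []          = refl
  lem (false ∷ x) = lem x
  lem (true ∷ x)  = transduce-copy T (suc zero) refl (λ _ → refl) x

-- With `false` it turns a comparison of lengths into an equality of words; with `true` it supplies
-- the top words 1...1.
pt-fill : ∀ b {f} → PolyTimeFun f → PolyTimeFun (λ x → replicate (length (f x)) b)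
pt-fill b {f} F = pt-cong (λ x → lem (f x)) (pt-FST T F)
  where
  T : FST
  T = record { n = 1 ; start = zero ; δ = λ _ _ → [ b ] , zero ; ω = λ _ → ε }
  lem : ∀ x → FST.run T x ≡ replicate (length x) b
  lem []      = refl
  lem (a ∷ x) = cong (b ∷_) (lem x)

pt-poly : ∀ p → PolyTimeFun (λ x → zeros (eval p (length x)))
pt-poly []       = pt-[]
pt-poly (c ∷ cs) = pt-cong
  (λ x → trans (sym (replicate-+ c _)) (cong (λ n → zeros (c + length x * n)) (length-replicate (eval cs (length x)))))
  (pt-++ (pt-const (zeros c)) (lift₂ multiply pt-id (pt-poly cs)))

-- Polynomial-time decidable predicates

record PTDec (P : Str → Set) : Set where
  field
    test     : Str → Bool
    poly     : PolyTimeFun (λ x → test x ∷ [])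
    sound    : ∀ x → test x ≡ true → P x
    complete : ∀ x → P x → test x ≡ true

  decide : ∀ x → Dec (P x)
  decide x with test x in eq
  ... | true  = yes (sound x eq)
  ... | false = no λ px → case trans (sym eq) (complete x px) of λ ()

opaque
  ptdec-map : ∀ {P Q : Str → Set} → (∀ x → P x → Q x) → (∀ x → Q x → P x) → PTDec P → PTDec Q
  ptdec-map f g D = record { test = test ; poly = poly ; sound = λ x e → f x (sound x e) ; complete = λ x q → complete x (g x q) }
    where open PTDec D

eqDFA : DFA₂
eqDFA = record { n = 2 ; start = zero ; δ = δ ; accept = λ { zero → true ; (suc zero) → false } }
  where
  δ : Fin 2 → Maybe Bool → Maybe Bool → Fin 2
  δ zero (just false) (just false) = zero
  δ zero (just true)  (just true)  = zero
  δ _    _            _            = suc zero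

module _ where
  open DFA₂ eqDFA

  eqDFA-sink : ∀ u v → accepts (suc zero) u v ≡ false
  eqDFA-sink []      []      = refl
  eqDFA-sink []      (b ∷ v) = eqDFA-sink [] v
  eqDFA-sink (a ∷ u) []      = eqDFA-sink u []
  eqDFA-sink (a ∷ u) (b ∷ v) = eqDFA-sink u v

  eqDFA-sound : ∀ u v → accepts zero u v ≡ true → u ≡ v
  eqDFA-sound []          []          e = refl
  eqDFA-sound []          (b ∷ v)     e = case trans (sym (eqDFA-sink [] v)) e of λ ()
  eqDFA-sound (false ∷ u) []          e = case trans (sym (eqDFA-sink u [])) e of λ ()
  eqDFA-sound (true ∷ u)  []          e = case trans (sym (eqDFA-sink u [])) e of λ ()
  eqDFA-sound (false ∷ u) (false ∷ v) e = cong (false ∷_) (eqDFA-sound u v e)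
  eqDFA-sound (true ∷ u)  (true ∷ v)  e = cong (true ∷_) (eqDFA-sound u v e)
  eqDFA-sound (false ∷ u) (true ∷ v)  e = case trans (sym (eqDFA-sink u v)) e of λ ()
  eqDFA-sound (true ∷ u)  (false ∷ v) e = case trans (sym (eqDFA-sink u v)) e of λ ()

  eqDFA-complete : ∀ u → accepts zero u u ≡ true
  eqDFA-complete []          = refl
  eqDFA-complete (false ∷ u) = eqDFA-complete u
  eqDFA-complete (true ∷ u)  = eqDFA-complete u

opaque
  ptdec-≡ : ∀ {f g} → PolyTimeFun f → PolyTimeFun g → PTDec (λ x → f x ≡ g x)
  ptdec-≡ {f} {g} F G = record
    { test = λ x → DFA₂.accepts eqDFA zero (f x) (g x) ; poly = lift₂ (lockstep eqDFA) F G
    ; sound = λ x → eqDFA-sound (f x) (g x) ; complete = λ x e → subst (λ v → DFA₂.accepts eqDFA zero (f x) v ≡ true) e (eqDFA-complete (f x)) }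

connective : (Bool → Bool → Bool) → DFA₂
connective op = record { n = 2 ; start = zero ; δ = δ ; accept = λ { zero → false ; (suc zero) → true } }
  where
  state : Bool → Fin 2
  state false = zero
  state true  = suc zero
  δ : Fin 2 → Maybe Bool → Maybe Bool → Fin 2
  δ _ (just a) (just b) = state (op a b)
  δ q _        _        = q

connective-accepts : ∀ op a b → DFA₂.accepts (connective op) zero (a ∷ []) (b ∷ []) ≡ op a b
connective-accepts op a b with op a b
... | false = refl
... | true  = refl

pt-connective : ∀ op {s t : Str → Bool} → PolyTimeFun (λ x → s x ∷ []) → PolyTimeFun (λ x → t x ∷ []) → PolyTimeFun (λ x → op (s x) (t x) ∷ [])
pt-connective op {s} {t} F G = pt-cong (λ x → cong (_∷ []) (connective-accepts op (s x) (t x))) (lift₂ (lockstep (connective op)) F G)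

opaque
  ptdec-× : ∀ {P Q : Str → Set} → PTDec P → PTDec Q → PTDec (λ x → P x × Q x)
  ptdec-× {P} {Q} D E = record
    { test = λ x → D.test x ∧ E.test x ; poly = pt-connective _∧_ D.poly E.poly ; sound = snd ; complete = cpl }
    where
    module D = PTDec D
    module E = PTDec E
    snd : ∀ x → D.test x ∧ E.test x ≡ true → P x × Q x
    snd x e with D.test x in p | E.test x in q
    snd x e | true | true = D.sound x p , E.sound x q
    cpl : ∀ x → P x × Q x → D.test x ∧ E.test x ≡ true
    cpl x (p , q) rewrite D.complete x p | E.complete x q = refl

opaque
  ptdec-⊎ : ∀ {P Q : Str → Set} → PTDec P → PTDec Q → PTDec (λ x → P x ⊎ Q x)
  ptdec-⊎ {P} {Q} D E = record
    { test = λ x → D.test x ∨ E.test x ; poly = pt-connective _∨_ D.poly E.poly ; sound = snd ; complete = cpl }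
    where
    module D = PTDec D
    module E = PTDec E
    snd : ∀ x → D.test x ∨ E.test x ≡ true → P x ⊎ Q x
    snd x e with D.test x in p | E.test x in q
    snd x e | true  | _    = inj₁ (D.sound x p)
    snd x e | false | true = inj₂ (E.sound x q)
    cpl : ∀ x → P x ⊎ Q x → D.test x ∨ E.test x ≡ true
    cpl x (inj₁ p) rewrite D.complete x p = refl
    cpl x (inj₂ q) rewrite E.complete x q with D.test x
    ... | true  = refl
    ... | false = refl

opaque
  ptdec-¬ : ∀ {P : Str → Set} → PTDec P → PTDec (λ x → ¬ P x)
  ptdec-¬ {P} D = record
    { test = λ x → not (test x) ; poly = pt-connective (λ a _ → not a) poly poly
    ; sound = snd ; complete = cpl }
    where
    open PTDec D
    snd : ∀ x → not (test x) ≡ true → ¬ P x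
    snd x e p rewrite complete x p = case e of λ ()
    cpl : ∀ x → ¬ P x → not (test x) ≡ true
    cpl x ¬p with test x in e
    ... | true  = ⊥-elim (¬p (sound x e))
    ... | false = refl

opaque
  ptdec-∘ : ∀ {P : Str → Set} {f} → PTDec P → PolyTimeFun f → PTDec (λ x → P (f x))
  ptdec-∘ {f = f} D F = record
    { test = λ x → test (f x) ; poly = pt-∘ poly F ; sound = λ x → sound (f x) ; complete = λ x → complete (f x) }
    where open PTDec D

-- Binary words as numbers

ones : ℕ → Str
ones n = replicate n true

digit : Bool → ℕ
digit false = 0
digit true  = 1

val : Str → ℕ
val []      = 0
val (b ∷ w) = digit b * 2 ^ length w + val w

-- The value of 1w in binary: the rank of w in the order by length, then lexicographic.
num : Str → ℕ
num w = 2 ^ length w + val w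

double : ∀ n → n + n ≡ 2 * n
double n = cong (n +_) (sym (+-identityʳ n))

val< : ∀ w → val w < 2 ^ length w
val< []          = s≤s z≤n
val< (false ∷ w) = ≤-trans (val< w) (m≤m+n _ _)
val< (true ∷ w)  = subst (λ m → m + val w < 2 ^ suc (length w)) (sym (+-identityʳ (2 ^ length w)))
  (subst (2 ^ length w + val w <_) (double (2 ^ length w)) (+-monoʳ-< (2 ^ length w) (val< w)))

num< : ∀ w → num w < 2 ^ suc (length w)
num< w = subst (num w <_) (double (2 ^ length w)) (+-monoʳ-< (2 ^ length w) (val< w))

num-shorter : ∀ u v → length u < length v → num u < num v
num-shorter u v l = ≤-trans (num< u) (≤-trans (^-monoʳ-≤ 2 l) (m≤m+n _ _))

val-injective : ∀ u v → length u ≡ length v → val u ≡ val v → u ≡ v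
val-injective []          []          l e = refl
val-injective (false ∷ u) (false ∷ v) l e = cong (false ∷_) (val-injective u v (suc-injective l) e)
val-injective (true ∷ u)  (true ∷ v)  l e = cong (true ∷_) (val-injective u v (suc-injective l)
  (+-cancelˡ-≡ (1 * 2 ^ length u) _ _ (trans e (cong (λ n → 1 * 2 ^ n + val v) (sym (suc-injective l))))))
val-injective (false ∷ u) (true ∷ v)  l e = ⊥-elim (<⇒≢ (<-≤-trans (val< u) (≤-trans (≤-reflexive (cong (2 ^_) (suc-injective l))) (≤-trans (m≤m+n _ 0) (m≤m+n _ (val v))))) e)
val-injective (true ∷ u)  (false ∷ v) l e = ⊥-elim (<⇒≢ (<-≤-trans (val< v) (≤-trans (≤-reflexive (cong (2 ^_) (sym (suc-injective l)))) (≤-trans (m≤m+n _ 0) (m≤m+n _ (val u))))) (sym e))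

num-injective : ∀ u v → num u ≡ num v → u ≡ v
num-injective u v e with <-cmp (length u) (length v)
... | tri< l _ _ = ⊥-elim (<⇒≢ (num-shorter u v l) e)
... | tri> _ _ l = ⊥-elim (<⇒≢ (num-shorter v u l) (sym e))
... | tri≈ _ l _ = val-injective u v l (+-cancelˡ-≡ (2 ^ length u) _ _ (trans e (cong (λ n → 2 ^ n + val v) (sym l))))

val-zeros : ∀ n → val (zeros n) ≡ 0
val-zeros zero    = refl
val-zeros (suc n) = val-zeros n

val-ones : ∀ n → suc (val (ones n)) ≡ 2 ^ n
val-ones zero    = refl
val-ones (suc n) = begin
  suc (1 * 2 ^ length (ones n) + val (ones n)) ≡⟨ cong (λ m → suc (1 * 2 ^ m + val (ones n))) (length-replicate n) ⟩
  suc (1 * 2 ^ n + val (ones n))               ≡⟨ sym (+-suc (1 * 2 ^ n) (val (ones n))) ⟩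
  1 * 2 ^ n + suc (val (ones n))               ≡⟨ cong₂ _+_ (*-identityˡ (2 ^ n)) (val-ones n) ⟩
  2 ^ n + 2 ^ n                                ≡⟨ double (2 ^ n) ⟩
  2 ^ suc n                                    ∎
  where open ≡-Reasoning

val-++ : ∀ u v → val (u ++ v) ≡ val u * 2 ^ length v + val v
val-++ []      v = refl
val-++ (b ∷ u) v = begin
  digit b * 2 ^ length (u ++ v) + val (u ++ v)
    ≡⟨ cong₂ (λ m n → digit b * m + n) (trans (cong (2 ^_) (length-++ u)) (^-distribˡ-+-* 2 (length u) (length v))) (val-++ u v) ⟩
  digit b * (2 ^ length u * 2 ^ length v) + (val u * 2 ^ length v + val v)
    ≡⟨ lem (digit b) (2 ^ length u) (2 ^ length v) (val u) (val v) ⟩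
  (digit b * 2 ^ length u + val u) * 2 ^ length v + val v ∎
  where
  open ≡-Reasoning
  lem : ∀ d p q a b → d * (p * q) + (a * q + b) ≡ (d * p + a) * q + b
  lem = solve-∀

-- States: 0 initial, 1 equal so far, 2 inside 01…1 / 10…0, 3 only 1s against 0s so far, 4 the same with the second word one letter longer, 5 sink.
pattern q0 = zero
pattern q1 = suc zero
pattern q2 = suc (suc zero)
pattern q3 = suc (suc (suc zero))
pattern q4 = suc (suc (suc (suc zero)))
pattern q5 = suc (suc (suc (suc (suc zero))))

succDFA : DFA₂
succDFA = record { n = 6 ; start = q0 ; δ = δ ; accept = accept }
  where
  δ : Fin 6 → Maybe Bool → Maybe Bool → Fin 6
  δ q0 (just false) (just false) = q1
  δ q0 (just true)  (just true)  = q1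
  δ q0 (just false) (just true)  = q2
  δ q0 (just true)  (just false) = q3
  δ q0 nothing      (just false) = q4
  δ q1 (just false) (just false) = q1
  δ q1 (just true)  (just true)  = q1
  δ q1 (just false) (just true)  = q2
  δ q2 (just true)  (just false) = q2
  δ q3 (just true)  (just false) = q3
  δ q3 nothing      (just false) = q4
  δ _  _            _            = q5
  accept : Fin 6 → Bool
  accept q2 = true
  accept q4 = true
  accept _  = false

module _ where
  open DFA₂ succDFA using (accepts)

  succDFA-sink : ∀ u v → accepts q5 u v ≢ true
  succDFA-sink []      (b ∷ v) = succDFA-sink [] v
  succDFA-sink (a ∷ u) []      = succDFA-sink u []
  succDFA-sink (a ∷ u) (b ∷ v) = succDFA-sink u v

  succDFA-sound₂ : ∀ u v → accepts q2 u v ≡ true → Σ[ n ∈ ℕ ] u ≡ ones n × v ≡ zeros n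
  succDFA-sound₂ []          []          e = 0 , refl , refl
  succDFA-sound₂ []          (b ∷ v)     e = ⊥-elim (succDFA-sink [] v e)
  succDFA-sound₂ (false ∷ u) []          e = ⊥-elim (succDFA-sink u [] e)
  succDFA-sound₂ (true ∷ u)  []          e = ⊥-elim (succDFA-sink u [] e)
  succDFA-sound₂ (false ∷ u) (b ∷ v)     e = ⊥-elim (succDFA-sink u v e)
  succDFA-sound₂ (true ∷ u)  (true ∷ v)  e = ⊥-elim (succDFA-sink u v e)
  succDFA-sound₂ (true ∷ u)  (false ∷ v) e with succDFA-sound₂ u v e
  ... | n , refl , refl = suc n , refl , refl

  succDFA-sound₄ : ∀ u v → accepts q4 u v ≡ true → u ≡ [] × v ≡ []
  succDFA-sound₄ []      []      e = refl , refl
  succDFA-sound₄ []      (b ∷ v) e = ⊥-elim (succDFA-sink [] v e)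
  succDFA-sound₄ (a ∷ u) []      e = ⊥-elim (succDFA-sink u [] e)
  succDFA-sound₄ (a ∷ u) (b ∷ v) e = ⊥-elim (succDFA-sink u v e)

  succDFA-sound₃ : ∀ u v → accepts q3 u v ≡ true → Σ[ n ∈ ℕ ] u ≡ ones n × v ≡ zeros (suc n)
  succDFA-sound₃ []          (false ∷ v) e with succDFA-sound₄ [] v e
  ... | refl , refl = 0 , refl , refl
  succDFA-sound₃ []          (true ∷ v)  e = ⊥-elim (succDFA-sink [] v e)
  succDFA-sound₃ (false ∷ u) []          e = ⊥-elim (succDFA-sink u [] e)
  succDFA-sound₃ (true ∷ u)  []          e = ⊥-elim (succDFA-sink u [] e)
  succDFA-sound₃ (false ∷ u) (b ∷ v)     e = ⊥-elim (succDFA-sink u v e)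
  succDFA-sound₃ (true ∷ u)  (true ∷ v)  e = ⊥-elim (succDFA-sink u v e)
  succDFA-sound₃ (true ∷ u)  (false ∷ v) e with succDFA-sound₃ u v e
  ... | n , refl , refl = suc n , refl , refl

  carry : ∀ n → val (true ∷ zeros n) ≡ suc (val (false ∷ ones n))
  carry n = begin
    1 * 2 ^ length (zeros n) + val (zeros n) ≡⟨ cong₂ (λ m k → 1 * 2 ^ m + k) (length-replicate n) (val-zeros n) ⟩
    1 * 2 ^ n + 0                            ≡⟨ trans (+-identityʳ _) (*-identityˡ (2 ^ n)) ⟩
    2 ^ n                                    ≡⟨ sym (val-ones n) ⟩
    suc (val (ones n))                       ∎
    where open ≡-Reasoning

  prepend : ∀ b u v → length v ≡ length u → val v ≡ suc (val u) → val (b ∷ v) ≡ suc (val (b ∷ u))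
  prepend b u v l e = trans (cong₂ (λ m n → digit b * 2 ^ m + n) l e) (+-suc (digit b * 2 ^ length u) (val u))

  same-length : ∀ n → length (true ∷ zeros n) ≡ length (false ∷ ones n)
  same-length n = cong suc (trans (length-replicate n) (sym (length-replicate n)))

  succDFA-sound₁ : ∀ u v → accepts q1 u v ≡ true → length v ≡ length u × val v ≡ suc (val u)
  succDFA-sound₁ []          (b ∷ v)     e = ⊥-elim (succDFA-sink [] v e)
  succDFA-sound₁ (false ∷ u) []          e = ⊥-elim (succDFA-sink u [] e)
  succDFA-sound₁ (true ∷ u)  []          e = ⊥-elim (succDFA-sink u [] e)
  succDFA-sound₁ (true ∷ u)  (false ∷ v) e = ⊥-elim (succDFA-sink u v e)
  succDFA-sound₁ (false ∷ u) (false ∷ v) e = let l , p = succDFA-sound₁ u v e in cong suc l , p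
  succDFA-sound₁ (true ∷ u)  (true ∷ v)  e = let l , p = succDFA-sound₁ u v e in cong suc l , prepend true u v l p
  succDFA-sound₁ (false ∷ u) (true ∷ v)  e with succDFA-sound₂ u v e
  ... | n , refl , refl = same-length n , carry n

  overflow : ∀ n → num (zeros (suc n)) ≡ suc (num (ones n))
  overflow n = begin
    2 ^ suc (length (zeros n)) + val (zeros n) ≡⟨ cong₂ (λ m k → 2 ^ suc m + k) (length-replicate n) (val-zeros n) ⟩
    2 ^ suc n + 0                              ≡⟨ trans (+-identityʳ _) (sym (double (2 ^ n))) ⟩
    2 ^ n + 2 ^ n                              ≡⟨ cong₂ (λ m k → 2 ^ m + k) (sym (length-replicate n)) (sym (val-ones n)) ⟩
    2 ^ length (ones n) + suc (val (ones n))   ≡⟨ +-suc _ _ ⟩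
    suc (num (ones n))                         ∎
    where open ≡-Reasoning

  within : ∀ u v → length v ≡ length u × val v ≡ suc (val u) → num v ≡ suc (num u)
  within u v (l , e) = trans (cong₂ (λ m n → 2 ^ m + n) l e) (+-suc _ _)

  succDFA-sound : ∀ u v → accepts q0 u v ≡ true → num v ≡ suc (num u)
  succDFA-sound []          (false ∷ v) e with succDFA-sound₄ [] v e
  ... | refl , refl = refl
  succDFA-sound []          (true ∷ v)  e = ⊥-elim (succDFA-sink [] v e)
  succDFA-sound (false ∷ u) []          e = ⊥-elim (succDFA-sink u [] e)
  succDFA-sound (true ∷ u)  []          e = ⊥-elim (succDFA-sink u [] e)
  succDFA-sound (false ∷ u) (false ∷ v) e = let l , p = succDFA-sound₁ u v e in within (false ∷ u) (false ∷ v) (cong suc l , p)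
  succDFA-sound (true ∷ u)  (true ∷ v)  e = let l , p = succDFA-sound₁ u v e in within (true ∷ u) (true ∷ v) (cong suc l , prepend true u v l p)
  succDFA-sound (false ∷ u) (true ∷ v)  e with succDFA-sound₂ u v e
  ... | n , refl , refl = within (false ∷ ones n) (true ∷ zeros n) (same-length n , carry n)
  succDFA-sound (true ∷ u)  (false ∷ v) e with succDFA-sound₃ u v e
  ... | n , refl , refl = overflow (suc n)

  accepts-carry : ∀ n → accepts q2 (ones n) (zeros n) ≡ true
  accepts-carry zero    = refl
  accepts-carry (suc n) = accepts-carry n

  accepts-overflow : ∀ n → accepts q0 (ones n) (zeros (suc n)) ≡ true
  accepts-overflow zero    = refl
  accepts-overflow (suc n) = go n
    where
    go : ∀ n → accepts q3 (ones n) (zeros (suc n)) ≡ true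
    go zero    = refl
    go (suc n) = go n

  -- The recursion carries from the right end; a word of 1s only is the case in which the carry
  -- leaves the word. The accepting run is built alongside for the completeness of the automaton.
  increment : ∀ u → u ≡ ones (length u) ⊎ Σ[ v ∈ Str ] length v ≡ length u × val v ≡ suc (val u) × accepts q1 u v ≡ true
  increment []      = inj₁ refl
  increment (b ∷ u) with increment u
  increment (false ∷ u) | inj₂ (v , l , e , a) = inj₂ (false ∷ v , cong suc l , e , a)
  increment (true ∷ u)  | inj₂ (v , l , e , a) = inj₂ (true ∷ v , cong suc l , prepend true u v l e , a)
  increment (true ∷ u)  | inj₁ u≡ = inj₁ (cong (true ∷_) u≡)
  increment (false ∷ u) | inj₁ u≡ = inj₂ (true ∷ zeros n , cong suc (length-replicate n)
    , trans (carry n) (cong (λ u → suc (val (false ∷ u))) (sym u≡)) , subst (λ u → accepts q2 u (zeros n) ≡ true) (sym u≡) (accepts-carry n))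
    where n = length u

  -- State 0 has all the transitions of state 1; it adds only those that lead to a change of length.
  first-letter : ∀ u v → accepts q1 u v ≡ true → accepts q0 u v ≡ true
  first-letter []          (b ∷ v)     e = ⊥-elim (succDFA-sink [] v e)
  first-letter (false ∷ u) []          e = ⊥-elim (succDFA-sink u [] e)
  first-letter (true ∷ u)  []          e = ⊥-elim (succDFA-sink u [] e)
  first-letter (false ∷ u) (false ∷ v) e = e
  first-letter (false ∷ u) (true ∷ v)  e = e
  first-letter (true ∷ u)  (false ∷ v) e = ⊥-elim (succDFA-sink u v e)
  first-letter (true ∷ u)  (true ∷ v)  e = e

  next-accepted : ∀ u → Σ[ v ∈ Str ] num v ≡ suc (num u) × accepts q0 u v ≡ true
  next-accepted u with increment u
  ... | inj₁ u≡ = zeros (suc n) , trans (overflow n) (cong (λ u → suc (num u)) (sym u≡)) , subst (λ u → accepts q0 u (zeros (suc n)) ≡ true) (sym u≡) (accepts-overflow n)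
    where n = length u
  ... | inj₂ (v , l , e , a) = v , within u v (l , e) , first-letter u v a

  -- Completeness comes from existence: every u has some accepted successor, its rank is determined
  -- by soundness of the construction, and `num` is injective, so v is that word.
  succDFA-complete : ∀ u v → num v ≡ suc (num u) → accepts q0 u v ≡ true
  succDFA-complete u v e with next-accepted u
  ... | w , n , a rewrite num-injective v w (trans e (sym n)) = a

next : Str → Str
next u = proj₁ (next-accepted u)

num-next : ∀ u → num (next u) ≡ suc (num u)
num-next u = proj₁ (proj₂ (next-accepted u))

val-surjective : ∀ n m → m < 2 ^ n → Σ[ w ∈ Str ] length w ≡ n × val w ≡ m
val-surjective n zero    _ = zeros n , length-replicate n , val-zeros n
val-surjective n (suc m) lt with val-surjective n m (<-trans (n<1+n m) lt)
... | w , l , e with increment w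
... | inj₂ (v , l′ , e′ , _) = v , trans l′ l , trans e′ (cong suc e)
... | inj₁ w≡ = ⊥-elim (<⇒≢ lt (trans (cong suc (trans (sym e) (cong val w≡))) (trans (val-ones (length w)) (cong (2 ^_) l))))

opaque
  ptdec-next : ∀ {f g} → PolyTimeFun f → PolyTimeFun g → PTDec (λ x → num (g x) ≡ suc (num (f x)))
  ptdec-next {f} {g} F G = record
    { test = λ x → DFA₂.accepts succDFA q0 (f x) (g x) ; poly = lift₂ (lockstep succDFA) F G
    ; sound = λ x → succDFA-sound (f x) (g x) ; complete = λ x → succDFA-complete (f x) (g x) }

-- Counting and ranking words

lookup-unique : ∀ {A : Set} {xs : List A} → Unique xs → ∀ i j → Data.List.lookup xs i ≡ Data.List.lookup xs j → i ≡ j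
lookup-unique (_ ∷ _)  zero    zero    e = refl
lookup-unique (x∉ ∷ _) zero    (suc j) e = ⊥-elim (All.lookup x∉ (∈-lookup j) e)
lookup-unique (x∉ ∷ _) (suc i) zero    e = ⊥-elim (All.lookup x∉ (∈-lookup i) (sym e))
lookup-unique (_ ∷ u)  (suc i) (suc j) e = cong suc (lookup-unique u i j e)

-- The map may depend on membership, because paths are translated only with a proof of their
-- acceptance at hand.
length-≤ : ∀ {A B : Set} {xs : List A} {ys : List B} → Unique xs → (f : ∀ {a} → a ∈ xs → B) →
  (∀ {a} (m : a ∈ xs) → f m ∈ ys) → (∀ {a a′} (m : a ∈ xs) (m′ : a′ ∈ xs) → f m ≡ f m′ → a ≡ a′) → length xs ≤ length ys
length-≤ {xs = xs} {ys} u f f∈ f-inj = injective⇒≤ {f = λ i → Any.index (f∈ (∈-lookup {xs = xs} i))} λ {i} {j} e →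
  lookup-unique u i j (f-inj (∈-lookup i) (∈-lookup j)
    (trans (lookup-index (f∈ (∈-lookup i))) (trans (cong (Data.List.lookup ys) e) (sym (lookup-index (f∈ (∈-lookup j)))))))

unique-⊆ : ∀ {A : Set} {xs ys : List A} → Unique xs → (∀ {a} → a ∈ xs → a ∈ ys) → length xs ≤ length ys
unique-⊆ u s = length-≤ u (λ {a} _ → a) s (λ _ _ e → e)

allVecs-∈ : ∀ {n} (v : Vec Bool n) → v ∈ allVecs n
allVecs-∈ []          = Any.here refl
allVecs-∈ (false ∷ v) = ∈-++⁺ˡ (∈-map⁺ (false ∷_) (allVecs-∈ v))
allVecs-∈ (true ∷ v)  = ∈-++⁺ʳ (map (false ∷_) (allVecs _)) (∈-map⁺ (true ∷_) (allVecs-∈ v))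

allVecs-unique : ∀ n → Unique (allVecs n)
allVecs-unique zero    = [] ∷ []
allVecs-unique (suc n) = ++-unique (map-unique (λ { refl → refl }) (allVecs-unique n)) (map-unique (λ { refl → refl }) (allVecs-unique n)) disjoint
  where
  disjoint : ∀ {v} → ¬ (v ∈ map (false ∷_) (allVecs n) × v ∈ map (true ∷_) (allVecs n))
  disjoint (p , q) with ∈-map⁻ (false ∷_) p | ∈-map⁻ (true ∷_) q
  ... | _ , _ , refl | _ , _ , ()

length-allVecs : ∀ n → length (allVecs n) ≡ 2 ^ n
length-allVecs zero    = refl
length-allVecs (suc n) = begin
  length (map (false ∷_) (allVecs n) ++ map (true ∷_) (allVecs n)) ≡⟨ length-++ (map (false ∷_) (allVecs n)) ⟩
  length (map (false Vec.∷_) (allVecs n)) + length (map (true Vec.∷_) (allVecs n))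
    ≡⟨ cong₂ _+_ (trans (length-map _ (allVecs n)) (length-allVecs n)) (trans (length-map _ (allVecs n)) (length-allVecs n)) ⟩
  2 ^ n + 2 ^ n ≡⟨ double (2 ^ n) ⟩
  2 ^ suc n ∎
  where open ≡-Reasoning

countVecs : ∀ {n} {P : Vec Bool n → Set} → Decidable P → ℕ
countVecs {n} P? = length (filter P? (allVecs n))

-- Applied in both directions, this equates the numbers of accepting paths of two machines.
countVecs-≤ : ∀ {m n} {P : Vec Bool m → Set} {Q : Vec Bool n → Set} (P? : Decidable P) (Q? : Decidable Q)
  (f : ∀ {v} → P v → Vec Bool n) → (∀ {v} (p : P v) → Q (f p)) →
  (∀ {v w} (p : P v) (q : P w) → f p ≡ f q → v ≡ w) → countVecs P? ≤ countVecs Q?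
countVecs-≤ {m} P? Q? f f-Q f-inj = length-≤ (filter-unique P? (allVecs-unique m))
  (λ i → f (proj₂ (∈-filter⁻ P? {xs = allVecs m} i)))
  (λ i → ∈-filter⁺ Q? (allVecs-∈ _) (f-Q _))
  (λ i j e → f-inj _ _ e)

countVecs-≡0 : ∀ {n} {P : Vec Bool n → Set} (P? : Decidable P) → countVecs P? ≡ 0 → ∀ v → ¬ P v
countVecs-≡0 {n} P? e v p with filter P? (allVecs n) | ∈-filter⁺ P? (allVecs-∈ v) p
countVecs-≡0 P? () v p | _ ∷ _ | _

countVecs-≢0 : ∀ {n} {P : Vec Bool n → Set} (P? : Decidable P) → countVecs P? ≢ 0 → ∃ P
countVecs-≢0 {n} P? ne with filter P? (allVecs n) in eq
... | []    = ⊥-elim (ne refl)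
... | v ∷ _ = v , proj₂ (∈-filter⁻ P? {xs = allVecs n} (subst (v ∈_) (sym eq) (Any.here refl)))

vec : ∀ {n} (w : Str) → length w ≡ n → Vec Bool n
vec w refl = fromList w

toList-vec : ∀ {n} (w : Str) (e : length w ≡ n) → toList (vec w e) ≡ w
toList-vec w refl = toList∘fromList w

toList-inj : ∀ {n} {v w : Vec Bool n} → toList v ≡ toList w → v ≡ w
toList-inj {v = []}    {[]}    e = refl
toList-inj {v = a ∷ v} {b ∷ w} e = cong₂ _∷_ (proj₁ (∷-injective e)) (toList-inj (proj₂ (∷-injective e)))

toList-replicate : ∀ n (b : Bool) → toList (Vec.replicate n b) ≡ replicate n b
toList-replicate zero    b = refl
toList-replicate (suc n) b = cong (b ∷_) (toList-replicate n b)

value : ∀ {n} → Vec Bool n → ℕ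
value v = val (toList v)

value< : ∀ {n} (v : Vec Bool n) → value v < 2 ^ n
value< v = subst (λ m → value v < 2 ^ m) (length-toList v) (val< (toList v))

value-injective : ∀ {n} {v w : Vec Bool n} → value v ≡ value w → v ≡ w
value-injective {v = v} {w} e = toList-inj (val-injective (toList v) (toList w) (trans (length-toList v) (sym (length-toList w))) e)

value-surjective : ∀ {n} m → m < 2 ^ n → Σ[ v ∈ Vec Bool n ] value v ≡ m
value-surjective {n} m lt with val-surjective n m lt
... | w , l , e = vec w l , trans (cong val (toList-vec w l)) e

<lex⇒value< : ∀ {n} {v w : Vec Bool n} → v <lex w → value v < value w
<lex⇒value< (here {n} {v} {w}) = <-≤-trans (value< v) (≤-trans (≤-reflexive (sym (trans (*-identityˡ _) (cong (2 ^_) (length-toList w))))) (m≤m+n _ (value w)))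
<lex⇒value< (there {n} {a} {v} {w} l) = subst (λ k → digit a * 2 ^ k + value v < digit a * 2 ^ length (toList w) + value w)
  (trans (length-toList w) (sym (length-toList v))) (+-monoʳ-< (digit a * 2 ^ length (toList w)) (<lex⇒value< l))

lex-compare : ∀ {n} (v w : Vec Bool n) → v <lex w ⊎ v ≡ w ⊎ w <lex v
lex-compare []          []          = inj₂ (inj₁ refl)
lex-compare (false ∷ v) (true ∷ w)  = inj₁ here
lex-compare (true ∷ v)  (false ∷ w) = inj₂ (inj₂ here)
lex-compare (false ∷ v) (false ∷ w) = Sum.map there (Sum.map (cong (false ∷_)) there) (lex-compare v w)
lex-compare (true ∷ v)  (true ∷ w)  = Sum.map there (Sum.map (cong (true ∷_)) there) (lex-compare v w)

value<⇒<lex : ∀ {n} {v w : Vec Bool n} → value v < value w → v <lex w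
value<⇒<lex {v = v} {w} l with lex-compare v w
... | inj₁ v<w        = v<w
... | inj₂ (inj₁ v≡w) = ⊥-elim (<⇒≢ l (cong value v≡w))
... | inj₂ (inj₂ w<v) = ⊥-elim (<⇒≯ l (<lex⇒value< w<v))

≤lex⇒value≤ : ∀ {n} {v w : Vec Bool n} → v ≤lex w → value v ≤ value w
≤lex⇒value≤ (inj₁ l)    = <⇒≤ (<lex⇒value< l)
≤lex⇒value≤ (inj₂ refl) = ≤-refl

value≤⇒≤lex : ∀ {n} {v w : Vec Bool n} → value v ≤ value w → v ≤lex w
value≤⇒≤lex l with m≤n⇒m<n∨m≡n l
... | inj₁ l′ = inj₁ (value<⇒<lex l′)
... | inj₂ e  = inj₂ (value-injective e)

-- The values of words of one length leave no gap, so any difference above 1 would expose a word in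
-- between.
≺lex⇒value : ∀ {n} {v w : Vec Bool n} → v ≺lex w → value w ≡ suc (value v)
≺lex⇒value {n} {v} {w} (l , none) with m≤n⇒m<n∨m≡n (<lex⇒value< l)
... | inj₂ e  = sym e
... | inj₁ l′ with value-surjective (suc (value v)) (<-trans l′ (value< w))
... | c , e = ⊥-elim (none (c , value<⇒<lex (≤-reflexive (sym e)) , value<⇒<lex (subst (_< value w) (sym e) l′)))

value⇒≺lex : ∀ {n} {v w : Vec Bool n} → value w ≡ suc (value v) → v ≺lex w
value⇒≺lex {v = v} {w} e = value<⇒<lex (≤-reflexive (sym e)) ,
  λ (c , p , q) → <⇒≱ (<lex⇒value< q) (subst (_≤ value c) (sym e) (<lex⇒value< p))

-- A strict total order on {0,1}^n is isomorphic to the lexicographic one: send v to the word whose value is the rank of v.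
module Rank {n : ℕ} (_<ₒ_ : Vec Bool n → Vec Bool n → Set)
  (irreflₒ : ∀ {v} → ¬ (v <ₒ v)) (transₒ : ∀ {u v w} → u <ₒ v → v <ₒ w → u <ₒ w)
  (compareₒ : ∀ v w → v <ₒ w ⊎ v ≡ w ⊎ w <ₒ v) where

  _<ₒ?_ : ∀ v w → Dec (v <ₒ w)
  v <ₒ? w with compareₒ v w
  ... | inj₁ v<w         = yes v<w
  ... | inj₂ (inj₁ refl) = no irreflₒ
  ... | inj₂ (inj₂ w<v)  = no λ v<w → irreflₒ (transₒ v<w w<v)

  below : Vec Bool n → List (Vec Bool n)
  below v = filter (_<ₒ? v) (allVecs n)

  rank : Vec Bool n → ℕ
  rank v = length (below v)

  -- Counting v itself along with the words below it is what makes the inequalities `rank-mono` and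
  -- `rank<` strict.
  below-unique : ∀ v → Unique (v ∷ below v)
  below-unique v = All.tabulate (λ i e → irreflₒ (subst (_<ₒ v) (sym e) (proj₂ (∈-filter⁻ (_<ₒ? v) {xs = allVecs n} i))))
    ∷ filter-unique (_<ₒ? v) (allVecs-unique n)

  rank-mono : ∀ {v w} → v <ₒ w → rank v < rank w
  rank-mono {v} {w} l = unique-⊆ (below-unique v) λ
    { (Any.here refl) → ∈-filter⁺ (_<ₒ? w) (allVecs-∈ _) l
    ; (Any.there i)   → ∈-filter⁺ (_<ₒ? w) (allVecs-∈ _) (transₒ (proj₂ (∈-filter⁻ (_<ₒ? v) {xs = allVecs n} i)) l) }

  rank< : ∀ v → rank v < 2 ^ n
  rank< v = subst (rank v <_) (length-allVecs n) (unique-⊆ (below-unique v) (λ {a} _ → allVecs-∈ a))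

  h : Vec Bool n → Vec Bool n
  h v = proj₁ (value-surjective (rank v) (rank< v))

  value-h : ∀ v → value (h v) ≡ rank v
  value-h v = proj₂ (value-surjective (rank v) (rank< v))

  h-mono : ∀ {v w} → v <ₒ w → value (h v) < value (h w)
  h-mono {v} {w} l = subst₂ _<_ (sym (value-h v)) (sym (value-h w)) (rank-mono l)

  h-injective : ∀ {v w} → h v ≡ h w → v ≡ w
  h-injective {v} {w} e with compareₒ v w
  ... | inj₁ l        = ⊥-elim (<⇒≢ (h-mono l) (cong value e))
  ... | inj₂ (inj₁ p) = p
  ... | inj₂ (inj₂ l) = ⊥-elim (<⇒≢ (h-mono l) (cong value (sym e)))

  h-reflects : ∀ {v w} → value (h v) < value (h w) → v <ₒ w
  h-reflects {v} {w} l with compareₒ v w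
  ... | inj₁ p           = p
  ... | inj₂ (inj₁ refl) = ⊥-elim (<-irrefl refl l)
  ... | inj₂ (inj₂ p)    = ⊥-elim (<⇒≯ l (h-mono p))

  h-surjective : ∀ w → Σ[ v ∈ Vec Bool n ] h v ≡ w
  h-surjective w with Any.any? (λ v → ≡-decVec _≟B_ (h v) w) (allVecs n)
  ... | yes p = Any.satisfied p
  -- Pigeonhole: a missed w together with the image of `h` would be one word more than there are.
  ... | no ¬p = ⊥-elim (<-irrefl (length-map h (allVecs n)) (unique-⊆ (fresh ∷ map-unique h-injective (allVecs-unique n)) (λ {a} _ → allVecs-∈ a)))
    where
    fresh : All (w ≢_) (map h (allVecs n))
    fresh = All.tabulate λ i e → let v , _ , e′ = ∈-map⁻ h i in ¬p (Any.map (λ { refl → trans (sym e′) (sym e) }) (allVecs-∈ v))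

  bijection : Vec Bool n ⤖ Vec Bool n
  bijection = mk⤖ {to = h} (h-injective , λ w → let v , e = h-surjective w in v , λ { refl → e })

  _≺ₒ_ : Vec Bool n → Vec Bool n → Set
  v ≺ₒ w = v <ₒ w × (∀ u → v <ₒ u → ¬ (u <ₒ w))

  ≺ₒ⇒≺lex : ∀ {v w} → v ≺ₒ w → h v ≺lex h w
  ≺ₒ⇒≺lex {v} {w} (l , none) = value<⇒<lex (h-mono l) , λ (c , p , q) →
    let u , e = h-surjective c
    in none u (h-reflects (<lex⇒value< (subst (h v <lex_) (sym e) p))) (h-reflects (<lex⇒value< (subst (_<lex h w) (sym e) q)))

  ≺lex⇒≺ₒ : ∀ {v w} → h v ≺lex h w → v ≺ₒ w
  ≺lex⇒≺ₒ (l , none) = h-reflects (<lex⇒value< l) , λ u p q → none (h u , value<⇒<lex (h-mono p) , value<⇒<lex (h-mono q))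

  bottom-value : ∀ {v} → (∀ w → v ≢ w → v <ₒ w) → h v ≡ Vec.replicate n false
  bottom-value {v} least with value-surjective {n} 0 (m^n>0 2 n)
  ... | c , e with h-surjective c
  ... | u , refl with compareₒ v u
  ... | inj₂ (inj₁ refl) = toList-inj (val-injective _ _ (trans (length-toList (h v)) (sym (length-toList (Vec.replicate n false)))) (trans e (sym (trans (cong val (toList-replicate n false)) (val-zeros n)))))
  ... | inj₂ (inj₂ l) = ⊥-elim (irreflₒ (transₒ l (least u λ { refl → irreflₒ l })))
  ... | inj₁ l = ⊥-elim (<⇒≱ (h-mono l) (subst (_≤ value (h v)) (sym e) z≤n))

  top-value : ∀ {v} → (∀ w → w ≢ v → w <ₒ v) → h v ≡ Vec.replicate n true
  top-value {v} greatest with h-surjective (Vec.replicate n true)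
  ... | u , e with ≡-decVec _≟B_ u v
  ... | yes refl = e
  ... | no u≢v = ⊥-elim (<⇒≱ (value< (h v)) (subst (_≤ value (h v)) (trans (cong (λ w → suc (value w)) e) (trans (cong (λ w → suc (val w)) (toList-replicate n true)) (val-ones n))) (h-mono (greatest u u≢v))))

-- From CLU#P to CL#P

_⊞_ : Poly → Poly → Poly
[]       ⊞ q        = q
(c ∷ p)  ⊞ []       = c ∷ p
(c ∷ p)  ⊞ (d ∷ q)  = (c + d) ∷ (p ⊞ q)

eval-⊞ : ∀ p q n → eval (p ⊞ q) n ≡ eval p n + eval q n
eval-⊞ []      q       n = refl
eval-⊞ (c ∷ p) []      n = sym (+-identityʳ _)
eval-⊞ (c ∷ p) (d ∷ q) n rewrite eval-⊞ p q n = lem c d n (eval p n) (eval q n)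
  where
  lem : ∀ c d n a b → c + d + n * (a + b) ≡ c + n * a + (d + n * b)
  lem = solve-∀

length-pair : ∀ x y → length (pair x y) ≡ 2 * length x + 2 + length y
length-pair []      y = refl
length-pair (b ∷ x) y = trans (cong (2 +_) (length-pair x y)) (lem (length x) (length y))
  where
  lem : ∀ m n → suc (suc (2 * m + 2 + n)) ≡ 2 * suc m + 2 + n
  lem = solve-∀

-- The second component is a suffix of the code, so for fixed x and fixed length of y the words ⟨x,
-- y⟩ are consecutive.
pair-++ : ∀ x y → pair x y ≡ pair x [] ++ y
pair-++ []      y = refl
pair-++ (b ∷ x) y = cong (λ z → b ∷ b ∷ z) (pair-++ x y)

num-++ : ∀ u v → num (u ++ v) ≡ num u * 2 ^ length v + val v
num-++ u v = begin
  2 ^ length (u ++ v) + val (u ++ v) ≡⟨ cong₂ _+_ (trans (cong (2 ^_) (length-++ u)) (^-distribˡ-+-* 2 (length u) (length v))) (val-++ u v) ⟩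
  2 ^ length u * 2 ^ length v + (val u * 2 ^ length v + val v) ≡⟨ lem (2 ^ length u) (2 ^ length v) (val u) (val v) ⟩
  num u * 2 ^ length v + val v ∎
  where
  open ≡-Reasoning
  lem : ∀ p q a b → p * q + (a * q + b) ≡ (p + a) * q + b
  lem = solve-∀

ptdec-pred₁ : ∀ {g : Str → Str} → PolyTimeFun g → PTDec (λ z → g z ≡ true ∷ [])
ptdec-pred₁ G = ptdec-≡ G (pt-const (true ∷ []))

-- The projections are total and return something on every word; encoding again detects the words
-- that are no pairs.
IsPair : Str → Set
IsPair u = pair (left u) (right u) ≡ u

ptdec-IsPair : PTDec IsPair
ptdec-IsPair = ptdec-≡ (pt-pair (pt-left pt-id) (pt-right pt-id)) pt-id

module FromCLU (M : BalancedNPTM) (b t : Str → Str) (pr : Str → Str → Str → Bool)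
  (B : PolyTimeFun b) (T : PolyTimeFun t) (PR : PolyTimePred₃ pr)
  (h⤖ : ∀ x → BalancedNPTM.Path M x ⤖ BalancedNPTM.Path M x)
  (bot : ∀ x → Σ (BalancedNPTM.Path M x) λ b′ → toList b′ ≡ b x × Bijection.to (h⤖ x) b′ ≡ Vec.replicate (BalancedNPTM.m M x) false)
  (top : ∀ x → Σ (BalancedNPTM.Path M x) λ t′ → toList t′ ≡ t x × Bijection.to (h⤖ x) t′ ≡ Vec.replicate (BalancedNPTM.m M x) true)
  (adj : ∀ x (y z : BalancedNPTM.Path M x) → (pr x (toList y) (toList z) ≡ true) ⇔ (Bijection.to (h⤖ x) y ≺lex Bijection.to (h⤖ x) z))
  where

  open BalancedNPTM M

  H : ∀ x → Path x → Path x
  H x = Bijection.to (h⤖ x)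

  H-injective : ∀ {x v w} → H x v ≡ H x w → v ≡ w
  H-injective {x} = Bijection.injective (h⤖ x)

  H-surjective : ∀ x w → Σ[ v ∈ Path x ] H x v ≡ w
  H-surjective x w = let v , e = Bijection.surjective (h⤖ x) w in v , e refl

  Valid : Str → Set
  Valid u = Σ[ x ∈ Str ] Σ[ v ∈ Path x ] u ≡ pair x (toList v)

  length-b : ∀ x → length (b x) ≡ m x
  length-b x = let b′ , e , _ = bot x in trans (cong length (sym e)) (length-toList b′)

  -- |b x| serves as a yardstick for p(|x|).
  ptdec-Valid : PTDec Valid
  ptdec-Valid = ptdec-map to from
    (ptdec-× ptdec-IsPair
      (ptdec-≡ (pt-fill false (pt-right pt-id)) (pt-fill false (pt-∘ B (pt-left pt-id)))))
    where
    to : ∀ u → IsPair u × zeros (length (right u)) ≡ zeros (length (b (left u))) → Valid u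
    to u (e , l) = left u , vec (right u) l′ , trans (sym e) (cong (pair (left u)) (sym (toList-vec (right u) l′)))
      where
      l′ : length (right u) ≡ m (left u)
      l′ = trans (trans (sym (length-replicate _)) (trans (cong length l) (length-replicate _))) (length-b (left u))
    from : ∀ u → Valid u → IsPair u × zeros (length (right u)) ≡ zeros (length (b (left u)))
    from _ (x , v , refl) rewrite left-pair x (toList v) | right-pair x (toList v) =
      refl , cong zeros (trans (length-toList v) (sym (length-b x)))

  open PTDec ptdec-Valid using () renaming (decide to valid?)

  opaque
    φ : Str → Str
    φ u with valid? u
    ... | yes (x , v , _) = pair x (toList (H x v))
    ... | no  _           = u

    φ-pair : ∀ x v → φ (pair x (toList v)) ≡ pair x (toList (H x v))
    φ-pair x v with valid? (pair x (toList v))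
    ... | no ¬valid = ⊥-elim (¬valid (x , v , refl))
    ... | yes (x′ , v′ , e) with pair-injective {x} {_} {x′} e
    ... | refl , e′ with toList-inj {v = v} {v′} e′
    ... | refl = refl

    φ-invalid : ∀ u → ¬ Valid u → φ u ≡ u
    φ-invalid u ¬valid with valid? u
    ... | no  _ = refl
    ... | yes v = ⊥-elim (¬valid v)

    -- `φ` permutes every block and fixes the words outside, so a preimage of a word of a block lies
    -- in that block. Injectivity and the border analysis rest on this.
    φ-fibre : ∀ u x w → φ u ≡ pair x (toList w) → Σ[ v ∈ Path x ] u ≡ pair x (toList v) × H x v ≡ w
    φ-fibre u x w e with valid? u
    ... | no ¬valid = ⊥-elim (¬valid (x , w , e))
    ... | yes (x′ , v , refl) with pair-injective {x′} {_} {x} e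
    ... | refl , e′ = v , refl , toList-inj e′

  φ-injective : ∀ u v → φ u ≡ φ v → u ≡ v
  φ-injective u v e = case valid? u of λ
    { (yes (x , w , refl)) →
        let v′ , v≡ , e′ = φ-fibre v x (H x w) (trans (sym e) (φ-pair x w))
        in trans (cong (pair x ∘ toList) (sym (H-injective e′))) (sym v≡)
    ; (no ¬u) → case valid? v of λ
        { (yes (x , w , refl)) →
            let u′ , u≡ , _ = φ-fibre u x (H x w) (trans e (φ-pair x w))
            in ⊥-elim (¬u (x , u′ , u≡))
        ; (no ¬v) → trans (sym (φ-invalid u ¬u)) (trans e (φ-invalid v ¬v)) } }

  φ-surjective : ∀ w → Σ[ u ∈ Str ] φ u ≡ w
  φ-surjective w = case valid? w of λ
    { (yes (x , v , refl)) → let v′ , e = H-surjective x v in pair x (toList v′) , trans (φ-pair x v′) (cong (pair x ∘ toList) e)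
    ; (no ¬w) → w , φ-invalid w ¬w }

  length-pairVec : ∀ x (v : Path x) → length (pair x (toList v)) ≡ 2 * length x + 2 + m x
  length-pairVec x v = trans (length-pair x (toList v)) (cong (2 * length x + 2 +_) (length-toList v))

  φ-length : ∀ u → length (φ u) ≡ length u
  φ-length u = case valid? u of λ
    { (yes (x , v , refl)) → trans (cong length (φ-pair x v)) (trans (length-pairVec x (H x v)) (sym (length-pairVec x v)))
    ; (no ¬u) → cong length (φ-invalid u ¬u) }

  key : Str → ℕ
  key u = num (φ u)

  key-injective : ∀ {u v} → key u ≡ key v → u ≡ v
  key-injective {u} {v} e = φ-injective u v (num-injective (φ u) (φ v) e)

  order : LROrder
  order = record
    { _<A_ = λ u v → key u < key v
    ; irrefl = λ u → <-irrefl refl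
    ; trans = <-trans
    ; total = λ u v u≢v → case <-cmp (key u) (key v) of λ
        { (tri< l _ _) → inj₁ l
        ; (tri≈ _ e _) → ⊥-elim (u≢v (key-injective e))
        ; (tri> _ _ l) → inj₂ l }
    ; length-respecting = λ u v l → num-shorter (φ u) (φ v) (subst₂ _<_ (sym (φ-length u)) (sym (φ-length v)) l) }

  open LROrder order using (_≺A_)

  -- Keys leave no gaps because `φ` is onto, so adjacency in the glued order becomes an equation
  -- between numbers.
  ≺A⇒key : ∀ {u v} → u ≺A v → key v ≡ suc (key u)
  ≺A⇒key {u} {v} (l , none) with m≤n⇒m<n∨m≡n l
  ... | inj₂ e  = sym e
  ... | inj₁ l′ with φ-surjective (next (φ u))
  ... | w , e = ⊥-elim (none (w , ≤-reflexive (sym w≡) , subst (_< key v) (sym w≡) l′))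
    where
    w≡ : key w ≡ suc (key u)
    w≡ = trans (cong num e) (num-next (φ u))

  key⇒≺A : ∀ {u v} → key v ≡ suc (key u) → u ≺A v
  key⇒≺A {u} {v} e = ≤-reflexive (sym e) , λ (w , p , q) → <⇒≱ q (subst (_≤ key w) (sym e) p)

  num-pairVec : ∀ x (v : Path x) → num (pair x (toList v)) ≡ num (pair x []) * 2 ^ m x + value v
  num-pairVec x v = trans (cong num (pair-++ x (toList v)))
    (trans (num-++ (pair x []) (toList v)) (cong (λ n → num (pair x []) * 2 ^ n + value v) (length-toList v)))

  num-pair-suc : ∀ x (v w : Path x) → value w ≡ suc (value v) → num (pair x (toList w)) ≡ suc (num (pair x (toList v)))
  num-pair-suc x v w e = trans (num-pairVec x w) (trans (cong (num (pair x []) * 2 ^ m x +_) e) (trans (+-suc _ _) (cong suc (sym (num-pairVec x v)))))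

  num-pair-suc⁻ : ∀ x (v w : Path x) → num (pair x (toList w)) ≡ suc (num (pair x (toList v))) → value w ≡ suc (value v)
  num-pair-suc⁻ x v w e = +-cancelˡ-≡ (num (pair x []) * 2 ^ m x) _ _
    (trans (sym (num-pairVec x w)) (trans e (trans (cong suc (num-pairVec x v)) (sym (+-suc _ _)))))

  key-pair : ∀ x v → key (pair x (toList v)) ≡ num (pair x (toList (H x v)))
  key-pair x v = cong num (φ-pair x v)

  -- Unless `H x v` consists of 1s only, incrementing it yields the next word of the same block, and
  -- by `φ-fibre` its preimage u would belong to the block too.
  leaves-at-top : ∀ x v u → key u ≡ suc (key (pair x (toList v))) → ¬ (Σ[ w ∈ Path x ] u ≡ pair x (toList w)) → toList v ≡ t x
  leaves-at-top x v u e out = Sum.[ atTop , (λ (w , l , n , _) → ⊥-elim (notTop w l n)) ]′ (increment (toList (H x v)))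
    where
    atTop : toList (H x v) ≡ ones (length (toList (H x v))) → toList v ≡ t x
    atTop o = let t′ , t≡ , ht = top x in
      trans (cong toList (H-injective {x} {v} {t′} (toList-inj (trans o (trans (cong ones (length-toList (H x v)))
        (sym (trans (cong toList ht) (toList-replicate (m x) true)))))))) t≡
    notTop : ∀ w → length w ≡ length (toList (H x v)) → val w ≡ suc (value (H x v)) → ⊥
    notTop w l n = out (let v′ , u≡ , _ = φ-fibre u x w′ φu in v′ , u≡)
      where
      w′ : Path x
      w′ = vec w (trans l (length-toList (H x v)))
      φu : φ u ≡ pair x (toList w′)
      φu = num-injective _ _ (trans e (trans (cong suc (key-pair x v))
        (sym (num-pair-suc x (H x v) w′ (trans (cong val (toList-vec w (trans l (length-toList (H x v))))) n)))))

  -- The dual argument: if `H x v` has positive value, the word just below it still lies in the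
  -- block.
  enters-at-bottom : ∀ x v u → key (pair x (toList v)) ≡ suc (key u) → ¬ (Σ[ w ∈ Path x ] u ≡ pair x (toList w)) → toList v ≡ b x
  enters-at-bottom x v u e out = by-value (value (H x v)) refl
    where
    by-value : ∀ k → value (H x v) ≡ k → toList v ≡ b x
    by-value zero val≡ = let b′ , b≡ , hb = bot x in
      trans (cong toList (H-injective {x} {v} {b′} (value-injective (trans val≡
        (sym (trans (cong value hb) (trans (cong val (toList-replicate (m x) false)) (val-zeros (m x))))))))) b≡
    by-value (suc k) val≡ = ⊥-elim (out (let v′ , u≡ , _ = φ-fibre u x w φu in v′ , u≡))
      where
      before = value-surjective {m x} k (<-trans (n<1+n k) (subst (_< 2 ^ m x) val≡ (value< (H x v))))
      w : Path x
      w = proj₁ before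
      φu : φ u ≡ pair x (toList w)
      φu = num-injective _ _ (suc-injective (trans (sym e) (trans (key-pair x v)
        (num-pair-suc x w (H x v) (trans val≡ (cong suc (sym (proj₂ before))))))))

  Same : Str → Str → Set
  Same u v = Valid u × Valid v × left u ≡ left v

  AtTop AtBottom : Str → Set
  AtTop u    = Valid u × right u ≡ t (left u)
  AtBottom u = Valid u × right u ≡ b (left u)

  -- The images under `φ` of the two border words of the block of u. They are computable even where
  -- `φ` is not.
  topOf bottomOf : Str → Str
  topOf u    = pair (left u) (ones (length (right u)))
  bottomOf u = pair (left u) (zeros (length (right u)))

  φ-AtTop : ∀ u → AtTop u → φ u ≡ topOf u
  φ-AtTop _ ((x , v , refl) , e) rewrite left-pair x (toList v) | right-pair x (toList v) = trans (φ-pair x v)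
    (cong (pair x) (trans (cong (toList ∘ H x) (toList-inj (trans e (sym (proj₁ (proj₂ (top x)))))))
      (trans (cong toList (proj₂ (proj₂ (top x)))) (trans (toList-replicate (m x) true) (cong ones (sym (length-toList v)))))))

  φ-AtBottom : ∀ u → AtBottom u → φ u ≡ bottomOf u
  φ-AtBottom _ ((x , v , refl) , e) rewrite left-pair x (toList v) | right-pair x (toList v) = trans (φ-pair x v)
    (cong (pair x) (trans (cong (toList ∘ H x) (toList-inj (trans e (sym (proj₁ (proj₂ (bot x)))))))
      (trans (cong toList (proj₂ (proj₂ (bot x)))) (trans (toList-replicate (m x) false) (cong zeros (sym (length-toList v)))))))

  Next : Str → Str → Set
  Next u v = num v ≡ suc (num u)

  -- For neighbours without a common block, each of the two lies outside all blocks or at the border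
  -- of its own. In all four cases the ranks are computable.
  Cross : Str → Str → Set
  Cross u v = ((¬ Valid u × ¬ Valid v) × Next u v) ⊎ ((¬ Valid u × AtBottom v) × Next u (bottomOf v))
            ⊎ ((AtTop u × ¬ Valid v) × Next (topOf u) v) ⊎ ((AtTop u × AtBottom v) × Next (topOf u) (bottomOf v))

  gp : Str → Str
  gp = proj₁ PR

  Adjacent : Str → Str → Set
  Adjacent u v = (Same u v × gp (pair (left u) (pair (right u) (right v))) ≡ true ∷ []) ⊎ (¬ Same u v × Cross u v)

  Cross⇒key : ∀ u v → Cross u v → key v ≡ suc (key u)
  Cross⇒key u v (inj₁ ((p , q) , n))               rewrite φ-invalid u p | φ-invalid v q = n
  Cross⇒key u v (inj₂ (inj₁ ((p , q) , n)))        rewrite φ-invalid u p | φ-AtBottom v q = n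
  Cross⇒key u v (inj₂ (inj₂ (inj₁ ((p , q) , n)))) rewrite φ-AtTop u p | φ-invalid v q = n
  Cross⇒key u v (inj₂ (inj₂ (inj₂ ((p , q) , n)))) rewrite φ-AtTop u p | φ-AtBottom v q = n

  pr-gp : ∀ x y z → gp (pair x (pair y z)) ≡ pr x y z ∷ []
  pr-gp = proj₂ (proj₂ PR)

  inside⇔ : ∀ x (v w : Path x) → (gp (pair x (pair (toList v) (toList w))) ≡ true ∷ []) ⇔ (key (pair x (toList w)) ≡ suc (key (pair x (toList v))))
  inside⇔ x v w = mk⇔
    (λ e → subst₂ (λ i j → i ≡ suc j) (sym (key-pair x w)) (sym (key-pair x v))
      (num-pair-suc x (H x v) (H x w) (≺lex⇒value (Equivalence.to (adj x v w) (proj₁ (∷-injective (trans (sym (pr-gp x (toList v) (toList w))) e)))))))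
    (λ e → trans (pr-gp x (toList v) (toList w)) (cong (_∷ []) (Equivalence.from (adj x v w) (value⇒≺lex
      (num-pair-suc⁻ x (H x v) (H x w) (subst₂ (λ i j → i ≡ suc j) (key-pair x w) (key-pair x v) e))))))

  Adjacent⇒key : ∀ u v → Adjacent u v → key v ≡ suc (key u)
  Adjacent⇒key u v (inj₂ (_ , c)) = Cross⇒key u v c
  Adjacent⇒key _ _ (inj₁ (((x , v , refl) , (x′ , w , refl) , l) , e))
    rewrite left-pair x (toList v) | left-pair x′ (toList w) | right-pair x (toList v) | right-pair x′ (toList w) with l
  ... | refl = Equivalence.to (inside⇔ x v w) e

  key⇒Adjacent : ∀ u v → key v ≡ suc (key u) → Adjacent u v
  key⇒Adjacent u v e with valid? u | valid? v
  ... | no ¬u | no ¬v = inj₂ ((λ s → ¬u (proj₁ s)) , inj₁ ((¬u , ¬v) , subst₂ (λ i j → num i ≡ suc (num j)) (φ-invalid v ¬v) (φ-invalid u ¬u) e))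
  ... | no ¬u | yes V@(x , w , refl) = inj₂ ((λ s → ¬u (proj₁ s)) , inj₂ (inj₁ ((¬u , at) ,
        subst₂ (λ i j → num i ≡ suc (num j)) (φ-AtBottom v at) (φ-invalid u ¬u) e)))
    where
    at : AtBottom v
    at = V , trans (right-pair x (toList w)) (trans (enters-at-bottom x w u e (λ (w′ , p) → ¬u (x , w′ , p))) (cong b (sym (left-pair x (toList w)))))
  ... | yes U@(x , w , refl) | no ¬v = inj₂ ((λ s → ¬v (proj₁ (proj₂ s))) , inj₂ (inj₂ (inj₁ ((at , ¬v) ,
        subst₂ (λ i j → num i ≡ suc (num j)) (φ-invalid v ¬v) (φ-AtTop u at) e))))
    where
    at : AtTop u
    at = U , trans (right-pair x (toList w)) (trans (leaves-at-top x w v e (λ (w′ , p) → ¬v (x , w′ , p))) (cong t (sym (left-pair x (toList w)))))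
  ... | yes U@(x , w , refl) | yes V@(x′ , w′ , refl) with ≡-decList _≟B_ x x′
  ... | yes refl = inj₁ ((U , V , trans (left-pair x (toList w)) (sym (left-pair x (toList w′)))) , inside)
    where
    inside : gp (pair (left (pair x (toList w))) (pair (right (pair x (toList w))) (right (pair x (toList w′))))) ≡ true ∷ []
    inside rewrite left-pair x (toList w) | right-pair x (toList w) | right-pair x (toList w′) = Equivalence.from (inside⇔ x w w′) e
  ... | no x≢x′ = inj₂ ((λ (_ , _ , l) → x≢x′ (trans (sym (left-pair x (toList w))) (trans l (left-pair x′ (toList w′)))))
        , inj₂ (inj₂ (inj₂ ((at , at′) , subst₂ (λ i j → num i ≡ suc (num j)) (φ-AtBottom v at′) (φ-AtTop u at) e))))
    where
    at : AtTop u
    at = U , trans (right-pair x (toList w)) (trans (leaves-at-top x w v e (λ (_ , p) → x≢x′ (sym (proj₁ (pair-injective {x′} p))))) (cong t (sym (left-pair x (toList w)))))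
    at′ : AtBottom v
    at′ = V , trans (right-pair x′ (toList w′)) (trans (enters-at-bottom x′ w′ u e (λ (_ , p) → x≢x′ (proj₁ (pair-injective {x} p)))) (cong b (sym (left-pair x′ (toList w′)))))

  ptdec-Adjacent : PTDec (λ z → Adjacent (left z) (right z))
  ptdec-Adjacent = ptdec-⊎
    (ptdec-× same (ptdec-pred₁ (pt-∘ (proj₁ (proj₂ PR)) (pt-pair (pt-left ℓ) (pt-pair (pt-right ℓ) (pt-right r))))))
    (ptdec-× (ptdec-¬ same)
      (ptdec-⊎ (ptdec-× (ptdec-× (ptdec-¬ vℓ) (ptdec-¬ vr)) (ptdec-next ℓ r))
      (ptdec-⊎ (ptdec-× (ptdec-× (ptdec-¬ vℓ) br) (ptdec-next ℓ lo))
      (ptdec-⊎ (ptdec-× (ptdec-× tℓ (ptdec-¬ vr)) (ptdec-next hi r))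
               (ptdec-× (ptdec-× tℓ br) (ptdec-next hi lo))))))
    where
    ℓ : PolyTimeFun left
    ℓ = pt-left pt-id
    r : PolyTimeFun right
    r = pt-right pt-id
    vℓ : PTDec (Valid ∘ left)
    vℓ = ptdec-∘ ptdec-Valid ℓ
    vr : PTDec (Valid ∘ right)
    vr = ptdec-∘ ptdec-Valid r
    same : PTDec (λ z → Same (left z) (right z))
    same = ptdec-× vℓ (ptdec-× vr (ptdec-≡ (pt-left ℓ) (pt-left r)))
    tℓ : PTDec (AtTop ∘ left)
    tℓ = ptdec-× vℓ (ptdec-≡ (pt-right ℓ) (pt-∘ T (pt-left ℓ)))
    br : PTDec (AtBottom ∘ right)
    br = ptdec-× vr (ptdec-≡ (pt-right r) (pt-∘ B (pt-left r)))
    hi : PolyTimeFun (topOf ∘ left)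
    hi = pt-pair (pt-left ℓ) (pt-fill true (pt-right ℓ))
    lo : PolyTimeFun (bottomOf ∘ right)
    lo = pt-pair (pt-left r) (pt-fill false (pt-right r))

  efficientAdj : EfficientAdj order
  efficientAdj = (λ u v → test (pair u v)) , ((λ z → test z ∷ []) , poly , λ _ _ → refl) , λ u v → mk⇔
    (λ e → key⇒≺A (subst₂ (λ u v → key v ≡ suc (key u)) (left-pair u v) (right-pair u v) (Adjacent⇒key _ _ (sound (pair u v) e))))
    (λ a → complete (pair u v) (key⇒Adjacent _ _ (subst₂ (λ u v → key v ≡ suc (key u)) (sym (left-pair u v)) (sym (right-pair u v)) (≺A⇒key a))))
    where open PTDec ptdec-Adjacent

  -- 2n + 2 + p(n) is the length of ⟨x, y⟩: the guesses of the new machine are the words of a block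
  -- themselves, since the glued order follows h_x only there.
  p′ : Poly
  p′ = (2 ∷ 2 ∷ []) ⊞ p

  eval-p′ : ∀ x → 2 * length x + 2 + m x ≡ eval p′ (length x)
  eval-p′ x = trans (lem (length x) (m x)) (sym (eval-⊞ (2 ∷ 2 ∷ []) p (length x)))
    where
    lem : ∀ n a → 2 * n + 2 + a ≡ 2 + n * (2 + n * 0) + a
    lem = solve-∀

  gV : Str → Str
  gV = proj₁ V-poly

  -- Guesses that are no pair, or a pair for another input, must be rejected: their place in the
  -- order has nothing to do with the block of x.
  Accepted : Str → Set
  Accepted z = (left (right z) ≡ left z × IsPair (right z)) × gV (right z) ≡ true ∷ []

  ptdec-Accepted : PTDec Accepted
  ptdec-Accepted = ptdec-× (ptdec-× (ptdec-≡ (pt-left (pt-right pt-id)) (pt-left pt-id)) (ptdec-∘ ptdec-IsPair (pt-right pt-id)))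
    (ptdec-pred₁ (pt-∘ (proj₁ (proj₂ V-poly)) (pt-right pt-id)))

  M′ : BalancedNPTM
  M′ = record { p = p′ ; V = λ x u → test (pair x u) ; V-poly = (λ z → test z ∷ []) , poly , λ _ _ → refl }
    where open PTDec ptdec-Accepted

  module M′ = BalancedNPTM M′

  path′ : ∀ x → Path x → M′.Path x
  path′ x v = vec (pair x (toList v)) (trans (length-pairVec x v) (eval-p′ x))

  toList-path′ : ∀ x v → toList (path′ x v) ≡ pair x (toList v)
  toList-path′ x v = toList-vec (pair x (toList v)) (trans (length-pairVec x v) (eval-p′ x))

  path′-injective : ∀ {x v w} → path′ x v ≡ path′ x w → v ≡ w
  path′-injective {x} {v} {w} e = toList-inj (proj₂ (pair-injective {x} {_} {x}
    (trans (sym (toList-path′ x v)) (trans (cong toList e) (toList-path′ x w)))))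

  acc⇒acc′ : ∀ x v → Acc x v → M′.Acc x (path′ x v)
  acc⇒acc′ x v a = PTDec.complete ptdec-Accepted (pair x (toList (path′ x v))) accepted
    where
    accepted : Accepted (pair x (toList (path′ x v)))
    accepted rewrite left-pair x (toList (path′ x v)) | right-pair x (toList (path′ x v)) | toList-path′ x v | left-pair x (toList v) | right-pair x (toList v) =
      (refl , refl) , trans (proj₂ (proj₂ V-poly) x (toList v)) (cong (_∷ []) a)

  acc′⇒acc : ∀ x w → M′.Acc x w → Σ[ v ∈ Path x ] w ≡ path′ x v × Acc x v
  acc′⇒acc x w a = v , toList-inj (trans w≡ (sym (toList-path′ x v))) , proj₁ (∷-injective (trans (sym (proj₂ (proj₂ V-poly) x (toList v))) (trans (cong gV (sym w≡)) gV≡)))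
    where
    acc : Accepted (pair x (toList w))
    acc = PTDec.sound ptdec-Accepted (pair x (toList w)) a
    gV≡ : gV (toList w) ≡ true ∷ []
    gV≡ = trans (cong gV (sym (right-pair x (toList w)))) (proj₂ acc)
    pair≡ : toList w ≡ pair x (right (toList w))
    pair≡ = subst₂ (λ u x′ → u ≡ pair x′ (right u)) (right-pair x (toList w)) (trans (proj₁ (proj₁ acc)) (left-pair x (toList w))) (sym (proj₂ (proj₁ acc)))
    l : length (right (toList w)) ≡ m x
    l = +-cancelˡ-≡ (2 * length x + 2) _ _ (trans (sym (length-pair x _)) (trans (cong length (sym pair≡)) (trans (length-toList w) (sym (eval-p′ x)))))
    v : Path x
    v = vec (right (toList w)) l
    w≡ : toList w ≡ pair x (toList v)
    w≡ = trans pair≡ (cong (pair x) (sym (toList-vec _ l)))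

  #acc≡ : ∀ x → #acc M x ≡ #acc M′ x
  #acc≡ x = ≤-antisym
    (countVecs-≤ (λ v → V x (toList v) ≟B true) (λ w → M′.V x (toList w) ≟B true) (λ {v} _ → path′ x v) (λ {v} → acc⇒acc′ x v) (λ _ _ → path′-injective {x}))
    (countVecs-≤ (λ w → M′.V x (toList w) ≟B true) (λ v → V x (toList v) ≟B true) (λ {w} a → proj₁ (acc′⇒acc x w a)) (λ {w} a → proj₂ (proj₂ (acc′⇒acc x w a)))
      (λ {v} {w} p q e → trans (proj₁ (proj₂ (acc′⇒acc x v p))) (trans (cong (path′ x) e) (sym (proj₁ (proj₂ (acc′⇒acc x w q)))))))

  module _ (x : Str) where
    _≈_ : M′.Path x → M′.Path x → Set
    _≈_ = _≡AMx_ order M′ x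

    ≈-preserves : ∀ {v w} → v ≈ w → M′.Acc x v ⇔ M′.Acc x w
    ≈-preserves = EqC.fold (On.isEquivalence (M′.Acc x) ⇔-isEquivalence) proj₂

    module _ (ℓ u : Path x) (interval : ∀ w → Acc x w ⇔ (H x ℓ ≤lex H x w × H x w ≤lex H x u)) where

      -- Induction on the distance from ℓ: the predecessor of v under h_x is still in the interval,
      -- hence accepting, and the two pairs are adjacent in the glued order.
      walk : ∀ k v → value (H x v) ≡ k + value (H x ℓ) → Acc x v → path′ x v ≈ path′ x ℓ
      walk zero v e a = subst (λ v → path′ x v ≈ path′ x ℓ) (sym (H-injective {x} {v} {ℓ} (value-injective e))) (EqC.reflexive (_∼_ order M′ x))
      walk (suc k) v e a = fwd (inj₂ (key⇒≺A key≡) , mk⇔ (λ _ → acc⇒acc′ x v′ a′) (λ _ → acc⇒acc′ x v a)) ◅ walk k v′ e′ a′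
        where
        bound : k + value (H x ℓ) < 2 ^ m x
        bound = <-trans (n<1+n _) (subst (_< 2 ^ m x) e (value< (H x v)))
        c = value-surjective (k + value (H x ℓ)) bound
        v′ : Path x
        v′ = proj₁ (H-surjective x (proj₁ c))
        e′ : value (H x v′) ≡ k + value (H x ℓ)
        e′ = trans (cong value (proj₂ (H-surjective x (proj₁ c)))) (proj₂ c)
        a′ : Acc x v′
        a′ = Equivalence.from (interval v′)
          ( value≤⇒≤lex (subst (value (H x ℓ) ≤_) (sym e′) (m≤n+m _ k))
          , value≤⇒≤lex (≤-trans (≤-trans (≤-reflexive e′) (n≤1+n _)) (≤-trans (≤-reflexive (sym e)) (≤lex⇒value≤ (proj₂ (Equivalence.to (interval v) a))))))
        key≡ : key (toList (path′ x v)) ≡ suc (key (toList (path′ x v′)))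
        key≡ = begin
          key (toList (path′ x v))              ≡⟨ cong key (toList-path′ x v) ⟩
          key (pair x (toList v))               ≡⟨ key-pair x v ⟩
          num (pair x (toList (H x v)))         ≡⟨ num-pair-suc x (H x v′) (H x v) (trans e (cong suc (sym e′))) ⟩
          suc (num (pair x (toList (H x v′))))  ≡⟨ cong suc (sym (key-pair x v′)) ⟩
          suc (key (pair x (toList v′)))        ≡⟨ cong (λ u → 1 + key u) (sym (toList-path′ x v′)) ⟩
          suc (key (toList (path′ x v′)))       ∎
          where open ≡-Reasoning

    isCluster : (#acc M x ≢ 0 → Σ (Path x) λ ℓ → Σ (Path x) λ u → ∀ w → Acc x w ⇔ (H x ℓ ≤lex H x w × H x w ≤lex H x u)) →
      AccIsCluster order M′ x
    isCluster interval = case #acc M x ≟ 0 of λ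
      { (yes e) → inj₁ λ w a → let v , _ , a′ = acc′⇒acc x w a in countVecs-≡0 (λ v → V x (toList v) ≟B true) e v a′
      ; (no ne) → let ℓ , u , i = interval ne
                      v₀ , a₀   = countVecs-≢0 (λ v → V x (toList v) ≟B true) ne
                  in inj₂ (cluster ℓ u i v₀ a₀) }
      where
      cluster : ∀ ℓ u → (∀ w → Acc x w ⇔ (H x ℓ ≤lex H x w × H x w ≤lex H x u)) → ∀ v₀ → Acc x v₀ →
        Σ (M′.Path x) λ y₀ → (∀ w → w ≈ y₀ → M′.Acc x w) × (∀ w → M′.Acc x w ⇔ w ≈ y₀)
      cluster ℓ u i v₀ a₀ = path′ x ℓ , (λ w r → Equivalence.from (≈-preserves r) aℓ) ,
          λ w → mk⇔ (reach w) (λ r → Equivalence.from (≈-preserves r) aℓ)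
        where
        -- Condition (4) alone does not say that ℓ accepts; any accepting path `v₀` lies between ℓ
        -- and u and so proves the interval nonempty.
        ℓ≤u : H x ℓ ≤lex H x u
        ℓ≤u = let p , q = Equivalence.to (i v₀) a₀ in value≤⇒≤lex (≤-trans (≤lex⇒value≤ p) (≤lex⇒value≤ q))
        aℓ : M′.Acc x (path′ x ℓ)
        aℓ = acc⇒acc′ x ℓ (Equivalence.from (i ℓ) (inj₂ refl , ℓ≤u))
        reach : ∀ w → M′.Acc x w → w ≈ path′ x ℓ
        reach w a =
          let v , w≡ , a′ = acc′⇒acc x w a
          in subst (_≈ path′ x ℓ) (sym w≡)
               (walk ℓ u i (value (H x v) ∸ value (H x ℓ)) v (sym (m∸n+n≡m (≤lex⇒value≤ (proj₁ (Equivalence.to (i v) a′))))) a′)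

CLU⇒CL : ∀ f → CLU#P f → CL#P f
CLU⇒CL f (M , b , t , pr , B , T , PR , spec) = M′ , order , efficientAdj , λ x →
  let _ , _ , _ , _ , interval , f≡ = spec x
  in isCluster x (λ ne → interval (λ e → ne (trans (sym f≡) e))) , trans f≡ (#acc≡ x)
  where
  open FromCLU M b t pr B T PR (λ x → proj₁ (spec x))
    (λ x → proj₁ (proj₂ (spec x))) (λ x → proj₁ (proj₂ (proj₂ (spec x)))) (λ x → proj₁ (proj₂ (proj₂ (proj₂ (spec x)))))

-- From CL#P to CLU#P

-- Serves for the successor of a word in `A` and, with the order and its reverse, for the two ends
-- of the accepting interval.
extremum : ∀ {A : Set} {P : A → Set} (P? : Decidable P) (_⊑_ : A → A → Set) →
  (∀ {a b c} → a ⊑ b → b ⊑ c → a ⊑ c) → (∀ a b → a ⊑ b ⊎ b ⊑ a) → ∀ xs →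
  (∀ {a} → a ∈ xs → ¬ P a) ⊎ Σ[ a ∈ A ] P a × (∀ {b} → b ∈ xs → P b → a ⊑ b)
extremum {A} {P} P? _⊑_ ⊑-trans ⊑-total = go
  where
  ⊑-refl : ∀ a → a ⊑ a
  ⊑-refl a = Sum.reduce (⊑-total a a)
  go : ∀ xs → (∀ {a} → a ∈ xs → ¬ P a) ⊎ Σ[ a ∈ A ] P a × (∀ {b} → b ∈ xs → P b → a ⊑ b)
  go []       = inj₁ λ ()
  go (x ∷ xs) with P? x | go xs
  ... | no ¬p | inj₁ none          = inj₁ λ { (Any.here refl) → ¬p ; (Any.there i) → none i }
  ... | yes p | inj₁ none          = inj₂ (x , p , λ { (Any.here refl) _ → ⊑-refl x ; (Any.there i) q → ⊥-elim (none i q) })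
  ... | no ¬p | inj₂ (a , pa , l)  = inj₂ (a , pa , λ { (Any.here refl) q → ⊥-elim (¬p q) ; (Any.there i) q → l i q })
  ... | yes p | inj₂ (a , pa , l) with ⊑-total x a
  ... | inj₁ x⊑a = inj₂ (x , p , λ { (Any.here refl) _ → ⊑-refl x ; (Any.there i) q → ⊑-trans x⊑a (l i q) })
  ... | inj₂ a⊑x = inj₂ (a , pa , λ { (Any.here refl) _ → a⊑x ; (Any.there i) q → l i q })

-- Successors in a length-respecting order

module LengthRespecting (A : LROrder) where
  open LROrder A renaming (trans to <A-trans; total to <A-total; irrefl to <A-irrefl)

  compareA : ∀ x y → x <A y ⊎ x ≡ y ⊎ y <A x
  compareA x y = case ≡-decList _≟B_ x y of λ
    { (yes e) → inj₂ (inj₁ e)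
    ; (no ne) → Sum.[ inj₁ , (λ l → inj₂ (inj₂ l)) ]′ (<A-total x y ne) }

  _≤A_ : Str → Str → Set
  x ≤A y = x <A y ⊎ x ≡ y

  ≮⇒≥A : ∀ {x y} → ¬ (x <A y) → y ≤A x
  ≮⇒≥A {x} {y} ¬l with compareA x y
  ... | inj₁ l        = ⊥-elim (¬l l)
  ... | inj₂ (inj₁ e) = inj₂ (sym e)
  ... | inj₂ (inj₂ l) = inj₁ l

  <A⇒length≤ : ∀ {x y} → x <A y → length x ≤ length y
  <A⇒length≤ {x} {y} l = ≮⇒≥ λ s → <A-irrefl x (<A-trans l (length-respecting y x s))

  ≤A⇒length≤ : ∀ {x y} → x ≤A y → length x ≤ length y
  ≤A⇒length≤ (inj₁ l)    = <A⇒length≤ l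
  ≤A⇒length≤ (inj₂ refl) = ≤-refl

  ≺A-unique : ∀ {x y z} → x ≺A y → x ≺A z → y ≡ z
  ≺A-unique {x} {y} {z} (p , none) (q , none′) with compareA y z
  ... | inj₁ l        = ⊥-elim (none′ (y , p , l))
  ... | inj₂ (inj₁ e) = e
  ... | inj₂ (inj₂ l) = ⊥-elim (none (z , q , l))

  ≺A-least : ∀ {x y z} → x ≺A y → x <A z → y ≤A z
  ≺A-least (_ , none) l = ≮⇒≥A λ z<y → none (_ , l , z<y)

  -- The word 0...0 of length |x| + 1 lies above x, and everything between them has length |x| or
  -- |x| + 1. So the successor is the minimum of a finite list; the search is exponential, but only
  -- existence is used, except for the fixed word ε.
  successor : ∀ x → Σ[ y ∈ Str ] x ≺A y
  successor x = Sum.[ (λ none → ⊥-elim (none z∈ x<z)) , (λ (y , x<y , least) → y , x<y , λ (w , x<w , w<y) →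
      <A-irrefl w (≤<A-trans w<y (least (short w x<w w<y (length-least y least)) x<w))) ]′
    (extremum above? (λ u v → u ≤A v) ≤A-trans ≤A-total candidates)
    where
    n = length x
    z : Str
    z = zeros (suc n)
    candidates : List Str
    candidates = map toList (allVecs n) ++ map toList (allVecs (suc n))
    candidate : ∀ w → length w ≡ n ⊎ length w ≡ suc n → w ∈ candidates
    candidate w (inj₁ l) = ∈-++⁺ˡ (subst (_∈ map toList (allVecs n)) (toList-vec w l) (∈-map⁺ toList (allVecs-∈ (vec w l))))
    candidate w (inj₂ l) = ∈-++⁺ʳ (map toList (allVecs n)) (subst (_∈ map toList (allVecs (suc n))) (toList-vec w l) (∈-map⁺ toList (allVecs-∈ (vec w l))))
    z∈ : z ∈ candidates
    z∈ = candidate z (inj₂ (length-replicate (suc n)))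
    x<z : x <A z
    x<z = length-respecting x z (≤-reflexive (sym (length-replicate (suc n))))
    above? : Decidable (x <A_)
    above? w with compareA x w
    ... | inj₁ l           = yes l
    ... | inj₂ (inj₁ refl) = no (<A-irrefl x)
    ... | inj₂ (inj₂ l)    = no λ l′ → <A-irrefl x (<A-trans l′ l)
    ≤A-trans : ∀ {u v w} → u ≤A v → v ≤A w → u ≤A w
    ≤A-trans (inj₂ refl) q           = q
    ≤A-trans (inj₁ p)    (inj₂ refl) = inj₁ p
    ≤A-trans (inj₁ p)    (inj₁ q)    = inj₁ (<A-trans p q)
    ≤A-total : ∀ u v → u ≤A v ⊎ v ≤A u
    ≤A-total u v with compareA u v
    ... | inj₁ l        = inj₁ (inj₁ l)
    ... | inj₂ (inj₁ e) = inj₁ (inj₂ e)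
    ... | inj₂ (inj₂ l) = inj₂ (inj₁ l)
    ≤<A-trans : ∀ {u v w} → u <A v → v ≤A w → u <A w
    ≤<A-trans p (inj₁ q)    = <A-trans p q
    ≤<A-trans p (inj₂ refl) = p
    length-least : ∀ y → (∀ {b} → b ∈ candidates → x <A b → y ≤A b) → length y ≤ suc n
    length-least y least = ≤-trans (≤A⇒length≤ (least z∈ x<z)) (≤-reflexive (length-replicate (suc n)))
    short : ∀ w {y} → x <A w → w <A y → length y ≤ suc n → w ∈ candidates
    short w x<w w<y ly = candidate w (lengths (m≤n⇒m<n∨m≡n (≤-trans (<A⇒length≤ w<y) ly)))
      where
      lengths : length w < suc n ⊎ length w ≡ suc n → length w ≡ n ⊎ length w ≡ suc n
      lengths (inj₁ (s≤s l)) = inj₁ (≤-antisym l (<A⇒length≤ x<w))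
      lengths (inj₂ e)       = inj₂ e

  ≺A-length : ∀ {x y} → x ≺A y → length x ≤ length y × length y ≤ suc (length x)
  ≺A-length {x} {y} s@(l , _) = <A⇒length≤ l ,
    ≤-trans (≤A⇒length≤ (≺A-least s (length-respecting x (zeros (suc (length x))) (≤-reflexive (sym (length-replicate (suc (length x))))))))
      (≤-reflexive (length-replicate (suc (length x))))

unpad-padded : ∀ j v → unpad (zeros j ++ true ∷ v) ≡ v
unpad-padded zero    v = refl
unpad-padded (suc j) v = unpad-padded j v

unpad-zeros : ∀ n → unpad (zeros n) ≡ []
unpad-zeros zero    = refl
unpad-zeros (suc n) = unpad-zeros n

padded : ∀ w → unpad w ≢ [] → Σ[ j ∈ ℕ ] w ≡ zeros j ++ true ∷ unpad w
padded []          ne = ⊥-elim (ne refl)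
padded (true ∷ w)  ne = 0 , refl
padded (false ∷ w) ne = let j , e = padded w ne in suc j , cong (false ∷_) e

pair≢[] : ∀ x y → pair x y ≢ []
pair≢[] []      y ()
pair≢[] (b ∷ x) y ()

-- The constraints on the lengths n = |y|, k = |z| of an edge y ≺ z padded by j zeros to length 3N + 4.
module Padding {j n k N : ℕ} (total : j + (2 * n + k) ≡ 3 * N + 1) (n≤k : n ≤ k) (k≤n+1 : k ≤ suc n) where

  source≤ : n ≤ N
  source≤ = ≮⇒≥ λ N<n → <-irrefl refl (begin-strict
    3 * N + 1         <⟨ +-monoʳ-< (3 * N) (s≤s (s≤s (z≤n {1}))) ⟩
    3 * N + 3         ≡⟨ lem N ⟩
    2 * suc N + suc N ≤⟨ +-mono-≤ (*-monoʳ-≤ 2 N<n) (≤-trans N<n n≤k) ⟩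
    2 * n + k         ≤⟨ m≤n+m (2 * n + k) j ⟩
    j + (2 * n + k)   ≡⟨ total ⟩
    3 * N + 1         ∎)
    where
    open ≤-Reasoning
    lem : ∀ N → 3 * N + 3 ≡ 2 * suc N + suc N
    lem = solve-∀

  -- As long as there is padding, the target is short enough to be a source itself, so the chain of
  -- live words continues.
  target≤ : 1 ≤ j → k ≤ N
  target≤ 1≤j = ≮⇒≥ λ N<k → <-irrefl refl (begin-strict
    3 * N + 1             <⟨ +-monoʳ-< (3 * N) (s≤s (s≤s (z≤n {0}))) ⟩
    3 * N + 2             ≡⟨ lem N ⟩
    1 + (2 * N + suc N)   ≤⟨ +-mono-≤ 1≤j (+-mono-≤ (*-monoʳ-≤ 2 (s≤s⁻¹ (≤-trans N<k k≤n+1))) N<k) ⟩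
    j + (2 * n + k)       ≡⟨ total ⟩
    3 * N + 1             ∎)
    where
    open ≤-Reasoning
    lem : ∀ N → 3 * N + 2 ≡ 1 + (2 * N + suc N)
    lem = solve-∀

  -- For n = N the equation gives j = N + 1 - k, which is 1 or 0 according to whether the target has
  -- length N or N + 1; a shorter source leaves more room. Thus a look at the padding replaces a
  -- comparison with N.
  top-source : j ≤ 1 → n ≡ N
  top-source j≤1 = ≤-antisym source≤ (≮⇒≥ λ n<N → <-irrefl refl (begin-strict
    3 * N + 1             ≡⟨ sym total ⟩
    j + (2 * n + k)       ≤⟨ +-mono-≤ j≤1 (+-monoʳ-≤ (2 * n) k≤n+1) ⟩
    1 + (2 * n + suc n)   <⟨ n<1+n _ ⟩
    2 + (2 * n + suc n)   ≡⟨ lem n ⟩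
    3 * suc n             ≤⟨ *-monoʳ-≤ 3 n<N ⟩
    3 * N                 ≤⟨ m≤m+n (3 * N) 1 ⟩
    3 * N + 1             ∎))
    where
    open ≤-Reasoning
    lem : ∀ n → 2 + (2 * n + suc n) ≡ 3 * suc n
    lem = solve-∀

  top-padding : n ≡ N → j ≤ 1
  top-padding refl = +-cancelʳ-≤ (3 * n) j 1 (begin
    j + 3 * n         ≡⟨ cong (j +_) (lem n) ⟩
    j + (2 * n + n)   ≤⟨ +-monoʳ-≤ j (+-monoʳ-≤ (2 * n) n≤k) ⟩
    j + (2 * n + k)   ≡⟨ total ⟩
    3 * n + 1         ≡⟨ +-comm (3 * n) 1 ⟩
    1 + 3 * n         ∎)
    where
    open ≤-Reasoning
    lem : ∀ n → 3 * n ≡ 2 * n + n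
    lem = solve-∀

  -- No padding means that the target has outgrown N: the chain of live words ends here.
  top-target : j ≡ 0 → suc N ≤ k
  top-target refl = +-cancelˡ-≤ (2 * N) (suc N) k (≤-reflexive (begin
    2 * N + suc N ≡⟨ lem N ⟩
    3 * N + 1     ≡⟨ sym total ⟩
    2 * n + k     ≡⟨ cong (λ m → 2 * m + k) (top-source z≤n) ⟩
    2 * N + k     ∎))
    where
    open ≡-Reasoning
    lem : ∀ N → 2 * N + suc N ≡ 3 * N + 1
    lem = solve-∀

padding-exists : ∀ {n k N} → k ≤ suc n → n ≤ N → Σ[ j ∈ ℕ ] j + (2 * n + k) ≡ 3 * N + 1
padding-exists {n} {k} {N} k≤n+1 n≤N = 3 * N + 1 ∸ (2 * n + k) , m∸n+n≡m (begin
  2 * n + k         ≤⟨ +-mono-≤ (*-monoʳ-≤ 2 n≤N) (≤-trans k≤n+1 (s≤s n≤N)) ⟩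
  2 * N + suc N     ≡⟨ lem N ⟩
  3 * N + 1         ∎)
  where
  open ≤-Reasoning
  lem : ∀ N → 2 * N + suc N ≡ 3 * N + 1
  lem = solve-∀

-- Live and dead words and their common order

module FromCL (M : BalancedNPTM) (A : LROrder) (eff : EfficientAdj A) where
  open BalancedNPTM M
  open LROrder A renaming (trans to <A-trans; total to <A-total; irrefl to <A-irrefl)
  open LengthRespecting A

  gA gV : Str → Str
  gA = proj₁ (proj₁ (proj₂ eff))
  gV = proj₁ V-poly

  gA⇔ : ∀ y z → (gA (pair y z) ≡ true ∷ []) ⇔ y ≺A z
  gA⇔ y z = mk⇔
    (λ e → Equivalence.to (proj₂ (proj₂ eff) y z) (proj₁ (∷-injective (trans (sym (proj₂ (proj₂ (proj₁ (proj₂ eff))) y z)) e))))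
    (λ a → trans (proj₂ (proj₂ (proj₁ (proj₂ eff))) y z) (cong (_∷ []) (Equivalence.from (proj₂ (proj₂ eff) y z) a)))

  Edge : Str → Set
  Edge v = IsPair (unpad v) × gA (unpad v) ≡ true ∷ []

  body source target : Str → Str
  body     = drop 1
  source u = left (unpad (body u))
  target u = right (unpad (body u))

  -- A live word 0 0^j 1 ⟨y, z⟩ with y ≺ z stands for y; all the other words are dead.
  Live : Str → Set
  Live u = u ≡ false ∷ body u × Edge (body u)

  ptdec-Edge : PTDec Edge
  ptdec-Edge = ptdec-× (ptdec-∘ ptdec-IsPair (pt-unpad pt-id)) (ptdec-pred₁ (pt-∘ (proj₁ (proj₂ (proj₁ (proj₂ eff)))) (pt-unpad pt-id)))

  ptdec-Live : PTDec Live
  ptdec-Live = ptdec-× (ptdec-≡ pt-id (pt-∷ false (pt-tail pt-id))) (ptdec-∘ ptdec-Edge (pt-tail pt-id))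

  open PTDec ptdec-Edge using () renaming (decide to edge?)
  open PTDec ptdec-Live using () renaming (decide to live?)

  edge-≺A : ∀ v → Edge v → left (unpad v) ≺A right (unpad v)
  edge-≺A v (p , e) = Equivalence.to (gA⇔ _ _) (trans (cong gA p) e)

  live-≺A : ∀ {u} → Live u → source u ≺A target u
  live-≺A {u} (_ , e) = edge-≺A (body u) e

  liveWord : ℕ → Str → Str → Str
  liveWord j y z = false ∷ zeros j ++ true ∷ pair y z

  source-liveWord : ∀ j y z → source (liveWord j y z) ≡ y
  source-liveWord j y z = trans (cong left (unpad-padded j (pair y z))) (left-pair y z)

  liveWord-Live : ∀ j {y z} → y ≺A z → Live (liveWord j y z)
  liveWord-Live j {y} {z} a = refl , subst IsPair (sym e) (cong₂ pair (left-pair y z) (right-pair y z)) , trans (cong gA e) (Equivalence.from (gA⇔ y z) a)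
    where
    e : unpad (zeros j ++ true ∷ pair y z) ≡ pair y z
    e = unpad-padded j (pair y z)

  live-form : ∀ {u} → Live u → Σ[ j ∈ ℕ ] u ≡ liveWord j (source u) (target u)
  live-form {u} (f , p , _) =
    -- A pair code is never empty, so the padding does end with a 1.
    let j , e = padded (body u) (λ ne → pair≢[] (source u) (target u) (trans p ne))
    in j , trans f (cong (false ∷_) (trans e (cong (λ v → zeros j ++ true ∷ v) (sym p))))

  length-liveWord : ∀ j y z → length (liveWord j y z) ≡ j + (2 * length y + length z) + 4
  length-liveWord j y z = trans (cong suc (trans (length-++ (zeros j)) (cong₂ (λ a b → a + suc b) (length-replicate j) (length-pair y z))))
    (lem j (length y) (length z))
    where
    lem : ∀ j n k → suc (j + suc (2 * n + 2 + k)) ≡ j + (2 * n + k) + 4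
    lem = solve-∀

  -- The value of the word with its first letter moved to the end. Thereby 0v and 1v become
  -- neighbours, and as 1v is always dead, at most one live word separates consecutive dead ones.
  jkey : Str → ℕ
  jkey []      = 0
  jkey (c ∷ v) = val v * 2 + digit c

  jkey-injective : ∀ u v → length u ≡ length v → jkey u ≡ jkey v → u ≡ v
  jkey-injective []          []          l e = refl
  jkey-injective (false ∷ u) (false ∷ v) l e = cong (false ∷_) (val-injective u v (suc-injective l) (*-cancelʳ-≡ _ _ 2 (+-cancelʳ-≡ 0 _ _ e)))
  jkey-injective (true ∷ u)  (true ∷ v)  l e = cong (true ∷_) (val-injective u v (suc-injective l) (*-cancelʳ-≡ _ _ 2 (+-cancelʳ-≡ 1 _ _ e)))
  jkey-injective (false ∷ u) (true ∷ v)  l e = ⊥-elim (2a≢2b+1 (val u) (val v) e)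
    where
    2a≢2b+1 : ∀ a b → a * 2 + 0 ≢ b * 2 + 1
    2a≢2b+1 (suc a) (suc b) e = 2a≢2b+1 a b (suc-injective (suc-injective e))
    2a≢2b+1 zero (suc b) ()
    2a≢2b+1 (suc a) zero ()
  jkey-injective (true ∷ u)  (false ∷ v) l e = sym (jkey-injective (false ∷ v) (true ∷ u) (sym l) (sym e))

  _⊏_ : Str → Str → Set
  u ⊏ v = (Live u × Live v × source u <A source v) ⊎ (Live u × ¬ Live v) ⊎ (¬ Live u × ¬ Live v × jkey u < jkey v)

  ⊏-irrefl : ∀ {u} → ¬ (u ⊏ u)
  ⊏-irrefl (inj₁ (_ , _ , l))        = <A-irrefl _ l
  ⊏-irrefl (inj₂ (inj₁ (l , d)))     = d l
  ⊏-irrefl (inj₂ (inj₂ (_ , _ , l))) = <-irrefl refl l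

  ⊏-trans : ∀ {u v w} → u ⊏ v → v ⊏ w → u ⊏ w
  ⊏-trans (inj₁ (a , b , l))        (inj₁ (_ , c , l′))        = inj₁ (a , c , <A-trans l l′)
  ⊏-trans (inj₁ (a , _ , _))        (inj₂ (inj₁ (_ , d)))      = inj₂ (inj₁ (a , d))
  ⊏-trans (inj₁ (_ , b , _))        (inj₂ (inj₂ (d , _ , _)))  = ⊥-elim (d b)
  ⊏-trans (inj₂ (inj₁ (_ , d)))     (inj₁ (b , _ , _))         = ⊥-elim (d b)
  ⊏-trans (inj₂ (inj₁ (_ , d)))     (inj₂ (inj₁ (b , _)))      = ⊥-elim (d b)
  ⊏-trans (inj₂ (inj₁ (a , _)))     (inj₂ (inj₂ (_ , d , _)))  = inj₂ (inj₁ (a , d))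
  ⊏-trans (inj₂ (inj₂ (_ , d , _))) (inj₁ (b , _ , _))         = ⊥-elim (d b)
  ⊏-trans (inj₂ (inj₂ (_ , d , _))) (inj₂ (inj₁ (b , _)))      = ⊥-elim (d b)
  ⊏-trans (inj₂ (inj₂ (a , _ , l))) (inj₂ (inj₂ (_ , c , l′))) = inj₂ (inj₂ (a , c , <-trans l l′))

  -- The source determines the target by uniqueness of successors, and then the total length
  -- determines the padding.
  source-injective : ∀ {u v} → length u ≡ length v → Live u → Live v → source u ≡ source v → u ≡ v
  source-injective {u} {v} l lu lv e = trans u≡ (trans (cong₂ (λ i z → liveWord i (source u) z) j≡ z≡)
      (trans (cong (λ y → liveWord j′ y (target v)) e) (sym v≡)))
    where
    j  = proj₁ (live-form lu)
    j′ = proj₁ (live-form lv)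
    u≡ : u ≡ liveWord j (source u) (target u)
    u≡ = proj₂ (live-form lu)
    v≡ : v ≡ liveWord j′ (source v) (target v)
    v≡ = proj₂ (live-form lv)
    z≡ : target u ≡ target v
    z≡ = ≺A-unique (live-≺A lu) (subst (_≺A target v) (sym e) (live-≺A lv))
    j≡ : j ≡ j′
    j≡ = +-cancelʳ-≡ (2 * length (source u) + length (target u)) j j′ (+-cancelʳ-≡ 4 _ _
      (trans (sym (length-liveWord j (source u) (target u))) (trans (cong length (sym u≡)) (trans l (trans (cong length v≡)
        (trans (length-liveWord j′ (source v) (target v)) (cong₂ (λ y z → j′ + (2 * length y + length z) + 4) (sym e) (sym z≡))))))))

  ⊏-compare : ∀ u v → length u ≡ length v → u ⊏ v ⊎ u ≡ v ⊎ v ⊏ u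
  ⊏-compare u v l = cases (live? u) (live? v)
    where
    cases : Dec (Live u) → Dec (Live v) → u ⊏ v ⊎ u ≡ v ⊎ v ⊏ u
    cases (yes a) (no d) = inj₁ (inj₂ (inj₁ (a , d)))
    cases (no d) (yes a) = inj₂ (inj₂ (inj₂ (inj₁ (a , d))))
    cases (yes a) (yes b) with compareA (source u) (source v)
    ... | inj₁ p        = inj₁ (inj₁ (a , b , p))
    ... | inj₂ (inj₁ e) = inj₂ (inj₁ (source-injective l a b e))
    ... | inj₂ (inj₂ p) = inj₂ (inj₂ (inj₁ (b , a , p)))
    cases (no c) (no d) with <-cmp (jkey u) (jkey v)
    ... | tri< p _ _ = inj₁ (inj₂ (inj₂ (c , d , p)))
    ... | tri≈ _ e _ = inj₂ (inj₁ (jkey-injective u v l e))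
    ... | tri> _ _ p = inj₂ (inj₂ (inj₂ (inj₂ (d , c , p))))

  Next : Str → Str → Set
  Next u v = num v ≡ suc (num u)

  -- From 0v to 1v; from 1v to 0w for the next tail w; and from 1v directly to 1w if 0w is live and
  -- has to be skipped.
  DeadNext : Str → Str → Set
  DeadNext u v = (u ≡ false ∷ body u × v ≡ true ∷ body u)
    ⊎ ((u ≡ true ∷ body u × v ≡ false ∷ body v) × Next (body u) (body v))
    ⊎ ((u ≡ true ∷ body u × v ≡ true ∷ body v) × Edge (body v) × Next (body u) (body v))

  -- The bound N does not occur: among words of the right length, a body that starts with 1 has no
  -- padding, and this marks the last live word. It is followed by 0...0, the least dead word.
  Adjacent : Str → Str → Set
  Adjacent u v = ((Live u × Live v) × source v ≡ target u)
    ⊎ ((Live u × body u ≡ true ∷ body (body u)) × v ≡ zeros (length v))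
    ⊎ ((¬ Live u × ¬ Live v) × DeadNext u v)

  ptdec-Adjacent : PTDec (λ z → Adjacent (left (right z)) (right (right z)))
  ptdec-Adjacent = ptdec-⊎ (ptdec-× (ptdec-× lu lv) (ptdec-≡ (pt-left (pt-unpad bv)) (pt-right (pt-unpad bu))))
    (ptdec-⊎ (ptdec-× (ptdec-× lu (ptdec-≡ bu (pt-∷ true (pt-tail bu)))) (ptdec-≡ v (pt-fill false v)))
      (ptdec-× (ptdec-× (ptdec-¬ lu) (ptdec-¬ lv))
        (ptdec-⊎ (ptdec-× (ptdec-≡ u (pt-∷ false bu)) (ptdec-≡ v (pt-∷ true bu)))
        (ptdec-⊎ (ptdec-× (ptdec-× (ptdec-≡ u (pt-∷ true bu)) (ptdec-≡ v (pt-∷ false bv))) (ptdec-next bu bv))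
                 (ptdec-× (ptdec-× (ptdec-≡ u (pt-∷ true bu)) (ptdec-≡ v (pt-∷ true bv))) (ptdec-× (ptdec-∘ ptdec-Edge bv) (ptdec-next bu bv)))))))
    where
    u : PolyTimeFun (λ z → left (right z))
    u = pt-left (pt-right pt-id)
    v : PolyTimeFun (λ z → right (right z))
    v = pt-right (pt-right pt-id)
    bu : PolyTimeFun (λ z → body (left (right z)))
    bu = pt-tail u
    bv : PolyTimeFun (λ z → body (right (right z)))
    bv = pt-tail v
    lu : PTDec (λ z → Live (left (right z)))
    lu = ptdec-∘ ptdec-Live u
    lv : PTDec (λ z → Live (right (right z)))
    lv = ptdec-∘ ptdec-Live v

  zeros-dead : ∀ n → ¬ Live (zeros n)
  zeros-dead zero    (() , _)
  zeros-dead (suc n) (_ , p , _) = pair≢[] (left (unpad (zeros n))) (right (unpad (zeros n))) (trans p (unpad-zeros n))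

  jkey-zeros : ∀ n → jkey (zeros n) ≡ 0
  jkey-zeros zero    = refl
  jkey-zeros (suc n) = cong (λ k → k * 2 + 0) (val-zeros n)

  module Words (N : ℕ) where

    opaque
      -- The leading bit, the delimiter of the padding, the separator 01 and the letters of ⟨y, z⟩
      -- make 1 + 1 + 2 + 2N + (N + 1) for the longest case |y| = N, |z| = N + 1.
      size : ℕ
      size = 5 + (N + (N + N))

      size≡ : size ≡ 5 + (N + (N + N))
      size≡ = refl

    module Lengths {u : Str} (l : length u ≡ size) (lu : Live u) where
      j : ℕ
      j = proj₁ (live-form lu)
      u≡ : u ≡ liveWord j (source u) (target u)
      u≡ = proj₂ (live-form lu)
      total : j + (2 * length (source u) + length (target u)) ≡ 3 * N + 1
      total = +-cancelʳ-≡ 4 _ _ (trans (sym (length-liveWord j (source u) (target u))) (trans (cong length (sym u≡)) (trans l (trans size≡ (lem N)))))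
        where
        lem : ∀ N → 5 + (N + (N + N)) ≡ 3 * N + 1 + 4
        lem = solve-∀
      open Padding {j} {length (source u)} {length (target u)} {N} total (proj₁ (≺A-length (live-≺A lu))) (proj₂ (≺A-length (live-≺A lu))) public

    live-exists : ∀ y → length y ≤ N → Σ[ u ∈ Str ] length u ≡ size × Live u × source u ≡ y
    live-exists y ly =
      let z , a = successor y
          j , e = padding-exists {length y} {length z} {N} (proj₂ (≺A-length a)) ly
      in liveWord j y z , trans (length-liveWord j y z) (trans (cong (_+ 4) e) (trans (lem N) (sym size≡))) , liveWord-Live j a , source-liveWord j y z
      where
      lem : ∀ N → 3 * N + 1 + 4 ≡ 5 + (N + (N + N))
      lem = solve-∀

    -- Immediate succession is restricted to words of length `size`, because `_⊏_` is total only
    -- between words of equal length.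
    _⊏̇_ : Str → Str → Set
    u ⊏̇ v = u ⊏ v × (∀ w → length w ≡ size → u ⊏ w → ¬ (w ⊏ v))

    next-value : ∀ u v → length u ≡ length v → Next u v → val v ≡ suc (val u)
    next-value u v l e = +-cancelˡ-≡ (2 ^ length v) _ _ (trans e (trans (cong (λ n → suc (2 ^ n + val u)) l) (sym (+-suc _ _))))

    value-next : ∀ u v → length v ≡ length u → val v ≡ suc (val u) → Next u v
    value-next u v l e = trans (cong₂ (λ n k → 2 ^ n + k) l e) (+-suc _ _)

    below-live : ∀ {u v} → u ⊏ v → Live v → Live u × source u <A source v
    below-live (inj₁ (a , _ , l))        b = a , l
    below-live (inj₂ (inj₁ (_ , d)))     b = ⊥-elim (d b)
    below-live (inj₂ (inj₂ (_ , d , _))) b = ⊥-elim (d b)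

    above-dead : ∀ {u v} → u ⊏ v → ¬ Live u → ¬ Live v × jkey u < jkey v
    above-dead (inj₁ (a , _ , l))        d = ⊥-elim (d a)
    above-dead (inj₂ (inj₁ (a , _)))     d = ⊥-elim (d a)
    above-dead (inj₂ (inj₂ (_ , e , l))) d = e , l

    below-dead : ∀ {u v} → u ⊏ v → ¬ Live u → ¬ Live v → jkey u < jkey v
    below-dead l d _ = proj₂ (above-dead l d)

    -- The dead words form a final segment, so only dead words can come between two of them.
    dead-adjacent : ∀ {u v} → ¬ Live u → ¬ Live v → jkey u < jkey v → (∀ w → length w ≡ size → ¬ Live w → jkey u < jkey w → ¬ (jkey w < jkey v)) → u ⊏̇ v
    dead-adjacent {u} {v} d e l none = inj₂ (inj₂ (d , e , l)) , λ w lw p q →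
      let dw , p′ = above-dead {u} {w} p d in none w lw dw p′ (below-dead {w} {v} q dw e)

    dead-covers : ∀ u v → length u ≡ size → length v ≡ size → ¬ Live u → ¬ Live v → DeadNext u v → u ⊏̇ v
    dead-covers u v lu lv d e (inj₁ (u≡ , v≡)) = dead-adjacent d e (≤-reflexive (sym key≡)) λ w _ _ p q → <⇒≱ q (subst (_≤ jkey w) (sym key≡) p)
      where
      key≡ : jkey v ≡ suc (jkey u)
      key≡ = trans (cong jkey v≡) (trans (+-suc (val (body u) * 2) 0) (cong suc (sym (cong jkey u≡))))
    dead-covers u v lu lv d e (inj₂ (inj₁ ((u≡ , v≡) , n))) = dead-adjacent d e (≤-reflexive (sym key≡)) λ w _ _ p q → <⇒≱ q (subst (_≤ jkey w) (sym key≡) p)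
      where
      bodies : length (body u) ≡ length (body v)
      bodies = suc-injective (trans (cong length (sym u≡)) (trans (trans lu (sym lv)) (cong length v≡)))
      key≡ : jkey v ≡ suc (jkey u)
      key≡ = trans (cong jkey v≡) (trans (cong (λ k → k * 2 + 0) (next-value (body u) (body v) bodies n))
        (trans (lem (val (body u))) (cong suc (sym (cong jkey u≡)))))
        where
        lem : ∀ a → suc a * 2 + 0 ≡ suc (a * 2 + 1)
        lem = solve-∀
    dead-covers u v lu lv d e (inj₂ (inj₂ ((u≡ , v≡) , edge , n))) =
      dead-adjacent d e (≤-trans (n<1+n _) (≤-trans (n≤1+n _) (≤-reflexive (sym key≡)))) none
      where
      bodies : length (body u) ≡ length (body v)
      bodies = suc-injective (trans (cong length (sym u≡)) (trans (trans lu (sym lv)) (cong length v≡)))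
      key≡ : jkey v ≡ suc (suc (jkey u))
      key≡ = trans (cong jkey v≡) (trans (cong (λ k → k * 2 + 1) (next-value (body u) (body v) bodies n))
        (cong (2 +_) (sym (cong jkey u≡))))
      -- The keys of u and v differ by 2; the single key between them belongs to a word that is live
      -- by `edge`.
      skipped : jkey (false ∷ body v) ≡ suc (jkey u)
      skipped = suc-injective (trans (sym (trans (cong jkey v≡) (+-suc (val (body v) * 2) 0))) key≡)
      none : ∀ w → length w ≡ size → ¬ Live w → jkey u < jkey w → ¬ (jkey w < jkey v)
      none w lw dw p q = dw (subst Live (sym w≡) (refl , edge))
        where
        w≡ : w ≡ false ∷ body v
        w≡ = jkey-injective w (false ∷ body v) (trans lw (trans (sym lv) (cong length v≡)))
          (trans (≤-antisym (s≤s⁻¹ (subst (jkey w <_) key≡ q)) p) (sym skipped))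

    adjacent-covers : ∀ u v → length u ≡ size → length v ≡ size → Adjacent u v → u ⊏̇ v
    adjacent-covers u v lu lv (inj₁ ((a , b) , e)) = inj₁ (a , b , proj₁ u≺v) , λ w _ p q →
      let c , q′ = below-live q b
          _ , p′ = below-live p c
      in proj₂ u≺v (source w , p′ , q′)
      where
      u≺v : source u ≺A source v
      u≺v = subst (source u ≺A_) (sym e) (live-≺A a)
    adjacent-covers u v lu lv (inj₂ (inj₁ ((a , starts) , v≡))) = inj₂ (inj₁ (a , dead)) , none
      where
      dead : ¬ Live v
      dead = subst (λ v → ¬ Live v) (sym v≡) (zeros-dead (length v))
      module U = Lengths lu a
      j≡0 : U.j ≡ 0
      j≡0 = starts-true U.j (trans (sym (cong body U.u≡)) starts)
        where
        starts-true : ∀ j {w w′} → zeros j ++ w ≡ true ∷ w′ → j ≡ 0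
        starts-true zero e = refl
      none : ∀ w → length w ≡ size → u ⊏ w → ¬ (w ⊏ v)
      none w lw p (inj₁ (_ , b , _)) = dead b
      -- A live word above u would have a source at or above the target of u, hence longer than N.
      none w lw p (inj₂ (inj₁ (c , _))) = <⇒≱ (≤-trans (U.top-target j≡0) (≤A⇒length≤ (≺A-least (live-≺A a) (proj₂ (below-live p c))))) (Lengths.source≤ lw c)
      none w lw p (inj₂ (inj₂ (_ , _ , l))) = case subst (jkey w <_) (trans (cong jkey v≡) (jkey-zeros (length v))) l of λ ()
    adjacent-covers u v lu lv (inj₂ (inj₂ ((d , e) , n))) = dead-covers u v lu lv d e n

    -- A live word with padding is followed by the word of its target, the last live one by 0...0, a
    -- dead 0v by 1v, and 1v by a word with the incremented tail; only 1...1 admits no increment.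
    adjacent-exists : ∀ u → length u ≡ size → u ≡ ones size ⊎ Σ[ v ∈ Str ] length v ≡ size × Adjacent u v
    adjacent-exists u lu = by (live? u)
      where
      from-live : (a : Live u) → Σ[ v ∈ Str ] length v ≡ size × Adjacent u v
      from-live a = go U.j refl
        where
        module U = Lengths lu a
        go : ∀ j → U.j ≡ j → Σ[ v ∈ Str ] length v ≡ size × Adjacent u v
        go zero e = zeros size , length-replicate size , inj₂ (inj₁ ((a , trans body≡ (cong (true ∷_) (sym (cong body body≡)))) , cong zeros (sym (length-replicate size))))
          where
          body≡ : body u ≡ true ∷ pair (source u) (target u)
          body≡ = trans (cong body U.u≡) (cong (λ j → zeros j ++ true ∷ pair (source u) (target u)) e)
        go (suc j) e =
          let v , lv , b , s = live-exists (target u) (U.target≤ (subst (1 ≤_) (sym e) (s≤s z≤n)))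
          in v , lv , inj₁ ((a , b) , s)
      from-dead : ∀ w → w ≡ u → ¬ Live u → u ≡ ones size ⊎ Σ[ v ∈ Str ] length v ≡ size × Adjacent u v
      from-dead []          refl d = case trans lu size≡ of λ ()
      from-dead (false ∷ w) refl d = inj₂ (true ∷ w , lu , inj₂ (inj₂ ((d , λ (e , _) → case e of λ ()) , inj₁ (refl , refl))))
      from-dead (true ∷ w)  refl d = Sum.[ (λ e → inj₁ (trans (cong (true ∷_) e) (cong ones lu))) , (λ (v , l , n , _) → inj₂ (choose v l n (edge? v))) ]′ (increment w)
        where
        choose : ∀ v → length v ≡ length w → val v ≡ suc (val w) → Dec (Edge v) → Σ[ v ∈ Str ] length v ≡ size × Adjacent u v
        choose v l n (yes e) = true ∷ v , trans (cong suc l) lu , inj₂ (inj₂ ((d , λ (e , _) → case e of λ ()) , inj₂ (inj₂ ((refl , refl) , e , value-next w v l n))))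
        choose v l n (no ¬e) = false ∷ v , trans (cong suc l) lu , inj₂ (inj₂ ((d , λ (_ , e) → ¬e e) , inj₂ (inj₁ ((refl , refl) , value-next w v l n))))
      by : Dec (Live u) → u ≡ ones size ⊎ Σ[ v ∈ Str ] length v ≡ size × Adjacent u v
      by (yes a) = inj₂ (from-live a)
      by (no d)  = from-dead u refl d

    ones-dead : ∀ n → ¬ Live (ones n)
    ones-dead zero    (() , _)
    ones-dead (suc n) (() , _)

    jkey-ones : ∀ u n → length u ≡ n → jkey u ≤ jkey (ones n)
    jkey-ones []      zero    l = z≤n
    jkey-ones (c ∷ u) (suc n) l = +-mono-≤ (*-monoˡ-≤ 2 (s≤s⁻¹ (≤-trans (val< u) (≤-reflexive (trans (cong (2 ^_) (suc-injective l)) (sym (val-ones n))))))) (digit≤1 c)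
      where
      digit≤1 : ∀ c → digit c ≤ 1
      digit≤1 false = z≤n
      digit≤1 true  = ≤-refl

    ones-greatest : ∀ u → length u ≡ size → u ≢ ones size → u ⊏ ones size
    ones-greatest u l ne = Sum.[ id , Sum.[ (λ e → ⊥-elim (ne e)) , (λ p → ⊥-elim (above p)) ]′ ]′ (⊏-compare u (ones size) (trans l (sym (length-replicate size))))
      where
      above : ones size ⊏ u → ⊥
      above p = <⇒≱ (proj₂ (above-dead {ones size} {u} p (ones-dead size))) (jkey-ones u size l)

    -- Completeness again comes from existence: u has some adjacent word, which covers u by
    -- `adjacent-covers`, and in a total order a cover is unique.
    covers-adjacent : ∀ u v → length u ≡ size → length v ≡ size → u ⊏̇ v → Adjacent u v
    covers-adjacent u v lu lv (p , none) = Sum.[ top , step ]′ (adjacent-exists u lu)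
      where
      top : u ≡ ones size → Adjacent u v
      top refl = Sum.[ (λ q → ⊥-elim (⊏-irrefl (⊏-trans p q))) , Sum.[ (λ e → ⊥-elim (⊏-irrefl (subst (u ⊏_) e p))) , (λ q → ⊥-elim (below-top q)) ]′ ]′ (⊏-compare v u (trans lv (sym lu)))
        where
        below-top : u ⊏ v → ⊥
        below-top q = <⇒≱ (proj₂ (above-dead {ones size} {v} q (ones-dead size))) (jkey-ones v size lv)
      step : Σ[ w ∈ Str ] length w ≡ size × Adjacent u w → Adjacent u v
      step (w , lw , a) = Sum.[ (λ q → ⊥-elim (none w lw (proj₁ c) q)) , Sum.[ (λ e → subst (Adjacent u) e a) , (λ q → ⊥-elim (proj₂ c v lv p q)) ]′ ]′ (⊏-compare w v (trans lw (sym lv)))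
        where
        c : u ⊏̇ w
        c = adjacent-covers u w lu lw a

    -- ε is least in `A`, and its successor is a single letter that does not depend on x. With |y| =
    -- 0 and |z| = 1 the padding is 3N, so the whole word is easy to compute.
    first : Str
    first = liveWord (3 * N) [] (proj₁ (successor []))

    first-Live : Live first
    first-Live = liveWord-Live (3 * N) (proj₂ (successor []))

    length-first : length first ≡ size
    length-first = trans (length-liveWord (3 * N) [] (proj₁ (successor []))) (trans (cong (λ k → 3 * N + (2 * 0 + k) + 4) z≡) (trans (lem N) (sym size≡)))
      where
      z≡ : length (proj₁ (successor [])) ≡ 1
      z≡ = one (proj₁ (successor [])) (proj₂ (successor []))
        where
        one : ∀ z → [] ≺A z → length z ≡ 1
        one []      (l , _) = ⊥-elim (<A-irrefl [] l)
        one (b ∷ z) a       = ≤-antisym (proj₂ (≺A-length a)) (s≤s z≤n)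
      lem : ∀ N → 3 * N + (2 * 0 + 1) + 4 ≡ 5 + (N + (N + N))
      lem = solve-∀

    first-least : ∀ u → length u ≡ size → first ≢ u → first ⊏ u
    first-least u l ne = Sum.[ id , Sum.[ (λ e → ⊥-elim (ne e)) , (λ p → ⊥-elim (below p)) ]′ ]′ (⊏-compare first u (trans length-first (sym l)))
      where
      no-smaller : ∀ y → ¬ (y <A [])
      no-smaller []      q = <A-irrefl [] q
      no-smaller (b ∷ y) q = <A-irrefl [] (<A-trans (length-respecting [] (b ∷ y) (s≤s z≤n)) q)
      below : u ⊏ first → ⊥
      below p = no-smaller (source u) (subst (source u <A_) (source-liveWord (3 * N) [] (proj₁ (successor []))) (proj₂ (below-live p first-Live)))

-- The machine, the bijections and the accepting interval

module Assemble (M : BalancedNPTM) (A : LROrder) (eff : EfficientAdj A) where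
  open BalancedNPTM M
  open LROrder A using (_<A_; _≺A_) renaming (irrefl to <A-irrefl; trans to <A-trans)
  open LengthRespecting A
  open FromCL M A eff

  p′ : Poly
  p′ = (5 ∷ []) ⊞ (p ⊞ (p ⊞ p))

  eval-3p : ∀ n → eval (p ⊞ (p ⊞ p)) n ≡ 3 * eval p n
  eval-3p n = trans (eval-⊞ p (p ⊞ p) n) (trans (cong (eval p n +_) (eval-⊞ p p n)) (lem (eval p n)))
    where
    lem : ∀ a → a + (a + a) ≡ 3 * a
    lem = solve-∀

  eval-p′ : ∀ x → Words.size (m x) ≡ eval p′ (length x)
  eval-p′ x = trans (Words.size≡ (m x)) (trans (lem (length x) (m x)) (sym (trans (eval-⊞ (5 ∷ []) (p ⊞ (p ⊞ p)) (length x)) (cong (5 + length x * 0 +_) (eval-3p (length x))))))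
    where
    lem : ∀ n a → 5 + (a + (a + a)) ≡ 5 + n * 0 + 3 * a
    lem = solve-∀

  -- A padding of at most one zero singles out the sources of length p(|x|).
  Final : Str → Set
  Final u = body u ≡ true ∷ body (body u) ⊎ body u ≡ false ∷ true ∷ body (body (body u))

  Accepted : Str → Set
  Accepted z = (Live (right z) × Final (right z)) × gV (pair (left z) (source (right z))) ≡ true ∷ []

  ptdec-Accepted : PTDec Accepted
  ptdec-Accepted = ptdec-×
    (ptdec-× (ptdec-∘ ptdec-Live r) (ptdec-⊎ (ptdec-≡ br (pt-∷ true (pt-tail br))) (ptdec-≡ br (pt-∷ false (pt-∷ true (pt-tail (pt-tail br)))))))
    (ptdec-pred₁ (pt-∘ (proj₁ (proj₂ V-poly)) (pt-pair (pt-left pt-id) (pt-left (pt-unpad br)))))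
    where
    r : PolyTimeFun right
    r = pt-right pt-id
    br : PolyTimeFun (body ∘ right)
    br = pt-tail r

  M′ : BalancedNPTM
  M′ = record { p = p′ ; V = λ x u → test (pair x u) ; V-poly = (λ z → test z ∷ []) , poly , λ _ _ → refl }
    where open PTDec ptdec-Accepted

  module M′ = BalancedNPTM M′

  module _ (x : Str) where
    open Words (m x)

    length-path′ : (w : M′.Path x) → length (toList w) ≡ size
    length-path′ w = trans (length-toList w) (sym (eval-p′ x))

    path′ : ∀ u → length u ≡ size → M′.Path x
    path′ u l = vec u (trans l (eval-p′ x))

    toList-path′ : ∀ u l → toList (path′ u l) ≡ u
    toList-path′ u l = toList-vec u (trans l (eval-p′ x))

    _<ₒ_ : M′.Path x → M′.Path x → Set
    v <ₒ w = toList v ⊏ toList w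

    compareₒ : ∀ v w → v <ₒ w ⊎ v ≡ w ⊎ w <ₒ v
    compareₒ v w = Sum.map₂ (Sum.map₁ toList-inj) (⊏-compare (toList v) (toList w) (trans (length-path′ v) (sym (length-path′ w))))

    open Rank _<ₒ_ (λ {v} → ⊏-irrefl {toList v}) (λ {u} {v} {w} → ⊏-trans {toList u} {toList v} {toList w}) compareₒ public

    Sourced : Str → Path x → Set
    Sourced u v = Live u × source u ≡ toList v

    Accepted⇒ : ∀ u → length u ≡ size → (Live u × Final u) × gV (pair x (source u)) ≡ true ∷ [] → Σ[ v ∈ Path x ] Sourced u v × Acc x v
    Accepted⇒ u l ((a , final) , g) = v , (a , sym (toList-vec (source u) ls)) ,
        proj₁ (∷-injective (trans (sym (proj₂ (proj₂ V-poly) x (toList v))) (trans (cong (gV ∘ pair x) (toList-vec (source u) ls)) g)))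
      where
      module U = Lengths l a
      small : ∀ j → U.j ≡ j → j ≤ 1
      small zero          _ = z≤n
      small (suc zero)    _ = s≤s z≤n
      small (suc (suc j)) e = ⊥-elim (absurd final)
        where
        body≡ : body u ≡ false ∷ false ∷ zeros j ++ true ∷ pair (source u) (target u)
        body≡ = trans (cong body U.u≡) (cong (λ j → zeros j ++ true ∷ pair (source u) (target u)) e)
        absurd : ¬ Final u
        absurd (inj₁ f) = case trans (sym body≡) f of λ ()
        absurd (inj₂ f) = case trans (sym body≡) f of λ ()
      ls : length (source u) ≡ m x
      ls = U.top-source (small U.j refl)
      v : Path x
      v = vec (source u) ls

    ⇒Accepted : ∀ u v → length u ≡ size → Sourced u v → Acc x v → (Live u × Final u) × gV (pair x (source u)) ≡ true ∷ []
    ⇒Accepted u v l (a , s) acc = (a , final U.j refl (U.top-padding (trans (cong length s) (length-toList v)))) ,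
        trans (cong (gV ∘ pair x) s) (trans (proj₂ (proj₂ V-poly) x (toList v)) (cong (_∷ []) acc))
      where
      module U = Lengths l a
      body≡ : ∀ {j} → U.j ≡ j → body u ≡ zeros j ++ true ∷ pair (source u) (target u)
      body≡ e = trans (cong body U.u≡) (cong (λ j → zeros j ++ true ∷ pair (source u) (target u)) e)
      final : ∀ j → U.j ≡ j → j ≤ 1 → Final u
      final zero       e _ = inj₁ (trans (body≡ e) (cong (true ∷_) (sym (cong body (body≡ e)))))
      final (suc zero) e _ = inj₂ (trans (body≡ e) (cong (λ w → false ∷ true ∷ w) (sym (cong (body ∘ body) (body≡ e)))))
      final (suc (suc j)) e (s≤s ())

    acc′⇒ : ∀ w → M′.Acc x w → Σ[ v ∈ Path x ] Sourced (toList w) v × Acc x v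
    acc′⇒ w a = Accepted⇒ (toList w) (length-path′ w)
      (subst₂ (λ y u → (Live u × Final u) × gV (pair y (source u)) ≡ true ∷ []) (left-pair x (toList w)) (right-pair x (toList w))
        (PTDec.sound ptdec-Accepted (pair x (toList w)) a))

    ⇒acc′ : ∀ w v → Sourced (toList w) v → Acc x v → M′.Acc x w
    ⇒acc′ w v s a = PTDec.complete ptdec-Accepted (pair x (toList w))
      (subst₂ (λ y u → (Live u × Final u) × gV (pair y (source u)) ≡ true ∷ []) (sym (left-pair x (toList w))) (sym (right-pair x (toList w)))
        (⇒Accepted (toList w) v (length-path′ w) s a))

    sourced-exists : ∀ v → Σ[ w ∈ M′.Path x ] Sourced (toList w) v
    sourced-exists v =
      let u , l , a , s = live-exists (toList v) (≤-reflexive (length-toList v))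
      in path′ u l , subst (λ u → Sourced u v) (sym (toList-path′ u l)) (a , s)

    sourced-injective : ∀ {w w′ v} → Sourced (toList w) v → Sourced (toList w′) v → w ≡ w′
    sourced-injective {w} {w′} (a , s) (a′ , s′) =
      toList-inj (source-injective (trans (length-path′ w) (sym (length-path′ w′))) a a′ (trans s (sym s′)))

    -- Each path of `M` is the source of exactly one live word of the given length, and acceptance
    -- carries over both ways.
    #acc≡ : #acc M x ≡ #acc M′ x
    #acc≡ = ≤-antisym
      (countVecs-≤ (λ v → V x (toList v) ≟B true) (λ w → M′.V x (toList w) ≟B true)
        (λ {v} _ → proj₁ (sourced-exists v)) (λ {v} a → ⇒acc′ _ v (proj₂ (sourced-exists v)) a)
        (λ {v} {v′} _ _ e → toList-inj (trans (sym (proj₂ (proj₂ (sourced-exists v)))) (trans (cong (source ∘ toList) e) (proj₂ (proj₂ (sourced-exists v′)))))))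
      (countVecs-≤ (λ w → M′.V x (toList w) ≟B true) (λ v → V x (toList v) ≟B true)
        (λ {w} a → proj₁ (acc′⇒ w a)) (λ {w} a → proj₂ (proj₂ (acc′⇒ w a)))
        (λ {w} {w′} a a′ e → sourced-injective {w} {w′} (proj₁ (proj₂ (acc′⇒ w a))) (subst (Sourced (toList w′)) (sym e) (proj₁ (proj₂ (acc′⇒ w′ a′))))))

    _≈_ : Path x → Path x → Set
    _≈_ = _≡AMx_ A M x

    module _ (y₀ : Path x) (acc⇔ : ∀ w → Acc x w ⇔ w ≈ y₀) where

      -- A chain of adjacent words cannot jump over v.
      chain-meets : ∀ {a c} v → a ≈ c → a ≈ y₀ → toList a ≤A toList v → toList v <A toList c → Acc x v
      chain-meets v Star.ε r a≤v v<c = ⊥-elim (Sum.[ (λ l → <A-irrefl _ (<A-trans l v<c)) , (λ e → <A-irrefl _ (subst (_<A _) (sym e) v<c)) ]′ a≤v)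
      chain-meets {a} v (_ Star.◅ chain) r (inj₂ e) v<c = Equivalence.from (acc⇔ v) (subst (_≈ y₀) (toList-inj e) r)
      chain-meets {a} v (_◅_ {j = a′} s chain) r (inj₁ a<v) v<c = chain-meets v chain (EqC.symmetric _ (s ◅ Star.ε) Star.◅◅ r) (advance s) v<c
        where
        -- A step up from a leads to its successor, which is at most v; a step down stays below v.
        up : ∀ {b} → (toList a ≺A b ⊎ b ≺A toList a) → b ≤A toList v
        up (inj₁ l)       = ≺A-least l a<v
        up (inj₂ (l , _)) = inj₁ (<A-trans l a<v)
        advance : SymClosure (_∼_ A M x) a a′ → toList a′ ≤A toList v
        advance (fwd (l , _)) = up l
        advance (bwd (l , _)) = up (Sum.swap l)

      convex : ∀ {a c} v → Acc x a → Acc x c → toList a <A toList v → toList v <A toList c → Acc x v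
      convex {a} {c} v aa ac l l′ =
        let ra = Equivalence.to (acc⇔ a) aa
            rc = Equivalence.to (acc⇔ c) ac
        in chain-meets v (ra Star.◅◅ EqC.symmetric _ rc) ra (inj₁ l) l′

      -- Everything below a live word is live, and the source of w is squeezed between two sources
      -- of length p(|x|). So it has that length, is a path of `M`, and `convex` applies to it.
      convex′ : ∀ ℓ u w → M′.Acc x ℓ → M′.Acc x u → ℓ <ₒ w → w <ₒ u → M′.Acc x w
      convex′ ℓ u w aℓ au l l′ = ⇒acc′ w v (live , sym v≡) (convex v (proj₂ (proj₂ ℓ′)) (proj₂ (proj₂ u′)) lower upper)
        where
        ℓ′ = acc′⇒ ℓ aℓ
        u′ = acc′⇒ u au
        live : Live (toList w)
        live = proj₁ (below-live l′ (proj₁ (proj₁ (proj₂ u′))))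
        lower′ : source (toList ℓ) <A source (toList w)
        lower′ = proj₂ (below-live l live)
        upper′ : source (toList w) <A source (toList u)
        upper′ = proj₂ (below-live l′ (proj₁ (proj₁ (proj₂ u′))))
        len : ∀ {y} {v : Path x} → y ≡ toList v → length y ≡ m x
        len {v = v} e = trans (cong length e) (length-toList v)
        lw : length (source (toList w)) ≡ m x
        lw = ≤-antisym (≤-trans (<A⇒length≤ upper′) (≤-reflexive (len {v = proj₁ u′} (proj₂ (proj₁ (proj₂ u′))))))
                       (≤-trans (≤-reflexive (sym (len {v = proj₁ ℓ′} (proj₂ (proj₁ (proj₂ ℓ′)))))) (<A⇒length≤ lower′))
        v : Path x
        v = vec (source (toList w)) lw
        v≡ : toList v ≡ source (toList w)
        v≡ = toList-vec (source (toList w)) lw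
        lower : toList (proj₁ ℓ′) <A toList v
        lower = subst₂ _<A_ (proj₂ (proj₁ (proj₂ ℓ′))) (sym v≡) lower′
        upper : toList v <A toList (proj₁ u′)
        upper = subst₂ _<A_ (sym v≡) (proj₂ (proj₁ (proj₂ u′))) upper′

    -- The ends are the accepting paths of least and greatest image under `h`; `convex′` fills the
    -- space between them.
    interval : AccIsCluster A M x → #acc M′ x ≢ 0 →
      Σ[ ℓ ∈ M′.Path x ] Σ[ u ∈ M′.Path x ] ∀ w → M′.Acc x w ⇔ (h ℓ ≤lex h w × h w ≤lex h u)
    interval (inj₁ none) ne =
      let w , a = countVecs-≢0 (λ w → M′.V x (toList w) ≟B true) ne
          v , _ , a′ = acc′⇒ w a
      in ⊥-elim (none v a′)
    interval (inj₂ (y₀ , _ , acc⇔)) ne = both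
        (Sum.[ (λ none → ⊥-elim (none (allVecs-∈ w₀) a₀)) , id ]′ (extremum acc? _⊑_ (λ {a} {b} {c} → ⊑-trans {a} {b} {c}) ⊑-total (allVecs (M′.m x))))
        (Sum.[ (λ none → ⊥-elim (none (allVecs-∈ w₀) a₀)) , id ]′ (extremum acc? (λ a b → b ⊑ a) (λ {a} {b} {c} p q → ⊑-trans {c} {b} {a} q p) (λ a b → ⊑-total b a) (allVecs (M′.m x))))
      where
      _⊑_ : M′.Path x → M′.Path x → Set
      a ⊑ b = value (h a) ≤ value (h b)
      ⊑-trans : ∀ {a b c} → a ⊑ b → b ⊑ c → a ⊑ c
      ⊑-trans = ≤-trans
      ⊑-total : ∀ a b → a ⊑ b ⊎ b ⊑ a
      ⊑-total a b = ≤-total (value (h a)) (value (h b))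
      acc? : Decidable (M′.Acc x)
      acc? w = M′.V x (toList w) ≟B true
      w₀ : M′.Path x
      w₀ = proj₁ (countVecs-≢0 acc? ne)
      a₀ : M′.Acc x w₀
      a₀ = proj₂ (countVecs-≢0 acc? ne)
      both : Σ[ ℓ ∈ M′.Path x ] M′.Acc x ℓ × (∀ {b} → b ∈ allVecs (M′.m x) → M′.Acc x b → ℓ ⊑ b) →
             Σ[ u ∈ M′.Path x ] M′.Acc x u × (∀ {b} → b ∈ allVecs (M′.m x) → M′.Acc x b → b ⊑ u) →
             Σ[ ℓ ∈ M′.Path x ] Σ[ u ∈ M′.Path x ] ∀ w → M′.Acc x w ⇔ (h ℓ ≤lex h w × h w ≤lex h u)
      both (ℓ , aℓ , min) (u , au , max) = ℓ , u , λ w → mk⇔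
        (λ a → value≤⇒≤lex {v = h ℓ} {h w} (min {w} (allVecs-∈ w) a) , value≤⇒≤lex {v = h w} {h u} (max {w} (allVecs-∈ w) a))
        (λ (p , q) → between w p q)
        where
        between : ∀ w → h ℓ ≤lex h w → h w ≤lex h u → M′.Acc x w
        between w (inj₂ e) _        = subst (M′.Acc x) (h-injective {ℓ} {w} e) aℓ
        between w (inj₁ _) (inj₂ e) = subst (M′.Acc x) (sym (h-injective {w} {u} e)) au
        between w (inj₁ p) (inj₁ q) = convex′ y₀ acc⇔ ℓ u w aℓ au (h-reflects {ℓ} {w} (<lex⇒value< p)) (h-reflects {w} {u} (<lex⇒value< q))

    ≺ₒ⇒⊏̇ : ∀ {v w} → v ≺ₒ w → toList v ⊏̇ toList w
    ≺ₒ⇒⊏̇ {v} {w} (l , none) = l , λ u lu p q → none (path′ u lu)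
      (subst (toList v ⊏_) (sym (toList-path′ u lu)) p) (subst (_⊏ toList w) (sym (toList-path′ u lu)) q)

    ⊏̇⇒≺ₒ : ∀ {v w} → toList v ⊏̇ toList w → v ≺ₒ w
    ⊏̇⇒≺ₒ (l , none) = l , λ u → none (toList u) (length-path′ u)

    bottom : Σ[ b′ ∈ M′.Path x ] toList b′ ≡ first × h b′ ≡ Vec.replicate (M′.m x) false
    bottom = b′ , b′≡ , bottom-value λ w ne → subst (_⊏ toList w) (sym b′≡) (first-least (toList w) (length-path′ w) λ e → ne (toList-inj (trans b′≡ e)))
      where
      b′ = path′ first length-first
      b′≡ : toList b′ ≡ first
      b′≡ = toList-path′ first length-first

    top : Σ[ t′ ∈ M′.Path x ] toList t′ ≡ ones size × h t′ ≡ Vec.replicate (M′.m x) true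
    top = t′ , t′≡ , top-value λ w ne → subst (toList w ⊏_) (sym t′≡) (ones-greatest (toList w) (length-path′ w) λ e → ne (toList-inj (trans e (sym t′≡))))
      where
      t′ = path′ (ones size) (length-replicate size)
      t′≡ : toList t′ ≡ ones size
      t′≡ = toList-path′ (ones size) (length-replicate size)

  pt-first : PolyTimeFun (λ x → Words.first (m x))
  pt-first = pt-∷ false (pt-++ (pt-cong (λ x → cong zeros (eval-3p (length x))) (pt-poly (p ⊞ (p ⊞ p)))) (pt-const (true ∷ pair [] (proj₁ (successor [])))))

  pt-last : PolyTimeFun (λ x → ones (Words.size (m x)))
  pt-last = pt-cong (λ x → cong ones (trans (length-replicate (eval p′ (length x))) (sym (eval-p′ x)))) (pt-fill true (pt-poly p′))

  predecessor : Str → Str → Str → Bool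
  predecessor x u v = PTDec.test ptdec-Adjacent (pair x (pair u v))

  predecessor⇔ : ∀ x v w → (predecessor x (toList v) (toList w) ≡ true) ⇔ (h x v ≺lex h x w)
  predecessor⇔ x v w = mk⇔
    (λ e → ≺ₒ⇒≺lex x (⊏̇⇒≺ₒ x (Words.adjacent-covers (m x) (toList v) (toList w) (length-path′ x v) (length-path′ x w)
      (subst₂ Adjacent l≡ r≡ (PTDec.sound ptdec-Adjacent z e)))))
    (λ c → PTDec.complete ptdec-Adjacent z (subst₂ Adjacent (sym l≡) (sym r≡)
      (Words.covers-adjacent (m x) (toList v) (toList w) (length-path′ x v) (length-path′ x w) (≺ₒ⇒⊏̇ x (≺lex⇒≺ₒ x c)))))
    where
    z = pair x (pair (toList v) (toList w))
    l≡ : left (right z) ≡ toList v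
    l≡ = trans (cong left (right-pair x _)) (left-pair (toList v) (toList w))
    r≡ : right (right z) ≡ toList w
    r≡ = trans (cong right (right-pair x _)) (right-pair (toList v) (toList w))

CL⇒CLU : ∀ f → CL#P f → CLU#P f
CL⇒CLU f (M , A , eff , spec) =
  M′ , (λ x → Words.first (m x)) , (λ x → ones (Words.size (m x))) , predecessor , pt-first , pt-last ,
  ((λ z → PTDec.test ptdec-Adjacent z ∷ []) , PTDec.poly ptdec-Adjacent , λ _ _ _ → refl) ,
  λ x → bijection x , bottom x , top x , predecessor⇔ x ,
    (λ ne → interval x (proj₁ (spec x)) (λ e → ne (trans (f≡ x) e))) , f≡ x
  where
  open BalancedNPTM M using (m)
  open FromCL M A eff
  open Assemble M A eff
  f≡ : ∀ x → f x ≡ #acc M′ x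
  f≡ x = trans (proj₂ (spec x)) (#acc≡ x)

theorem3p1 : (f : Str → ℕ) → CLU#P f ⇔ CL#P f
theorem3p1 f = mk⇔ (CLU⇒CL f) (CL⇒CLU f)
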